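{- Let $n\ge 1$, $d\ge 1$ be integers. (1) If there is an $\mathbb{F}_2$-linear code $\mathcal{C}\subseteq\mathbb{F}_2^n$ of blocklength $n$, rate $k$ and distance $d$ with an $\varepsilon$-smooth local tester of soundness $\delta>0$, then there is a Cayley graph $\mathcal{G}=\mathrm{Cay}(\mathbb{F}_2^h,S)$ such that $|S|=n$, $h=n-k$, $S$ is $d$-wise linearly independent, and the shortest-path metric on $\mathcal{G}$ embeds into $\ell_1$ with distortion at most $\varepsilon/\delta$. (2) If there is a Cayley graph $\mathcal{G}=\mathrm{Cay}(\mathbb{F}_2^h,S)$ such that $|S|=n$, $S$ is $d$-wise linearly independent, and the shortest-path metric on $\mathcal{G}$ embeds into $\ell_1$ with distortion at most $c$, then there is an $\mathbb{F}_2$-linear code of blocklength $n$, rate $k=n-h$ and distance $d$ with an $\varepsilon$-smooth local tester of soundness $\delta$, for some $\varepsilon\ge 0$ and $\delta>0$ such that $\varepsilon/\delta\le c$.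
   Context: A code of blocklength $n$ is a linear subspace $\mathcal{C}\subseteq\mathbb{F}_2^n$; its rate is $k=\dim\mathcal{C}$. It has distance $d$ if every nonzero $c\in\mathcal{C}$ has Hamming weight at least $d$. For $r\in\mathbb{F}_2^n$, $d(r,\mathcal{C})=\min_{c\in\mathcal{C}}d(r,c)$ where $d(\cdot,\cdot)$ is Hamming distance. The dual code is $\mathcal{C}^\perp=\{\alpha\in\mathbb{F}_2^n:\alpha\cdot c=0\ \forall c\in\mathcal{C}\}$. A local tester for $\mathcal{C}$ is a probability distribution $\mathcal{D}$ on $\mathcal{C}^\perp$. It is $\varepsilon$-smooth if $\Pr_{\alpha\leftarrow\mathcal{D}}[\alpha_i=1]\le\varepsilon$ for every $i\in[n]$, and has soundness $\delta$ if $\Pr_{\alpha\leftarrow\mathcal{D}}[\alpha\cdot r=1]\ge\delta\cdot d(r,\mathcal{C})$ for every $r\in\mathbb{F}_2^n$. For a multiset (indexed family) $S=\{s_1,\dots,s_n\}$ of vectors spanning $\mathbb{F}_2^h$, $\mathrm{Cay}(\mathbb{F}_2^h,S)$ is the (multi)graph with vertex set $\mathbb{F}_2^h$ and edges $(x,x+s)$ for $x\in\mathbb{F}_2^h$, $s\in S$ (with multiplicity). $S$ is $d$-wise linearly independent if every subfamily of fewer than $d$ of its members is linearly independent over $\mathbb{F}_2$. An embedding of a metric space $(X_1,d_1)$ into a metric space $(X_2,d_2)$ with distortion $c$ is a map $f:X_1\to X_2$ such that for some $\alpha>0$, $\alpha\, d_1(x,y)\le d_2(f(x),f(y))\le c\,\alpha\,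 d_1(x,y)$ for all $x,y\in X_1$ (necessarily $c\ge 1$ once $X_1$ has two points). Embedding into $\ell_1$ means that $X_2=\mathbb{R}^m$ for some $m$ with the $\ell_1$ norm metric.
   Formalization: A distortion is required to be nonnegative; without this, part (2) fails for the one-vertex graph (h = 0) with negative c, since ε/δ ≤ c is then impossible for ε ≥ 0 and δ > 0; for h ≥ 1 the requirement is automatic. -}

module Defs where

open import Algebra.Bundles using (RawMonoid)
import Algebra.Definitions.RawMonoid as RawMonoidDefs
open import Data.Bool.Base using (Bool; true; false; _∧_; _xor_; if_then_else_)
open import Data.Bool.Properties using (T?)
open import Data.Fin.Base using (Fin)
open import Data.Integer.Base using (+_)
open import Data.Nat.Base as ℕ using (ℕ; zero; suc)
import Data.Nat.Properties as ℕ
open import Data.Product using (Σ; ∃; ∃-syntax; _×_; _,_; proj₁; proj₂)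
open import Data.Rational.Base as ℚ using (ℚ; 0ℚ; 1ℚ; ½)
import Data.Rational.Properties as ℚ
open import Data.Rational.Solver using (module +-*-Solver)
open import Data.Sum.Base using (inj₁; inj₂)
open import Data.Vec.Base using (Vec; []; _∷_; lookup; map; zipWith; replicate; count; foldr′)
open import Function.Base using (_∘_)
open import Function.Definitions using (Injective)
open import Level using (0ℓ)
open import Relation.Binary.PropositionalEquality
open import Relation.Nullary.Negation using (¬_)
open import Relation.Unary using (Pred; _∈_)

------------------------------------------------------------------------
-- Cauchy real numbers

-- The standard library has no real numbers.  A real is a Cauchy sequence
-- of rationals; equality is the relation _≈ℝ_, not _≡_.

IsCauchy : (ℕ → ℚ) → Set
IsCauchy s = ∀ e → 0ℚ ℚ.< e →
  ∃[ N ] (∀ m n → N ℕ.≤ m → N ℕ.≤ n → ℚ.∣ s m ℚ.- s n ∣ ℚ.< e)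

record ℝ : Set where
  constructor mkℝ
  field
    seq    : ℕ → ℚ
    cauchy : IsCauchy seq

open ℝ public

infix 4 _≈ℝ_ _≤ℝ_ _<ℝ_

_≈ℝ_ : ℝ → ℝ → Set
x ≈ℝ y = ∀ e → 0ℚ ℚ.< e →
  ∃[ N ] (∀ n → N ℕ.≤ n → ℚ.∣ seq x n ℚ.- seq y n ∣ ℚ.< e)

_≤ℝ_ : ℝ → ℝ → Set
x ≤ℝ y = ∀ e → 0ℚ ℚ.< e →
  ∃[ N ] (∀ n → N ℕ.≤ n → seq x n ℚ.≤ seq y n ℚ.+ e)

_<ℝ_ : ℝ → ℝ → Set
x <ℝ y = ∃[ q ] (0ℚ ℚ.< q ×
  ∃[ N ] (∀ n → N ℕ.≤ n → seq x n ℚ.+ q ℚ.≤ seq y n))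

-- Real operations are applied termwise; the next lemma is used to show that
-- the result is again Cauchy.

lipschitz-cauchy : ∀ a b s → IsCauchy a → IsCauchy b →
  ∀ K → 0ℚ ℚ.< K → ∀ N₀ →
  (∀ m n → N₀ ℕ.≤ m → N₀ ℕ.≤ n →
    ℚ.∣ s m ℚ.- s n ∣ ℚ.≤ K ℚ.* (ℚ.∣ a m ℚ.- a n ∣ ℚ.+ ℚ.∣ b m ℚ.- b n ∣)) →
  IsCauchy s
lipschitz-cauchy a b s a-cauchy b-cauchy K K>0 N₀ bound e e>0 =
  N , close
  where
  open ℚ.≤-Reasoning
  instance
    K-pos : ℚ.Positive K
    K-pos = ℚ.positive K>0
    K-nonZero : ℚ.NonZero K
    K-nonZero = ℚ.pos⇒nonZero K
    e-pos : ℚ.Positive e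
    e-pos = ℚ.positive e>0
    K⁻¹-pos : ℚ.Positive (ℚ.1/ K)
    K⁻¹-pos = ℚ.1/pos⇒pos K
    e½-pos : ℚ.Positive (½ ℚ.* e)
    e½-pos = ℚ.pos*pos⇒pos ½ e
    e′-pos : ℚ.Positive (ℚ.1/ K ℚ.* (½ ℚ.* e))
    e′-pos = ℚ.pos*pos⇒pos (ℚ.1/ K) (½ ℚ.* e)

  e′ : ℚ
  e′ = ℚ.1/ K ℚ.* (½ ℚ.* e)

  Na Nb N : ℕ
  Na = proj₁ (a-cauchy e′ (ℚ.positive⁻¹ e′))
  Nb = proj₁ (b-cauchy e′ (ℚ.positive⁻¹ e′))
  N  = N₀ ℕ.⊔ (Na ℕ.⊔ Nb)

  N₀≤N : N₀ ℕ.≤ N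
  N₀≤N = ℕ.m≤m⊔n N₀ _
  Na≤N : Na ℕ.≤ N
  Na≤N = ℕ.≤-trans (ℕ.m≤m⊔n Na Nb) (ℕ.m≤n⊔m N₀ _)
  Nb≤N : Nb ℕ.≤ N
  Nb≤N = ℕ.≤-trans (ℕ.m≤n⊔m Na Nb) (ℕ.m≤n⊔m N₀ _)

  e′+e′ : K ℚ.* (e′ ℚ.+ e′) ≡ e
  e′+e′ = begin-equality
    K ℚ.* (e′ ℚ.+ e′)
      ≡⟨ solve 3 (λ k j x → k :* (j :* (con ½ :* x) :+ j :* (con ½ :* x))
                            := (k :* j) :* x) refl K (ℚ.1/ K) e ⟩
    (K ℚ.* ℚ.1/ K) ℚ.* e  ≡⟨ cong (ℚ._* e) (ℚ.*-inverseʳ K) ⟩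
    1ℚ ℚ.* e              ≡⟨ ℚ.*-identityˡ e ⟩
    e                     ∎
    where open +-*-Solver

  close : ∀ m n → N ℕ.≤ m → N ℕ.≤ n → ℚ.∣ s m ℚ.- s n ∣ ℚ.< e
  close m n N≤m N≤n = begin-strict
    ℚ.∣ s m ℚ.- s n ∣
      ≤⟨ bound m n (ℕ.≤-trans N₀≤N N≤m) (ℕ.≤-trans N₀≤N N≤n) ⟩
    K ℚ.* (ℚ.∣ a m ℚ.- a n ∣ ℚ.+ ℚ.∣ b m ℚ.- b n ∣)
      <⟨ ℚ.*-monoʳ-<-pos K (ℚ.+-mono-<
           (proj₂ (a-cauchy e′ (ℚ.positive⁻¹ e′)) m n (ℕ.≤-trans Na≤N N≤m) (ℕ.≤-trans Na≤N N≤n))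
           (proj₂ (b-cauchy e′ (ℚ.positive⁻¹ e′)) m n (ℕ.≤-trans Nb≤N N≤m) (ℕ.≤-trans Nb≤N N≤n))) ⟩
    K ℚ.* (e′ ℚ.+ e′)  ≡⟨ e′+e′ ⟩
    e                  ∎

lipschitz-cauchy₁ : ∀ a s → IsCauchy a → ∀ K → 0ℚ ℚ.< K → ∀ N₀ →
  (∀ m n → N₀ ℕ.≤ m → N₀ ℕ.≤ n →
    ℚ.∣ s m ℚ.- s n ∣ ℚ.≤ K ℚ.* ℚ.∣ a m ℚ.- a n ∣) →
  IsCauchy s
lipschitz-cauchy₁ a s a-cauchy K K>0 N₀ bound =
  lipschitz-cauchy a a s a-cauchy a-cauchy K K>0 N₀ λ m n N₀≤m N₀≤n →
    ℚ.≤-trans (bound m n N₀≤m N₀≤n)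
      (ℚ.*-monoˡ-≤-nonNeg K {{ℚ.nonNegative (ℚ.<⇒≤ K>0)}}
        (p≤p+∣q∣ ℚ.∣ a m ℚ.- a n ∣ (a m ℚ.- a n)))
  where
  p≤p+∣q∣ : ∀ p q → p ℚ.≤ p ℚ.+ ℚ.∣ q ∣
  p≤p+∣q∣ p q = subst (ℚ._≤ p ℚ.+ ℚ.∣ q ∣) (ℚ.+-identityʳ p)
    (ℚ.+-monoʳ-≤ p (ℚ.nonNegative⁻¹ ℚ.∣ q ∣ {{ℚ.∣-∣-nonNeg q}}))

fromℚ : ℚ → ℝ
fromℚ q = mkℝ (λ _ → q) λ e e>0 → 0 , λ _ _ _ _ →
  subst (λ z → ℚ.∣ z ∣ ℚ.< e) (sym (ℚ.+-inverseʳ q)) e>0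

fromℕ : ℕ → ℝ
fromℕ n = fromℚ (+ n ℚ./ 1)

0ℝ 1ℝ : ℝ
0ℝ = fromℚ 0ℚ
1ℝ = fromℚ 1ℚ

0<1 : 0ℚ ℚ.< 1ℚ
0<1 = ℚ.positive⁻¹ 1ℚ

infixl 6 _+ℝ_ _-ℝ_
infixl 7 _*ℝ_ _÷ℝ_[_]
infix  8 -ℝ_

_+ℝ_ : ℝ → ℝ → ℝ
x +ℝ y = mkℝ (λ n → seq x n ℚ.+ seq y n)
  (lipschitz-cauchy (seq x) (seq y) (λ n → seq x n ℚ.+ seq y n)
    (cauchy x) (cauchy y) 1ℚ 0<1 0 λ m n _ _ →
    let a = seq x m; a′ = seq x n; b = seq y m; b′ = seq y n in begin
    ℚ.∣ (a ℚ.+ b) ℚ.- (a′ ℚ.+ b′) ∣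
      ≡⟨ cong ℚ.∣_∣ (solve 4 (λ a b a′ b′ → (a :+ b) :- (a′ :+ b′)
           := (a :- a′) :+ (b :- b′)) refl a b a′ b′) ⟩
    ℚ.∣ (a ℚ.- a′) ℚ.+ (b ℚ.- b′) ∣
      ≤⟨ ℚ.∣p+q∣≤∣p∣+∣q∣ (a ℚ.- a′) (b ℚ.- b′) ⟩
    ℚ.∣ a ℚ.- a′ ∣ ℚ.+ ℚ.∣ b ℚ.- b′ ∣
      ≡⟨ ℚ.*-identityˡ _ ⟨
    1ℚ ℚ.* (ℚ.∣ a ℚ.- a′ ∣ ℚ.+ ℚ.∣ b ℚ.- b′ ∣) ∎)
  where
  open ℚ.≤-Reasoning
  open +-*-Solver

-ℝ_ : ℝ → ℝ
-ℝ x = mkℝ (λ n → ℚ.- seq x n)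
  (lipschitz-cauchy₁ (seq x) (λ n → ℚ.- seq x n) (cauchy x) 1ℚ 0<1 0 λ m n _ _ →
    let a = seq x m; a′ = seq x n in begin
    ℚ.∣ ℚ.- a ℚ.- ℚ.- a′ ∣  ≡⟨ cong ℚ.∣_∣ (ℚ.neg-distrib-+ a (ℚ.- a′)) ⟨
    ℚ.∣ ℚ.- (a ℚ.- a′) ∣    ≡⟨ ℚ.∣-p∣≡∣p∣ (a ℚ.- a′) ⟩
    ℚ.∣ a ℚ.- a′ ∣          ≡⟨ ℚ.*-identityˡ _ ⟨
    1ℚ ℚ.* ℚ.∣ a ℚ.- a′ ∣   ∎)
  where open ℚ.≤-Reasoning

_-ℝ_ : ℝ → ℝ → ℝ
x -ℝ y = x +ℝ (-ℝ y)

∣p∣-∣q∣≤∣p-q∣ : ∀ p q → ℚ.∣ p ∣ ℚ.- ℚ.∣ q ∣ ℚ.≤ ℚ.∣ p ℚ.- q ∣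
∣p∣-∣q∣≤∣p-q∣ p q = begin
  ℚ.∣ p ∣ ℚ.- ℚ.∣ q ∣
    ≡⟨ cong (λ z → ℚ.∣ z ∣ ℚ.- ℚ.∣ q ∣)
         (solve 2 (λ p q → p := (p :- q) :+ q) refl p q) ⟩
  ℚ.∣ (p ℚ.- q) ℚ.+ q ∣ ℚ.- ℚ.∣ q ∣
    ≤⟨ ℚ.+-monoˡ-≤ (ℚ.- ℚ.∣ q ∣) (ℚ.∣p+q∣≤∣p∣+∣q∣ (p ℚ.- q) q) ⟩
  (ℚ.∣ p ℚ.- q ∣ ℚ.+ ℚ.∣ q ∣) ℚ.- ℚ.∣ q ∣
    ≡⟨ solve 2 (λ a b → (a :+ b) :- b := a) refl ℚ.∣ p ℚ.- q ∣ ℚ.∣ q ∣ ⟩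
  ℚ.∣ p ℚ.- q ∣ ∎
  where
  open ℚ.≤-Reasoning
  open +-*-Solver

∣p-q∣≡∣q-p∣ : ∀ p q → ℚ.∣ p ℚ.- q ∣ ≡ ℚ.∣ q ℚ.- p ∣
∣p-q∣≡∣q-p∣ p q = trans
  (cong ℚ.∣_∣ (solve 2 (λ p q → p :- q := :- (q :- p)) refl p q))
  (ℚ.∣-p∣≡∣p∣ (q ℚ.- p))
  where open +-*-Solver

∣∣p∣-∣q∣∣≤∣p-q∣ : ∀ p q → ℚ.∣ ℚ.∣ p ∣ ℚ.- ℚ.∣ q ∣ ∣ ℚ.≤ ℚ.∣ p ℚ.- q ∣
∣∣p∣-∣q∣∣≤∣p-q∣ p q with ℚ.∣p∣≡p∨∣p∣≡-p (ℚ.∣ p ∣ ℚ.- ℚ.∣ q ∣)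
... | inj₁ eq = subst (ℚ._≤ ℚ.∣ p ℚ.- q ∣) (sym eq) (∣p∣-∣q∣≤∣p-q∣ p q)
... | inj₂ eq = subst₂ ℚ._≤_
  (trans (solve 2 (λ a b → b :- a := :- (a :- b)) refl ℚ.∣ p ∣ ℚ.∣ q ∣) (sym eq))
  (∣p-q∣≡∣q-p∣ q p)
  (∣p∣-∣q∣≤∣p-q∣ q p)
  where open +-*-Solver

∣_∣ℝ : ℝ → ℝ
∣ x ∣ℝ = mkℝ (λ n → ℚ.∣ seq x n ∣)
  (lipschitz-cauchy₁ (seq x) (λ n → ℚ.∣ seq x n ∣) (cauchy x) 1ℚ 0<1 0 λ m n _ _ →
    subst (ℚ.∣ ℚ.∣ seq x m ∣ ℚ.- ℚ.∣ seq x n ∣ ∣ ℚ.≤_) (sym (ℚ.*-identityˡ _))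
      (∣∣p∣-∣q∣∣≤∣p-q∣ (seq x m) (seq x n)))

EventuallyBounded : (ℕ → ℚ) → Set
EventuallyBounded s =
  ∃[ N ] ∃[ B ] (0ℚ ℚ.< B × (∀ n → N ℕ.≤ n → ℚ.∣ s n ∣ ℚ.≤ B))

eventually-bounded : ∀ x → EventuallyBounded (seq x)
eventually-bounded x = N , B , B>0 , bound
  where
  open ℚ.≤-Reasoning
  open +-*-Solver
  N = proj₁ (cauchy x 1ℚ 0<1)
  c = seq x N
  B = 1ℚ ℚ.+ ℚ.∣ c ∣
  B>0 : 0ℚ ℚ.< B
  B>0 = ℚ.+-mono-<-≤ 0<1 (ℚ.nonNegative⁻¹ ℚ.∣ c ∣ {{ℚ.∣-∣-nonNeg c}})
  bound : ∀ n → N ℕ.≤ n → ℚ.∣ seq x n ∣ ℚ.≤ B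
  bound n N≤n = begin
    ℚ.∣ seq x n ∣
      ≡⟨ cong ℚ.∣_∣ (solve 2 (λ p q → p := (p :- q) :+ q) refl (seq x n) c) ⟩
    ℚ.∣ (seq x n ℚ.- c) ℚ.+ c ∣
      ≤⟨ ℚ.∣p+q∣≤∣p∣+∣q∣ (seq x n ℚ.- c) c ⟩
    ℚ.∣ seq x n ℚ.- c ∣ ℚ.+ ℚ.∣ c ∣
      ≤⟨ ℚ.+-monoˡ-≤ ℚ.∣ c ∣ (ℚ.<⇒≤ (proj₂ (cauchy x 1ℚ 0<1) n N N≤n ℕ.≤-refl)) ⟩
    B ∎

product-difference : ∀ a a′ b b′ A B → 0ℚ ℚ.< A → 0ℚ ℚ.< B →
  ℚ.∣ a′ ∣ ℚ.≤ A → ℚ.∣ b ∣ ℚ.≤ B →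
  ℚ.∣ a ℚ.* b ℚ.- a′ ℚ.* b′ ∣ ℚ.≤ (A ℚ.+ B) ℚ.* (ℚ.∣ a ℚ.- a′ ∣ ℚ.+ ℚ.∣ b ℚ.- b′ ∣)
product-difference a a′ b b′ A B A>0 B>0 a′≤A b≤B = begin
  ℚ.∣ a ℚ.* b ℚ.- a′ ℚ.* b′ ∣
    ≡⟨ cong ℚ.∣_∣ (solve 4 (λ a b a′ b′ → a :* b :- a′ :* b′
         := b :* (a :- a′) :+ a′ :* (b :- b′)) refl a b a′ b′) ⟩
  ℚ.∣ b ℚ.* (a ℚ.- a′) ℚ.+ a′ ℚ.* (b ℚ.- b′) ∣
    ≤⟨ ℚ.∣p+q∣≤∣p∣+∣q∣ (b ℚ.* (a ℚ.- a′)) (a′ ℚ.* (b ℚ.- b′)) ⟩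
  ℚ.∣ b ℚ.* (a ℚ.- a′) ∣ ℚ.+ ℚ.∣ a′ ℚ.* (b ℚ.- b′) ∣
    ≡⟨ cong₂ ℚ._+_ (ℚ.∣p*q∣≡∣p∣*∣q∣ b (a ℚ.- a′)) (ℚ.∣p*q∣≡∣p∣*∣q∣ a′ (b ℚ.- b′)) ⟩
  ℚ.∣ b ∣ ℚ.* ℚ.∣ a ℚ.- a′ ∣ ℚ.+ ℚ.∣ a′ ∣ ℚ.* ℚ.∣ b ℚ.- b′ ∣
    ≤⟨ ℚ.+-mono-≤
         (ℚ.*-monoʳ-≤-nonNeg ℚ.∣ a ℚ.- a′ ∣ {{ℚ.∣-∣-nonNeg (a ℚ.- a′)}} (ℚ.≤-trans b≤B B≤A+B))
         (ℚ.*-monoʳ-≤-nonNeg ℚ.∣ b ℚ.- b′ ∣ {{ℚ.∣-∣-nonNeg (b ℚ.- b′)}} (ℚ.≤-trans a′≤A A≤A+B)) ⟩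
  (A ℚ.+ B) ℚ.* ℚ.∣ a ℚ.- a′ ∣ ℚ.+ (A ℚ.+ B) ℚ.* ℚ.∣ b ℚ.- b′ ∣
    ≡⟨ ℚ.*-distribˡ-+ (A ℚ.+ B) ℚ.∣ a ℚ.- a′ ∣ ℚ.∣ b ℚ.- b′ ∣ ⟨
  (A ℚ.+ B) ℚ.* (ℚ.∣ a ℚ.- a′ ∣ ℚ.+ ℚ.∣ b ℚ.- b′ ∣) ∎
  where
  open ℚ.≤-Reasoning
  open +-*-Solver
  A≤A+B : A ℚ.≤ A ℚ.+ B
  A≤A+B = subst (ℚ._≤ A ℚ.+ B) (ℚ.+-identityʳ A) (ℚ.+-monoʳ-≤ A (ℚ.<⇒≤ B>0))
  B≤A+B : B ℚ.≤ A ℚ.+ B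
  B≤A+B = subst (ℚ._≤ A ℚ.+ B) (ℚ.+-identityˡ B) (ℚ.+-monoˡ-≤ B (ℚ.<⇒≤ A>0))

*-cauchy : ∀ {a b} → IsCauchy a → IsCauchy b →
  EventuallyBounded a → EventuallyBounded b → IsCauchy (λ n → a n ℚ.* b n)
*-cauchy {a} {b} a-cauchy b-cauchy (M , A , A>0 , a≤A) (N , B , B>0 , b≤B) =
  lipschitz-cauchy a b (λ n → a n ℚ.* b n) a-cauchy b-cauchy (A ℚ.+ B)
    (ℚ.+-mono-< A>0 B>0) (M ℕ.⊔ N) λ m n M⊔N≤m M⊔N≤n →
      product-difference (a m) (a n) (b m) (b n) A B A>0 B>0
        (a≤A n (ℕ.≤-trans (ℕ.m≤m⊔n M N) M⊔N≤n))
        (b≤B m (ℕ.≤-trans (ℕ.m≤n⊔m M N) M⊔N≤m))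

_*ℝ_ : ℝ → ℝ → ℝ
x *ℝ y = mkℝ (λ n → seq x n ℚ.* seq y n)
  (*-cauchy (cauchy x) (cauchy y) (eventually-bounded x) (eventually-bounded y))

inverse-difference : ∀ a b u v r → 0ℚ ℚ.< u → 0ℚ ℚ.< v →
  u ℚ.* a ≡ 1ℚ → v ℚ.* b ≡ 1ℚ → u ℚ.≤ r → v ℚ.≤ r →
  ℚ.∣ u ℚ.- v ∣ ℚ.≤ (r ℚ.* r) ℚ.* ℚ.∣ a ℚ.- b ∣
inverse-difference a b u v r u>0 v>0 ua≡1 vb≡1 u≤r v≤r = begin
  ℚ.∣ u ℚ.- v ∣
    ≡⟨ cong ℚ.∣_∣ (cong₂ ℚ._-_ (sym (ℚ.*-identityʳ u)) (sym (ℚ.*-identityʳ v))) ⟩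
  ℚ.∣ u ℚ.* 1ℚ ℚ.- v ℚ.* 1ℚ ∣
    ≡⟨ cong ℚ.∣_∣ (cong₂ (λ y z → u ℚ.* y ℚ.- v ℚ.* z) (sym vb≡1) (sym ua≡1)) ⟩
  ℚ.∣ u ℚ.* (v ℚ.* b) ℚ.- v ℚ.* (u ℚ.* a) ∣
    ≡⟨ cong ℚ.∣_∣ (solve 4 (λ u v a b → u :* (v :* b) :- v :* (u :* a)
         := (u :* v) :* (b :- a)) refl u v a b) ⟩
  ℚ.∣ (u ℚ.* v) ℚ.* (b ℚ.- a) ∣
    ≡⟨ ℚ.∣p*q∣≡∣p∣*∣q∣ (u ℚ.* v) (b ℚ.- a) ⟩
  ℚ.∣ u ℚ.* v ∣ ℚ.* ℚ.∣ b ℚ.- a ∣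
    ≡⟨ cong₂ ℚ._*_ (ℚ.0≤p⇒∣p∣≡p (ℚ.<⇒≤ (ℚ.positive⁻¹ (u ℚ.* v)
         {{ℚ.pos*pos⇒pos u v}}))) (∣p-q∣≡∣q-p∣ b a) ⟩
  (u ℚ.* v) ℚ.* ℚ.∣ a ℚ.- b ∣
    ≤⟨ ℚ.*-monoʳ-≤-nonNeg ℚ.∣ a ℚ.- b ∣ {{ℚ.∣-∣-nonNeg (a ℚ.- b)}} (ℚ.≤-trans
         (ℚ.*-monoʳ-≤-nonNeg v {{ℚ.pos⇒nonNeg v}} u≤r)
         (ℚ.*-monoˡ-≤-nonNeg r
           {{ℚ.nonNegative (ℚ.≤-trans (ℚ.<⇒≤ u>0) u≤r)}} v≤r)) ⟩
  (r ℚ.* r) ℚ.* ℚ.∣ a ℚ.- b ∣ ∎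
  where
  open ℚ.≤-Reasoning
  open +-*-Solver
  instance
    u-pos : ℚ.Positive u
    u-pos = ℚ.positive u>0
    v-pos : ℚ.Positive v
    v-pos = ℚ.positive v>0

-- The reciprocal truncates the terms of a positive real from below at the
-- rational lower bound q carried by its positivity proof, which the terms
-- exceed from some index on.

truncated-nonZero : ∀ {q} p → 0ℚ ℚ.< q → ℚ.NonZero (q ℚ.⊔ p)
truncated-nonZero {q} p q>0 = ℚ.>-nonZero (ℚ.<-≤-trans q>0 (ℚ.p≤p⊔q q p))

module Reciprocal (x : ℝ) (x>0 : 0ℝ <ℝ x) where

  q : ℚ
  q = proj₁ x>0

  q>0 : 0ℚ ℚ.< q
  q>0 = proj₁ (proj₂ x>0)

  instance
    q-pos : ℚ.Positive q
    q-pos = ℚ.positive q>0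
    q-nonZero : ℚ.NonZero q
    q-nonZero = ℚ.pos⇒nonZero q
    q⁻¹-pos : ℚ.Positive (ℚ.1/ q)
    q⁻¹-pos = ℚ.1/pos⇒pos q

  terms : ℕ → ℚ
  terms n = (ℚ.1/ (q ℚ.⊔ seq x n)) {{truncated-nonZero (seq x n) q>0}}

  module _ (n : ℕ) where
    private
      t : ℚ
      t = q ℚ.⊔ seq x n
      instance
        t-nonZero : ℚ.NonZero t
        t-nonZero = truncated-nonZero (seq x n) q>0
        t-pos : ℚ.Positive t
        t-pos = ℚ.positive (ℚ.<-≤-trans q>0 (ℚ.p≤p⊔q q (seq x n)))

    terms-inverse : terms n ℚ.* t ≡ 1ℚ
    terms-inverse = ℚ.*-inverseˡ t

    terms-pos : ℚ.Positive (terms n)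
    terms-pos = ℚ.1/pos⇒pos t

    terms≤q⁻¹ : terms n ℚ.≤ ℚ.1/ q
    terms≤q⁻¹ = ℚ.*-cancelʳ-≤-pos q (begin
      terms n ℚ.* q  ≤⟨ ℚ.*-monoˡ-≤-nonNeg (terms n)
                          {{ℚ.pos⇒nonNeg (terms n) {{terms-pos}}}} (ℚ.p≤p⊔q q (seq x n)) ⟩
      terms n ℚ.* t  ≡⟨ terms-inverse ⟩
      1ℚ             ≡⟨ ℚ.*-inverseˡ q ⟨
      ℚ.1/ q ℚ.* q   ∎)
      where open ℚ.≤-Reasoning

  N₀ : ℕ
  N₀ = proj₁ (proj₂ (proj₂ x>0))

  truncated≡ : ∀ n → N₀ ℕ.≤ n → q ℚ.⊔ seq x n ≡ seq x n
  truncated≡ n N₀≤n = ℚ.p≤q⇒p⊔q≡q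
    (subst (ℚ._≤ seq x n) (ℚ.+-identityˡ q) (proj₂ (proj₂ (proj₂ x>0)) n N₀≤n))

  terms-cauchy : IsCauchy terms
  terms-cauchy = lipschitz-cauchy₁ (seq x) terms (cauchy x) (ℚ.1/ q ℚ.* ℚ.1/ q)
    (ℚ.positive⁻¹ _ {{ℚ.pos*pos⇒pos (ℚ.1/ q) (ℚ.1/ q)}}) N₀ bound
    where
    inverse : ∀ n → N₀ ℕ.≤ n → terms n ℚ.* seq x n ≡ 1ℚ
    inverse n N₀≤n =
      trans (cong (terms n ℚ.*_) (sym (truncated≡ n N₀≤n))) (terms-inverse n)

    bound : ∀ m n → N₀ ℕ.≤ m → N₀ ℕ.≤ n →
      ℚ.∣ terms m ℚ.- terms n ∣ ℚ.≤ (ℚ.1/ q ℚ.* ℚ.1/ q) ℚ.* ℚ.∣ seq x m ℚ.- seq x n ∣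
    bound m n N₀≤m N₀≤n = inverse-difference
      (seq x m) (seq x n) (terms m) (terms n) (ℚ.1/ q)
      (ℚ.positive⁻¹ _ {{terms-pos m}}) (ℚ.positive⁻¹ _ {{terms-pos n}})
      (inverse m N₀≤m) (inverse n N₀≤n) (terms≤q⁻¹ m) (terms≤q⁻¹ n)

  reciprocal : ℝ
  reciprocal = mkℝ terms terms-cauchy

_÷ℝ_[_] : (x y : ℝ) → 0ℝ <ℝ y → ℝ
x ÷ℝ y [ y>0 ] = x *ℝ Reciprocal.reciprocal y y>0

+-0-rawMonoid : RawMonoid 0ℓ 0ℓ
+-0-rawMonoid = record { Carrier = ℝ ; _≈_ = _≈ℝ_ ; _∙_ = _+ℝ_ ; ε = 0ℝ }

open RawMonoidDefs +-0-rawMonoid public using () renaming (sum to sumℝ)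

------------------------------------------------------------------------
-- Linear algebra over 𝔽₂

-- 𝔽₂ is Bool with addition _xor_ and multiplication _∧_.
𝔽₂ : Set
𝔽₂ = Bool

infix 9 𝔽₂^_
𝔽₂^_ : ℕ → Set
𝔽₂^ n = Vec 𝔽₂ n

private
  variable
    h k n : ℕ

infixl 6 _⊕_
infixr 7 _⊙_
infix  7 _∙_

𝟎 : 𝔽₂^ n
𝟎 = replicate _ false

_⊕_ : 𝔽₂^ n → 𝔽₂^ n → 𝔽₂^ n
_⊕_ = zipWith _xor_

_⊙_ : 𝔽₂ → 𝔽₂^ n → 𝔽₂^ n
a ⊙ v = map (a ∧_) v

_∙_ : 𝔽₂^ n → 𝔽₂^ n → 𝔽₂
u ∙ v = foldr′ _xor_ false (zipWith _∧_ u v)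

⊕-rawMonoid : ℕ → RawMonoid 0ℓ 0ℓ
⊕-rawMonoid n = record { Carrier = 𝔽₂^ n ; _≈_ = _≡_ ; _∙_ = _⊕_ ; ε = 𝟎 }

lincomb : (Fin k → 𝔽₂) → (Fin k → 𝔽₂^ n) → 𝔽₂^ n
lincomb {n = n} a v = RawMonoidDefs.sum (⊕-rawMonoid n) (λ i → a i ⊙ v i)

LinearlyIndependent : (Fin k → 𝔽₂^ n) → Set
LinearlyIndependent v = ∀ a → lincomb a v ≡ 𝟎 → ∀ i → a i ≡ false

Spanning : (Fin k → 𝔽₂^ n) → Set
Spanning v = ∀ x → ∃[ a ] lincomb a v ≡ x

WiseIndependent : ℕ → (Fin n → 𝔽₂^ h) → Set
WiseIndependent {n} d S = ∀ j → j ℕ.< d → (ι : Fin j → Fin n) →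
  Injective _≡_ _≡_ ι → LinearlyIndependent (S ∘ ι)

------------------------------------------------------------------------
-- Codes and local testers

weight : 𝔽₂^ n → ℕ
weight = count T?

-- x ⊕ y is nonzero exactly at the coordinates where x and y differ.
hamming : 𝔽₂^ n → 𝔽₂^ n → ℕ
hamming x y = weight (x ⊕ y)

IsMinimum : Pred ℕ 0ℓ → ℕ → Set
IsMinimum P m = P m × (∀ j → P j → m ℕ.≤ j)

record LinearCode (n : ℕ) : Set₁ where
  field
    words    : Pred (𝔽₂^ n) 0ℓ
    𝟎-closed : 𝟎 ∈ words
    ⊕-closed : ∀ {u v} → u ∈ words → v ∈ words → u ⊕ v ∈ words
    ⊙-closed : ∀ a {v} → v ∈ words → a ⊙ v ∈ words

open LinearCode public

HasRate : LinearCode n → ℕ → Set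
HasRate {n} C k = Σ (Fin k → 𝔽₂^ n) λ b →
  (∀ i → b i ∈ words C) × LinearlyIndependent b ×
  (∀ v → v ∈ words C → ∃[ a ] lincomb a b ≡ v)

HasDistance : LinearCode n → ℕ → Set
HasDistance C d = ∀ v → v ∈ words C → ¬ v ≡ 𝟎 → d ℕ.≤ weight v

IsDistanceToCode : 𝔽₂^ n → LinearCode n → ℕ → Set
IsDistanceToCode r C = IsMinimum (λ w → ∃[ c ] (c ∈ words C × hamming r c ≡ w))

dual : LinearCode n → Pred (𝔽₂^ n) 0ℓ
dual C α = ∀ c → c ∈ words C → α ∙ c ≡ false

∑ : (𝔽₂^ n → ℝ) → ℝ
∑ {zero}  f = f []
∑ {suc n} f = ∑ (λ v → f (false ∷ v)) +ℝ ∑ (λ v → f (true ∷ v))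

record LocalTester (C : LinearCode n) : Set where
  field
    mass     : 𝔽₂^ n → ℝ
    mass-≥0  : ∀ α → 0ℝ ≤ℝ mass α
    mass-sum : ∑ mass ≈ℝ 1ℝ
    support  : ∀ α → ¬ α ∈ dual C → mass α ≈ℝ 0ℝ

open LocalTester public

Pr : {C : LinearCode n} → LocalTester C → (𝔽₂^ n → Bool) → ℝ
Pr D event = ∑ (λ α → if event α then mass D α else 0ℝ)

IsSmooth : {C : LinearCode n} → LocalTester C → ℝ → Set
IsSmooth {n} D ε = ∀ (i : Fin n) → Pr D (λ α → lookup α i) ≤ℝ ε

HasSoundness : {C : LinearCode n} → LocalTester C → ℝ → Set
HasSoundness {C = C} D δ = ∀ r m → IsDistanceToCode r C m →
  δ *ℝ fromℕ m ≤ℝ Pr D (λ α → α ∙ r)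

------------------------------------------------------------------------
-- Cayley graphs and embeddings into ℓ₁

record Multigraph : Set₁ where
  field
    Vertex        : Set
    Edge          : Set
    source target : Edge → Vertex

data Walk (G : Multigraph) : (x y : Multigraph.Vertex G) → ℕ → Set where
  stop : ∀ {x} → Walk G x x 0
  step : ∀ {y ℓ} (e : Multigraph.Edge G) → Walk G (Multigraph.target G e) y ℓ →
         Walk G (Multigraph.source G e) y (suc ℓ)

IsShortestPathMetric : (G : Multigraph) →
  (Multigraph.Vertex G → Multigraph.Vertex G → ℕ) → Set
IsShortestPathMetric G ρ = ∀ x y → IsMinimum (Walk G x y) (ρ x y)

-- Each undirected edge {x , x ⊕ s} is present in both orientations, as
-- x ⊕ s ⊕ s ≡ x.
Cay : ∀ h → (Fin n → 𝔽₂^ h) → Multigraph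
Cay {n} h S = record
  { Vertex = 𝔽₂^ h
  ; Edge   = 𝔽₂^ h × Fin n
  ; source = proj₁
  ; target = λ (x , i) → x ⊕ S i
  }

ℓ₁ : ∀ {m} → (u v : Fin m → ℝ) → ℝ
ℓ₁ u v = sumℝ (λ i → ∣ u i -ℝ v i ∣ℝ)

-- A distortion is a nonnegative number.  This has to be required only for
-- one-point spaces, where the two inequalities do not constrain c.
IsEmbedding : {X₁ X₂ : Set} → (X₁ → X₁ → ℝ) → (X₂ → X₂ → ℝ) →
  (X₁ → X₂) → ℝ → Set
IsEmbedding d₁ d₂ f c = 0ℝ ≤ℝ c × ∃[ α ] (0ℝ <ℝ α × (∀ x y →
  α *ℝ d₁ x y ≤ℝ d₂ (f x) (f y) × d₂ (f x) (f y) ≤ℝ (c *ℝ α) *ℝ d₁ x y))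

EmbedsIntoℓ₁ : {X : Set} → (X → X → ℝ) → ℝ → Set
EmbedsIntoℓ₁ {X} dist c = ∃[ m ] Σ (X → Fin m → ℝ) λ f →
  ∃[ c′ ] (c′ ≤ℝ c × IsEmbedding dist ℓ₁ f c′)

ShortestPathEmbedsIntoℓ₁ : Multigraph → ℝ → Set
ShortestPathEmbedsIntoℓ₁ G c = ∃[ ρ ]
  (IsShortestPathMetric G ρ × EmbedsIntoℓ₁ (λ x y → fromℕ (ρ x y)) c)

{-# OPTIONS --safe #-}

-- A family S of n vectors spanning 𝔽₂^h is the parity check matrix of the code ker S.  A walk from x to y
-- in Cay(𝔽₂^h, S) is a vector r with S r = x ⊕ y, so the graph distance of x and y is the distance of any
-- such r to the code.
--
-- A tester with masses μ embeds the graph: the coordinate of x at α is μ(α) [α · r = 1] for some r with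
-- S r = x, and the ℓ₁ distance of x and y is Pr[α · r = 1] with S r = x ⊕ y.  Soundness bounds it from
-- below; smoothness and a union bound over the support of a lightest such r bound it from above.
--
-- Conversely, for an embedding f let φ = f ∘ S and G(r) = Σ_v ‖φ(v ⊕ r) − φ(v)‖₁.  The Fourier transform Ĝ
-- is nonpositive away from 𝟎 because |s − t| is of negative type, and w = −Ĝ satisfies
-- 2 Σ_α w(α) [α · r = 1] = 2ⁿ G(r) by Fourier inversion, so the normalised w is the wanted tester.  As w is
-- an explicit formula in φ, these facts hold for each rational term of the Cauchy sequences separately.
module Submission where

open import Defs
open import Data.Bool.Base using (Bool; true; false; _∧_; _xor_; not; if_then_else_)
import Data.Bool.Properties as Bool
open import Data.Fin.Base using (Fin; zero; suc; fromℕ<; _↑ˡ_; _↑ʳ_; splitAt)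
import Data.Fin.Properties as Fin
open import Data.Integer.Base as ℤ using (+_)
import Data.Integer.Properties as ℤ
open import Data.List.Base using (List; []; _∷_; _++_)
open import Data.List.Membership.Propositional using () renaming (_∈_ to _∈ₗ_)
open import Data.List.Membership.Propositional.Properties using (∈-++⁺ˡ; ∈-++⁺ʳ)
open import Data.List.Relation.Binary.Permutation.Propositional using (↭-sym)
open import Data.List.Relation.Binary.Permutation.Propositional.Properties using (∈-resp-↭)
import Data.List.Relation.Unary.All as All
open import Data.List.Relation.Unary.Any using (here; there)
open import Data.List.Relation.Unary.Linked using (Linked; _∷_)
open import Data.List.Relation.Unary.Linked.Properties using (Linked⇒All)
open import Data.Nat.Base as ℕ using (ℕ; zero; suc; z≤n; s≤s; _+_; _≤_)
import Data.Nat.Properties as ℕ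
open import Data.Product using (Σ; ∃; ∃-syntax; _×_; _,_; proj₁; proj₂)
open import Data.Rational.Base as ℚ using (ℚ; 0ℚ; 1ℚ; ½)
import Data.Rational.Properties as ℚ
open import Data.Rational.Solver using (module +-*-Solver)
open import Data.Rational.Unnormalised.Base as ℚᵘ using (mkℚᵘ; *≡*)
import Data.Rational.Unnormalised.Properties as ℚᵘ
open import Data.Sum.Base using (_⊎_; inj₁; inj₂; [_,_]′)
open import Data.Vec.Base using ([]; _∷_; lookup; head; tail; tabulate)
import Data.Vec.Properties as Vec
open import Function.Base using (_∘_; id; const)
open import Function.Definitions using (Injective)
open import Level using (0ℓ)
open import Relation.Binary.Bundles using (Preorder)
open import Relation.Binary.PropositionalEquality
open import Relation.Nullary.Decidable using (Dec; yes; no; from-yes)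
open import Relation.Nullary.Negation using (¬_; contradiction)
open import Relation.Unary using (_∈_)

open import Algebra.Properties.CommutativeMonoid.Sum ℚ.+-0-commutativeMonoid using ()
  renaming (sum to sumℚ; sum-cong-≗ to sumℚ-cong; sum-replicate-zero to sumℚ-0)
open import Data.List.Sort ℚ.≤-decTotalOrder using (sort; sort-↭; sort-↗)

-- The embedding is pulled back along `combine S` to all of 𝔽₂ⁿ because the tester has to live on
-- vectors of length n. Translation by a kernel vector fixes the pulled-back map, so its Fourier
-- weight at α vanishes as soon as α is odd on some codeword, and that is support in the dual code.
-- Summing over all v replaces an arbitrary ℓ₁ metric by a translation-invariant one; the bounds of
-- the embedding survive because the graph metric is itself translation invariant. The obstacle is
-- constructive. Order on Cauchy reals is not decidable, while decomposing an ℓ₁ metric into cuts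
-- sorts the values of a coordinate; hence negative type is proved over ℚ and applied to the terms
-- of the sequences. Likewise a code is an arbitrary predicate, so membership in its dual is decided
-- on a basis, and the missing generator or parity check map is produced by explicit elimination.

private
  variable
    h k m n : ℕ

-- Linear algebra over 𝔽₂

⊕-assoc : (u v w : 𝔽₂^ n) → (u ⊕ v) ⊕ w ≡ u ⊕ (v ⊕ w)
⊕-assoc = Vec.zipWith-assoc Bool.xor-assoc

⊕-comm : (u v : 𝔽₂^ n) → u ⊕ v ≡ v ⊕ u
⊕-comm = Vec.zipWith-comm Bool.xor-comm

⊕-identityˡ : (v : 𝔽₂^ n) → 𝟎 ⊕ v ≡ v
⊕-identityˡ = Vec.zipWith-identityˡ Bool.xor-identityˡ

⊕-identityʳ : (v : 𝔽₂^ n) → v ⊕ 𝟎 ≡ v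
⊕-identityʳ = Vec.zipWith-identityʳ Bool.xor-identityʳ

⊕-self : (v : 𝔽₂^ n) → v ⊕ v ≡ 𝟎
⊕-self []      = refl
⊕-self (x ∷ v) = cong₂ _∷_ (Bool.xor-same x) (⊕-self v)

⊕-cancelˡ : (u v : 𝔽₂^ n) → u ⊕ (u ⊕ v) ≡ v
⊕-cancelˡ u v = begin
  u ⊕ (u ⊕ v)  ≡⟨ ⊕-assoc u u v ⟨
  (u ⊕ u) ⊕ v  ≡⟨ cong (_⊕ v) (⊕-self u) ⟩
  𝟎 ⊕ v        ≡⟨ ⊕-identityˡ v ⟩
  v            ∎
  where open ≡-Reasoning

⊕≡𝟎⇒≡ : (u v : 𝔽₂^ n) → u ⊕ v ≡ 𝟎 → u ≡ v
⊕≡𝟎⇒≡ u v eq = begin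
  u            ≡⟨ ⊕-identityʳ u ⟨
  u ⊕ 𝟎        ≡⟨ cong (u ⊕_) eq ⟨
  u ⊕ (u ⊕ v)  ≡⟨ ⊕-cancelˡ u v ⟩
  v            ∎
  where open ≡-Reasoning

⊕-medial : (u v w x : 𝔽₂^ n) → (u ⊕ v) ⊕ (w ⊕ x) ≡ (u ⊕ w) ⊕ (v ⊕ x)
⊕-medial u v w x = begin
  (u ⊕ v) ⊕ (w ⊕ x)  ≡⟨ ⊕-assoc u v (w ⊕ x) ⟩
  u ⊕ (v ⊕ (w ⊕ x))  ≡⟨ cong (u ⊕_) (⊕-assoc v w x) ⟨
  u ⊕ ((v ⊕ w) ⊕ x)  ≡⟨ cong (λ z → u ⊕ (z ⊕ x)) (⊕-comm v w) ⟩
  u ⊕ ((w ⊕ v) ⊕ x)  ≡⟨ cong (u ⊕_) (⊕-assoc w v x) ⟩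
  u ⊕ (w ⊕ (v ⊕ x))  ≡⟨ ⊕-assoc u w (v ⊕ x) ⟨
  (u ⊕ w) ⊕ (v ⊕ x)  ∎
  where open ≡-Reasoning

⊙-false : (v : 𝔽₂^ n) → false ⊙ v ≡ 𝟎
⊙-false v = Vec.map-const v false

⊙-true : (v : 𝔽₂^ n) → true ⊙ v ≡ v
⊙-true = Vec.map-id

⊙-distribʳ-xor : ∀ a b (v : 𝔽₂^ n) → (a xor b) ⊙ v ≡ a ⊙ v ⊕ b ⊙ v
⊙-distribʳ-xor a b []      = refl
⊙-distribʳ-xor a b (x ∷ v) =
  cong₂ _∷_ (Bool.∧-distribʳ-xor x a b) (⊙-distribʳ-xor a b v)

infix 4 _≟ᵛ_
_≟ᵛ_ : (u v : 𝔽₂^ n) → Dec (u ≡ v)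
_≟ᵛ_ = Vec.≡-dec Bool._≟_

∙-comm : (u v : 𝔽₂^ n) → u ∙ v ≡ v ∙ u
∙-comm []      []      = refl
∙-comm (x ∷ u) (y ∷ v) = cong₂ _xor_ (Bool.∧-comm x y) (∙-comm u v)

xor-medial : ∀ a b c d → (a xor b) xor (c xor d) ≡ (a xor c) xor (b xor d)
xor-medial false false c d = refl
xor-medial false true  false d = refl
xor-medial false true  true  d = refl
xor-medial true  false c d = Bool.not-distribˡ-xor c d
xor-medial true  true  c d = sym (Bool.xor-annihilates-not c d)

∙-distribˡ-⊕ : (a u v : 𝔽₂^ n) → a ∙ (u ⊕ v) ≡ (a ∙ u) xor (a ∙ v)
∙-distribˡ-⊕ []      []      []      = refl
∙-distribˡ-⊕ (a ∷ as) (x ∷ u) (y ∷ v) = begin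
  (a ∧ (x xor y)) xor (as ∙ (u ⊕ v))
    ≡⟨ cong₂ _xor_ (Bool.∧-distribˡ-xor a x y) (∙-distribˡ-⊕ as u v) ⟩
  ((a ∧ x) xor (a ∧ y)) xor ((as ∙ u) xor (as ∙ v))
    ≡⟨ xor-medial (a ∧ x) (a ∧ y) (as ∙ u) (as ∙ v) ⟩
  ((a ∧ x) xor (as ∙ u)) xor ((a ∧ y) xor (as ∙ v)) ∎
  where open ≡-Reasoning

∙-zeroˡ : (v : 𝔽₂^ n) → 𝟎 ∙ v ≡ false
∙-zeroˡ []      = refl
∙-zeroˡ (x ∷ v) = ∙-zeroˡ v

∙-zeroʳ : (v : 𝔽₂^ n) → v ∙ 𝟎 ≡ false
∙-zeroʳ v = trans (∙-comm v 𝟎) (∙-zeroˡ v)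

unit : Fin n → 𝔽₂^ n
unit zero    = true ∷ 𝟎
unit (suc i) = false ∷ unit i

∙-unit : (a : 𝔽₂^ n) (i : Fin n) → a ∙ unit i ≡ lookup a i
∙-unit (a ∷ as) zero    = begin
  (a ∧ true) xor (as ∙ 𝟎)  ≡⟨ cong₂ _xor_ (Bool.∧-identityʳ a) (∙-zeroʳ as) ⟩
  a xor false              ≡⟨ Bool.xor-identityʳ a ⟩
  a                        ∎
  where open ≡-Reasoning
∙-unit (a ∷ as) (suc i) =
  trans (cong (_xor (as ∙ unit i)) (Bool.∧-zeroʳ a)) (∙-unit as i)

nonzero-coordinate : (v : 𝔽₂^ n) → ¬ v ≡ 𝟎 → ∃[ i ] lookup v i ≡ true
nonzero-coordinate []          v≢𝟎 = contradiction refl v≢𝟎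
nonzero-coordinate (true  ∷ v) v≢𝟎 = zero , refl
nonzero-coordinate (false ∷ v) v≢𝟎 =
  let i , vᵢ = nonzero-coordinate v (v≢𝟎 ∘ cong (false ∷_)) in suc i , vᵢ

-- Over 𝔽₂ additivity is linearity.
Linear : (𝔽₂^ m → 𝔽₂^ n) → Set
Linear f = ∀ u v → f (u ⊕ v) ≡ f u ⊕ f v

linear-𝟎 : {f : 𝔽₂^ m → 𝔽₂^ n} → Linear f → f 𝟎 ≡ 𝟎
linear-𝟎 {f = f} f-linear = begin
  f 𝟎          ≡⟨ cong f (⊕-self 𝟎) ⟨
  f (𝟎 ⊕ 𝟎)    ≡⟨ f-linear 𝟎 𝟎 ⟩
  f 𝟎 ⊕ f 𝟎    ≡⟨ ⊕-self (f 𝟎) ⟩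
  𝟎            ∎
  where open ≡-Reasoning

linear-⊙ : {f : 𝔽₂^ m → 𝔽₂^ n} → Linear f → ∀ a v → f (a ⊙ v) ≡ a ⊙ f v
linear-⊙ {f = f} f-linear false v =
  trans (cong f (⊙-false v)) (trans (linear-𝟎 f-linear) (sym (⊙-false (f v))))
linear-⊙ {f = f} f-linear true  v =
  trans (cong f (⊙-true v)) (sym (⊙-true (f v)))

linear-lincomb : {f : 𝔽₂^ m → 𝔽₂^ n} → Linear f →
  (a : Fin k → 𝔽₂) (v : Fin k → 𝔽₂^ m) → f (lincomb a v) ≡ lincomb a (f ∘ v)
linear-lincomb {k = zero}          f-linear a v = linear-𝟎 f-linear
linear-lincomb {k = suc k} {f = f} f-linear a v = trans
  (f-linear (a zero ⊙ v zero) (lincomb (a ∘ suc) (v ∘ suc)))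
  (cong₂ _⊕_ (linear-⊙ f-linear (a zero) (v zero))
             (linear-lincomb f-linear (a ∘ suc) (v ∘ suc)))

lincomb-cong : {a b : Fin k → 𝔽₂} {v w : Fin k → 𝔽₂^ n} →
  (∀ i → a i ≡ b i) → (∀ i → v i ≡ w i) → lincomb a v ≡ lincomb b w
lincomb-cong {k = zero}  a≗b v≗w = refl
lincomb-cong {k = suc k} a≗b v≗w = cong₂ _⊕_
  (cong₂ _⊙_ (a≗b zero) (v≗w zero)) (lincomb-cong (a≗b ∘ suc) (v≗w ∘ suc))

lincomb-xor : (a b : Fin k → 𝔽₂) (v : Fin k → 𝔽₂^ n) →
  lincomb (λ i → a i xor b i) v ≡ lincomb a v ⊕ lincomb b v
lincomb-xor {k = zero}  a b v = sym (⊕-self 𝟎)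
lincomb-xor {k = suc k} a b v = begin
  (a zero xor b zero) ⊙ v zero ⊕ lincomb (λ i → a (suc i) xor b (suc i)) (v ∘ suc)
    ≡⟨ cong₂ _⊕_ (⊙-distribʳ-xor (a zero) (b zero) (v zero))
                 (lincomb-xor (a ∘ suc) (b ∘ suc) (v ∘ suc)) ⟩
  (a zero ⊙ v zero ⊕ b zero ⊙ v zero) ⊕
    (lincomb (a ∘ suc) (v ∘ suc) ⊕ lincomb (b ∘ suc) (v ∘ suc))
    ≡⟨ ⊕-medial _ _ _ _ ⟩
  lincomb a v ⊕ lincomb b v ∎
  where open ≡-Reasoning

combine : (Fin k → 𝔽₂^ n) → 𝔽₂^ k → 𝔽₂^ n
combine v a = lincomb (lookup a) v

combine-linear : (v : Fin k → 𝔽₂^ n) → Linear (combine v)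
combine-linear v a b = trans
  (lincomb-cong (λ i → Vec.lookup-zipWith _xor_ i a b) (λ _ → refl))
  (lincomb-xor (lookup a) (lookup b) v)

combine-tabulate : (a : Fin k → 𝔽₂) (v : Fin k → 𝔽₂^ n) →
  combine v (tabulate a) ≡ lincomb a v
combine-tabulate a v = lincomb-cong (Vec.lookup∘tabulate a) (λ _ → refl)

false∷-linear : Linear {m = n} (false ∷_)
false∷-linear u v = refl

combine-unit : (a : 𝔽₂^ n) → combine unit a ≡ a
combine-unit []      = refl
combine-unit (x ∷ a) = begin
  x ⊙ (true ∷ 𝟎) ⊕ lincomb (lookup a) ((false ∷_) ∘ unit)
    ≡⟨ cong (x ⊙ (true ∷ 𝟎) ⊕_) (linear-lincomb {f = false ∷_} false∷-linear (lookup a) unit) ⟨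
  x ⊙ (true ∷ 𝟎) ⊕ (false ∷ combine unit a)
    ≡⟨ cong (λ b → x ⊙ (true ∷ 𝟎) ⊕ (false ∷ b)) (combine-unit a) ⟩
  x ⊙ (true ∷ 𝟎) ⊕ (false ∷ a)
    ≡⟨ lemma x ⟩
  x ∷ a ∎
  where
  open ≡-Reasoning
  lemma : ∀ x → x ⊙ (true ∷ 𝟎) ⊕ (false ∷ a) ≡ x ∷ a
  lemma false = cong (false ∷_) (trans (cong (_⊕ a) (⊙-false 𝟎)) (⊕-identityˡ a))
  lemma true  = cong (true ∷_) (trans (cong (_⊕ a) (⊙-true 𝟎)) (⊕-identityˡ a))

linear-combine : {f : 𝔽₂^ m → 𝔽₂^ n} → Linear f → ∀ v → combine (f ∘ unit) v ≡ f v
linear-combine {f = f} f-linear v =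
  trans (sym (linear-lincomb f-linear (lookup v) unit)) (cong f (combine-unit v))

all-false⇒≡𝟎 : (v : 𝔽₂^ n) → (∀ i → lookup v i ≡ false) → v ≡ 𝟎
all-false⇒≡𝟎 []      _ = refl
all-false⇒≡𝟎 (x ∷ v) p = cong₂ _∷_ (p zero) (all-false⇒≡𝟎 v (p ∘ suc))

-- Exact sequences over 𝔽₂ by elimination

record Quotient (v : 𝔽₂^ (suc n)) : Set where
  field
    project    : 𝔽₂^ (suc n) → 𝔽₂^ n
    linear     : Linear project
    surjective : ∀ y → ∃[ x ] project x ≡ y
    kills      : project v ≡ 𝟎
    kernel     : ∀ x → project x ≡ 𝟎 → ∃[ a ] x ≡ a ⊙ v

∷-linear : {f : 𝔽₂^ m → 𝔽₂^ n} → Linear f → Linear (λ v → head v ∷ f (tail v))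
∷-linear f-linear (x ∷ u) (y ∷ v) = cong ((x xor y) ∷_) (f-linear u v)

quotient : (v : 𝔽₂^ (suc n)) → ¬ v ≡ 𝟎 → Quotient v
quotient {n} (true ∷ v) _ = record
  { project    = project
  ; linear     = λ where
      (x ∷ u) (y ∷ w) → trans (cong ((u ⊕ w) ⊕_) (⊙-distribʳ-xor x y v))
                              (⊕-medial u w (x ⊙ v) (y ⊙ v))
  ; surjective = λ y → (false ∷ y) , trans (cong (y ⊕_) (⊙-false v)) (⊕-identityʳ y)
  ; kills      = trans (cong (v ⊕_) (⊙-true v)) (⊕-self v)
  ; kernel     = λ where
      (x ∷ u) eq → x , cong₂ _∷_ (sym (Bool.∧-identityʳ x)) (⊕≡𝟎⇒≡ u (x ⊙ v) eq)
  }
  where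
  project : 𝔽₂^ (suc n) → 𝔽₂^ n
  project (x ∷ u) = u ⊕ x ⊙ v
quotient {zero}  (false ∷ []) v≢𝟎 = contradiction refl v≢𝟎
quotient {suc n} (false ∷ v)  v≢𝟎 = record
  { project    = λ x → head x ∷ project (tail x)
  ; linear     = ∷-linear linear
  ; surjective = λ where
      (y ∷ ys) → let x , eq = surjective ys in (y ∷ x) , cong (y ∷_) eq
  ; kills      = cong (false ∷_) kills
  ; kernel     = λ where
      (x ∷ u) eq → let a , u≡ = kernel u (Vec.∷-injectiveʳ eq) in
        a , cong₂ _∷_ (trans (Vec.∷-injectiveˡ eq) (sym (Bool.∧-zeroʳ a))) u≡
  }
  where open Quotient (quotient v (v≢𝟎 ∘ cong (false ∷_)))

-- The short exact sequence 0 → 𝔽₂ᵏ → 𝔽₂ⁿ → 𝔽₂ʰ → 0. In coding terms `g` is a generator map and `f`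
-- a parity check of the same code; each direction of the theorem starts from one of the two maps
-- and needs the other.
record ExactSequence {k n h : ℕ} (g : 𝔽₂^ k → 𝔽₂^ n) (f : 𝔽₂^ n → 𝔽₂^ h) : Set where
  field
    g-linear   : Linear g
    f-linear   : Linear f
    injective  : ∀ u → g u ≡ 𝟎 → u ≡ 𝟎
    surjective : ∀ y → ∃[ x ] f x ≡ y
    composite  : ∀ u → f (g u) ≡ 𝟎
    kernel     : ∀ x → f x ≡ 𝟎 → ∃[ u ] g u ≡ x

-- Induction on `k`: dividing the target by the image of the first basis vector lowers `k` and `n`
-- together, so the dimension formula comes out of the recursion.
cokernel-sequence : (g : 𝔽₂^ k → 𝔽₂^ n) → Linear g → (∀ u → g u ≡ 𝟎 → u ≡ 𝟎) →
  ∃[ h ] (h ℕ.+ k ≡ n × Σ (𝔽₂^ n → 𝔽₂^ h) (ExactSequence g))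
cokernel-sequence {k = zero} {n = n} g g-linear g-inj = n , ℕ.+-identityʳ n , id , record
  { g-linear   = g-linear
  ; f-linear   = λ _ _ → refl
  ; injective  = g-inj
  ; surjective = λ y → y , refl
  ; composite  = λ where [] → linear-𝟎 g-linear
  ; kernel     = λ x x≡𝟎 → [] , trans (linear-𝟎 g-linear) (sym x≡𝟎)
  }
cokernel-sequence {k = suc k} {n = zero} g g-linear g-inj with g (true ∷ 𝟎) in eq
... | [] with () ← g-inj (true ∷ 𝟎) eq
cokernel-sequence {k = suc k} {n = suc n} g g-linear g-inj = result
  where
  open ≡-Reasoning

  v : 𝔽₂^ (suc n)
  v = g (true ∷ 𝟎)

  v≢𝟎 : ¬ v ≡ 𝟎
  v≢𝟎 v≡𝟎 with () ← g-inj (true ∷ 𝟎) v≡𝟎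

  module Q = Quotient (quotient v v≢𝟎)

  split : ∀ a u → g (a ∷ u) ≡ a ⊙ v ⊕ g (false ∷ u)
  split false u = sym (trans (cong (_⊕ g (false ∷ u)) (⊙-false v)) (⊕-identityˡ _))
  split true  u = begin
    g (true ∷ u)                ≡⟨ cong (λ w → g (true ∷ w)) (⊕-identityˡ u) ⟨
    g ((true ∷ 𝟎) ⊕ (false ∷ u)) ≡⟨ g-linear (true ∷ 𝟎) (false ∷ u) ⟩
    v ⊕ g (false ∷ u)           ≡⟨ cong (_⊕ g (false ∷ u)) (⊙-true v) ⟨
    true ⊙ v ⊕ g (false ∷ u)    ∎

  g′ : 𝔽₂^ k → 𝔽₂^ n
  g′ u = Q.project (g (false ∷ u))

  g′-linear : Linear g′
  g′-linear u w = trans (cong Q.project (g-linear (false ∷ u) (false ∷ w))) (Q.linear _ _)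

  -- If the quotient kills `g (false ∷ u)`, that vector is some `a ⊙ v`, and then `g` already kills
  -- `a ∷ u`.
  g′-inj : ∀ u → g′ u ≡ 𝟎 → u ≡ 𝟎
  g′-inj u eq = let a , gu≡av = Q.kernel (g (false ∷ u)) eq in
    Vec.∷-injectiveʳ (g-inj (a ∷ u)
      (trans (split a u) (trans (cong (a ⊙ v ⊕_) gu≡av) (⊕-self (a ⊙ v)))))

  -- The vector `u` reaches `x` only modulo `v`; the missing multiple of `v` is supplied as the
  -- first coordinate.
  lift-kernel : ∀ x u → g′ u ≡ Q.project x → ∃[ w ] g w ≡ x
  lift-kernel x u eq =
    let a , eq′ = Q.kernel (g (false ∷ u) ⊕ x)
                    (trans (Q.linear _ _) (trans (cong (_⊕ Q.project x) eq) (⊕-self _)))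
    in (a ∷ u) , (begin
      g (a ∷ u)                          ≡⟨ split a u ⟩
      a ⊙ v ⊕ g (false ∷ u)              ≡⟨ cong (_⊕ g (false ∷ u)) eq′ ⟨
      (g (false ∷ u) ⊕ x) ⊕ g (false ∷ u) ≡⟨ ⊕-comm (g (false ∷ u) ⊕ x) (g (false ∷ u)) ⟩
      g (false ∷ u) ⊕ (g (false ∷ u) ⊕ x) ≡⟨ ⊕-cancelˡ (g (false ∷ u)) x ⟩
      x                                  ∎)

  result : ∃[ h ] (h ℕ.+ suc k ≡ suc n × Σ (𝔽₂^ (suc n) → 𝔽₂^ h) (ExactSequence g))
  result with h , h+k≡n , f′ , exact ← cokernel-sequence g′ g′-linear g′-inj =
    h , trans (ℕ.+-suc h k) (cong suc h+k≡n) , f′ ∘ Q.project , record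
      { g-linear   = g-linear
      ; f-linear   = λ u w → trans (cong f′ (Q.linear u w)) (E.f-linear _ _)
      ; injective  = g-inj
      ; surjective = λ y →
          let x′ , f′x′≡y = E.surjective y
              x , qx≡x′   = Q.surjective x′
          in x , trans (cong f′ qx≡x′) f′x′≡y
      ; composite  = λ where
          (a ∷ u) → begin
            f′ (Q.project (g (a ∷ u)))
              ≡⟨ cong (f′ ∘ Q.project) (split a u) ⟩
            f′ (Q.project (a ⊙ v ⊕ g (false ∷ u)))
              ≡⟨ cong f′ (Q.linear (a ⊙ v) (g (false ∷ u))) ⟩
            f′ (Q.project (a ⊙ v) ⊕ g′ u)
              ≡⟨ cong (λ z → f′ (z ⊕ g′ u)) (trans (linear-⊙ Q.linear a v) (cong (a ⊙_) Q.kills)) ⟩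
            f′ (a ⊙ 𝟎 ⊕ g′ u)
              ≡⟨ cong (λ z → f′ (z ⊕ g′ u)) (linear-𝟎 {f = a ⊙_} (⊙-linear a)) ⟩
            f′ (𝟎 ⊕ g′ u)
              ≡⟨ cong f′ (⊕-identityˡ (g′ u)) ⟩
            f′ (g′ u)
              ≡⟨ E.composite u ⟩
            𝟎 ∎
      ; kernel     = λ x eq → let u , g′u≡ = E.kernel (Q.project x) eq in lift-kernel x u g′u≡
      }
    where
    module E = ExactSequence exact
    ⊙-linear : ∀ a → Linear {m = n} (a ⊙_)
    ⊙-linear false u w = trans (⊙-false (u ⊕ w)) (sym (trans
      (cong₂ _⊕_ (⊙-false u) (⊙-false w)) (⊕-self 𝟎)))
    ⊙-linear true u w = trans (⊙-true (u ⊕ w)) (sym (cong₂ _⊕_ (⊙-true u) (⊙-true w)))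

record Hyperplane (φ : 𝔽₂^ (suc n) → 𝔽₂) : Set where
  field
    include   : 𝔽₂^ n → 𝔽₂^ (suc n)
    linear    : Linear include
    injective : ∀ u → include u ≡ 𝟎 → u ≡ 𝟎
    inside    : ∀ u → φ (include u) ≡ false
    covers    : ∀ x → φ x ≡ false → ∃[ u ] include u ≡ x

Additive : (𝔽₂^ n → 𝔽₂) → Set
Additive φ = ∀ u v → φ (u ⊕ v) ≡ φ u xor φ v

additive-∷ : {φ : 𝔽₂^ (suc n) → 𝔽₂} → Additive φ →
  ∀ b u → φ (b ∷ u) ≡ (b ∧ φ (true ∷ 𝟎)) xor φ (false ∷ u)
additive-∷         φ-additive false u = refl
additive-∷ {φ = φ} φ-additive true  u =
  trans (cong (λ w → φ (true ∷ w)) (sym (⊕-identityˡ u))) (φ-additive (true ∷ 𝟎) (false ∷ u))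

xor≡false⇒≡ : ∀ a b → a xor b ≡ false → a ≡ b
xor≡false⇒≡ false b     eq = sym eq
xor≡false⇒≡ true  true  eq = refl

-- If `φ` is nonzero on the first basis vector, the equation `φ x ≡ false` can be solved for the
-- first coordinate. Otherwise `φ` ignores that coordinate and the search goes on in the tail; the
-- witness `x` guarantees that it succeeds.
hyperplane : (φ : 𝔽₂^ (suc n) → 𝔽₂) → Additive φ → ∀ x → φ x ≡ true → Hyperplane φ
hyperplane {n} φ φ-additive (b ∷ x) φx with φ (true ∷ 𝟎) | additive-∷ {φ = φ} φ-additive
hyperplane {n} φ φ-additive (b ∷ x) φx | true | split = record
  { include   = λ u → φ (false ∷ u) ∷ u
  ; linear    = λ u v → cong (_∷ (u ⊕ v)) (φ-additive (false ∷ u) (false ∷ v))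
  ; injective = λ u → Vec.∷-injectiveʳ
  ; inside    = λ u → trans (split′ (φ (false ∷ u)) u) (Bool.xor-same (φ (false ∷ u)))
  ; covers    = λ where
      (b ∷ u) eq → u , cong (_∷ u)
        (sym (xor≡false⇒≡ b (φ (false ∷ u)) (trans (sym (split′ b u)) eq)))
  }
  where
  split′ : ∀ b u → φ (b ∷ u) ≡ b xor φ (false ∷ u)
  split′ b u = trans (split b u) (cong (_xor φ (false ∷ u)) (Bool.∧-identityʳ b))
hyperplane {zero} φ φ-additive (b ∷ []) φx | false | split
  with () ← trans (sym φx) (trans (split b [])
    (cong₂ _xor_ (Bool.∧-zeroʳ b) (trans (φ-additive (false ∷ []) (false ∷ [])) (Bool.xor-same (φ (false ∷ []))))))
hyperplane {suc n} φ φ-additive (b ∷ x) φx | false | split = record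
  { include   = λ u → head u ∷ include (tail u)
  ; linear    = ∷-linear linear
  ; injective = λ where
      (b ∷ u) eq → cong₂ _∷_ (Vec.∷-injectiveˡ eq) (injective u (Vec.∷-injectiveʳ eq))
  ; inside    = λ u → trans (split′ (head u) _) (inside (tail u))
  ; covers    = λ where
      (b ∷ y) eq → let u , eq′ = covers y (trans (sym (split′ b y)) eq) in
        (b ∷ u) , cong (b ∷_) eq′
  }
  where
  split′ : ∀ b u → φ (b ∷ u) ≡ φ (false ∷ u)
  split′ b u = trans (split b u) (cong (_xor φ (false ∷ u)) (Bool.∧-zeroʳ b))

  open Hyperplane (hyperplane (λ u → φ (false ∷ u))
    (λ u v → φ-additive (false ∷ u) (false ∷ v)) x (trans (sym (split′ b x)) φx))

head-additive : ∀ {h} {f : 𝔽₂^ n → 𝔽₂^ (suc h)} → Linear f → Additive (head ∘ f)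
head-additive {h = h} {f = f} f-linear u v = trans (cong head (f-linear u v)) (head-⊕ (f u) (f v))
  where
  head-⊕ : (x y : 𝔽₂^ (suc h)) → head (x ⊕ y) ≡ head x xor head y
  head-⊕ (_ ∷ _) (_ ∷ _) = refl

tail-linear : Linear {m = suc n} tail
tail-linear (_ ∷ _) (_ ∷ _) = refl

-- Induction on `h`: the first output coordinate cuts out a hyperplane, and the remaining ones are
-- still surjective on it, since a preimage of `false ∷ y` lies inside. Both `n` and `h` drop by one
-- while `k` stays, which is the dimension formula.
kernel-sequence : (f : 𝔽₂^ n → 𝔽₂^ h) → Linear f → (∀ y → ∃[ x ] f x ≡ y) →
  ∃[ k ] (k ℕ.+ h ≡ n × Σ (𝔽₂^ k → 𝔽₂^ n) λ g → ExactSequence g f)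
kernel-sequence {n = n} {h = zero} f f-linear f-surj = n , ℕ.+-identityʳ n , id , record
  { g-linear   = λ _ _ → refl
  ; f-linear   = f-linear
  ; injective  = λ _ → id
  ; surjective = f-surj
  ; composite  = λ u → 𝔽₂^0-unique (f u)
  ; kernel     = λ x _ → x , refl
  }
  where
  𝔽₂^0-unique : (v : 𝔽₂^ 0) → v ≡ 𝟎
  𝔽₂^0-unique [] = refl
kernel-sequence {n = zero} {h = suc h} f f-linear f-surj with f-surj (true ∷ 𝟎)
... | [] , eq with () ← trans (sym eq) (linear-𝟎 f-linear)
kernel-sequence {n = suc n} {h = suc h} f f-linear f-surj = restrict (kernel-sequence f′ f′-linear f′-surj)
  where
  ∷-η : ∀ {b} {w : 𝔽₂^ h} {v : 𝔽₂^ (suc h)} → head v ≡ b → tail v ≡ w → v ≡ b ∷ w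
  ∷-η {v = _ ∷ _} = cong₂ _∷_

  module P = Hyperplane (hyperplane (head ∘ f) (head-additive f-linear)
    (proj₁ (f-surj (true ∷ 𝟎))) (cong head (proj₂ (f-surj (true ∷ 𝟎)))))

  f′ : 𝔽₂^ n → 𝔽₂^ h
  f′ = tail ∘ f ∘ P.include

  f′-linear : Linear f′
  f′-linear u v = trans (cong (tail ∘ f) (P.linear u v))
    (trans (cong tail (f-linear _ _)) (tail-linear (f (P.include u)) (f (P.include v))))

  f′-surj : ∀ y → ∃[ x ] f′ x ≡ y
  f′-surj y =
    let x , fx≡  = f-surj (false ∷ y)
        u , iu≡x = P.covers x (cong head fx≡)
    in u , trans (cong (tail ∘ f) iu≡x) (cong tail fx≡)

  restrict : ∃[ k ] (k ℕ.+ h ≡ n × Σ (𝔽₂^ k → 𝔽₂^ n) λ g → ExactSequence g f′) →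
    ∃[ k ] (k ℕ.+ suc h ≡ suc n × Σ (𝔽₂^ k → 𝔽₂^ (suc n)) λ g → ExactSequence g f)
  restrict (k , k+h≡n , g , exact) =
    k , trans (ℕ.+-suc k h) (cong suc k+h≡n) , P.include ∘ g , record
      { g-linear   = λ u v → trans (cong P.include (E.g-linear u v)) (P.linear _ _)
      ; f-linear   = f-linear
      ; injective  = λ u eq → E.injective u (P.injective (g u) eq)
      ; surjective = f-surj
      ; composite  = λ u → ∷-η (P.inside (g u)) (E.composite u)
      ; kernel     = λ x fx≡𝟎 →
          let y , iy≡x = P.covers x (cong head fx≡𝟎)
              u , gu≡y = E.kernel y (trans (cong (tail ∘ f) iy≡x) (cong tail fx≡𝟎))
          in u , trans (cong P.include gu≡y) iy≡x
      }
    where module E = ExactSequence exact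

-- Walks and weights

weight-𝟎 : ∀ n → weight (𝟎 {n}) ≡ 0
weight-𝟎 zero    = refl
weight-𝟎 (suc n) = weight-𝟎 n

weight-unit : (i : Fin n) → weight (unit i) ≡ 1
weight-unit {suc n} zero    = cong suc (weight-𝟎 n)
weight-unit         (suc i) = weight-unit i

weight-⊕ : (u v : 𝔽₂^ n) → weight (u ⊕ v) ℕ.≤ weight u ℕ.+ weight v
weight-⊕ []          []          = z≤n
weight-⊕ (false ∷ u) (false ∷ v) = weight-⊕ u v
weight-⊕ (false ∷ u) (true  ∷ v) =
  subst (suc (weight (u ⊕ v)) ℕ.≤_) (sym (ℕ.+-suc (weight u) (weight v))) (s≤s (weight-⊕ u v))
weight-⊕ (true  ∷ u) (false ∷ v) = s≤s (weight-⊕ u v)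
weight-⊕ (true  ∷ u) (true  ∷ v) = begin
  weight (u ⊕ v)                       ≤⟨ weight-⊕ u v ⟩
  weight u ℕ.+ weight v                ≤⟨ ℕ.+-monoʳ-≤ (weight u) (ℕ.n≤1+n (weight v)) ⟩
  weight u ℕ.+ suc (weight v)          ≤⟨ ℕ.n≤1+n _ ⟩
  suc (weight u ℕ.+ suc (weight v))    ∎
  where open ℕ.≤-Reasoning

weight-≡𝟎 : (v : 𝔽₂^ n) → weight v ≡ 0 → v ≡ 𝟎
weight-≡𝟎 []          _  = refl
weight-≡𝟎 (false ∷ v) eq = cong (false ∷_) (weight-≡𝟎 v eq)

-- Exhaustive search: the recursion compares the minima over the two half cubes. Emptiness is
-- reported as well, because one half may contain no candidate.
argmin : (f : 𝔽₂^ n → ℕ) {P : 𝔽₂^ n → Set} → (∀ v → Dec (P v)) →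
  (∀ v → ¬ P v) ⊎ ∃[ v ] (P v × ∀ u → P u → f v ℕ.≤ f u)
argmin {zero} f P? with P? []
... | no ¬P[] = inj₁ λ where [] → ¬P[]
... | yes P[] = inj₂ ([] , P[] , λ where [] _ → ℕ.≤-refl)
argmin {suc n} f P? with argmin (f ∘ (false ∷_)) (P? ∘ (false ∷_))
                       | argmin (f ∘ (true ∷_)) (P? ∘ (true ∷_))
... | inj₁ ¬Pf | inj₁ ¬Pt = inj₁ λ where
  (false ∷ u) → ¬Pf u
  (true  ∷ u) → ¬Pt u
... | inj₁ ¬Pf | inj₂ (v , Pv , v-min) = inj₂ ((true ∷ v) , Pv , λ where
  (false ∷ u) Pu → contradiction Pu (¬Pf u)
  (true  ∷ u) Pu → v-min u Pu)
... | inj₂ (v , Pv , v-min) | inj₁ ¬Pt = inj₂ ((false ∷ v) , Pv , λ where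
  (false ∷ u) Pu → v-min u Pu
  (true  ∷ u) Pu → contradiction Pu (¬Pt u))
... | inj₂ (v , Pv , v-min) | inj₂ (w , Pw , w-min)
  with ℕ.≤-total (f (false ∷ v)) (f (true ∷ w))
...   | inj₁ v≤w = inj₂ ((false ∷ v) , Pv , λ where
  (false ∷ u) Pu → v-min u Pu
  (true  ∷ u) Pu → ℕ.≤-trans v≤w (w-min u Pu))
...   | inj₂ w≤v = inj₂ ((true ∷ w) , Pw , λ where
  (false ∷ u) Pu → ℕ.≤-trans w≤v (v-min u Pu)
  (true  ∷ u) Pu → w-min u Pu)

lightest : {P : 𝔽₂^ n → Set} → (∀ v → Dec (P v)) → ∃ P →
  ∃[ v ] (P v × ∀ u → P u → weight v ℕ.≤ weight u)
lightest P? (v , Pv) with argmin weight P?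
... | inj₁ ¬P    = contradiction Pv (¬P v)
... | inj₂ found = found

combine-∘unit : (S : Fin n → 𝔽₂^ h) (i : Fin n) → combine S (unit i) ≡ S i
combine-∘unit S zero    = begin
  true ⊙ S zero ⊕ combine (S ∘ suc) 𝟎
    ≡⟨ cong₂ _⊕_ (⊙-true (S zero)) (linear-𝟎 (combine-linear (S ∘ suc))) ⟩
  S zero ⊕ 𝟎
    ≡⟨ ⊕-identityʳ (S zero) ⟩
  S zero ∎
  where open ≡-Reasoning
combine-∘unit S (suc i) = begin
  false ⊙ S zero ⊕ combine (S ∘ suc) (unit i)
    ≡⟨ cong₂ _⊕_ (⊙-false (S zero)) (combine-∘unit (S ∘ suc) i) ⟩
  𝟎 ⊕ S (suc i)
    ≡⟨ ⊕-identityˡ (S (suc i)) ⟩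
  S (suc i) ∎
  where open ≡-Reasoning

-- Only the parity with which each generator is used matters for the endpoint. Cancelling repeated
-- uses can lower the weight below the length, hence the inequality.
walk⇒vector : (S : Fin n → 𝔽₂^ h) → ∀ {x y ℓ} → Walk (Cay h S) x y ℓ →
  ∃[ v ] (weight v ℕ.≤ ℓ × combine S v ≡ x ⊕ y)
walk⇒vector {n} S {x} stop =
  𝟎 , ℕ.≤-reflexive (weight-𝟎 n) , trans (linear-𝟎 (combine-linear S)) (sym (⊕-self x))
walk⇒vector S {y = y} (step {ℓ = ℓ} (x , i) walk) with v , |v|≤ℓ , Sv≡ ← walk⇒vector S walk =
  unit i ⊕ v , bound , end
  where
  bound : weight (unit i ⊕ v) ℕ.≤ suc ℓ
  bound = ℕ.≤-trans (weight-⊕ (unit i) v)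
    (ℕ.≤-trans (ℕ.≤-reflexive (cong (ℕ._+ weight v) (weight-unit i))) (s≤s |v|≤ℓ))
  end : combine S (unit i ⊕ v) ≡ x ⊕ y
  end = begin
    combine S (unit i ⊕ v)            ≡⟨ combine-linear S (unit i) v ⟩
    combine S (unit i) ⊕ combine S v  ≡⟨ cong₂ _⊕_ (combine-∘unit S i) Sv≡ ⟩
    S i ⊕ ((x ⊕ S i) ⊕ y)             ≡⟨ cong (λ z → S i ⊕ (z ⊕ y)) (⊕-comm x (S i)) ⟩
    S i ⊕ ((S i ⊕ x) ⊕ y)             ≡⟨ cong (S i ⊕_) (⊕-assoc (S i) x y) ⟩
    S i ⊕ (S i ⊕ (x ⊕ y))             ≡⟨ ⊕-cancelˡ (S i) (x ⊕ y) ⟩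
    x ⊕ y                             ∎
    where open ≡-Reasoning

widen : (S : Fin (suc n) → 𝔽₂^ h) → ∀ {x y ℓ} →
  Walk (Cay h (S ∘ suc)) x y ℓ → Walk (Cay h S) x y ℓ
widen S stop                = stop
widen S (step (x , i) walk) = step (x , suc i) (widen S walk)

-- Each generator in the support of `v` is taken once, in the order of the indices.
vector⇒walk : (S : Fin n → 𝔽₂^ h) → ∀ x v →
  Walk (Cay h S) x (x ⊕ combine S v) (weight v)
vector⇒walk S x []          = subst (λ y → Walk _ x y 0) (sym (⊕-identityʳ x)) stop
vector⇒walk S x (false ∷ v) = subst (λ y → Walk _ x (x ⊕ y) (weight v))
  (sym (trans (cong (_⊕ combine (S ∘ suc) v) (⊙-false (S zero))) (⊕-identityˡ _)))
  (widen S (vector⇒walk (S ∘ suc) x v))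
vector⇒walk S x (true ∷ v)  = step (x , zero) (subst (λ y → Walk _ (x ⊕ S zero) y (weight v))
  (trans (⊕-assoc x (S zero) _)
    (cong (λ s → x ⊕ (s ⊕ combine (S ∘ suc) v)) (sym (⊙-true (S zero)))))
  (widen S (vector⇒walk (S ∘ suc) (x ⊕ S zero) v)))

vector⇒walk-to : (S : Fin n → 𝔽₂^ h) → ∀ {x y} v → combine S v ≡ x ⊕ y →
  Walk (Cay h S) x y (weight v)
vector⇒walk-to S {x} {y} v Sv≡ = subst (λ z → Walk _ x z (weight v))
  (trans (cong (x ⊕_) Sv≡) (⊕-cancelˡ x y)) (vector⇒walk S x v)

lightest⇒shortest : (S : Fin n → 𝔽₂^ h) → ∀ {x y} v → combine S v ≡ x ⊕ y →
  (∀ u → combine S u ≡ x ⊕ y → weight v ℕ.≤ weight u) →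
  IsMinimum (Walk (Cay h S) x y) (weight v)
lightest⇒shortest S v Sv≡ v-min = vector⇒walk-to S v Sv≡ , λ ℓ walk →
  let u , |u|≤ℓ , Su≡ = walk⇒vector S walk in ℕ.≤-trans (v-min u Su≡) |u|≤ℓ

distance-unique : (C : LinearCode n) → ∀ r {m m′} →
  IsDistanceToCode r C m → IsDistanceToCode r C m′ → m ≡ m′
distance-unique C r (near , m-min) (near′ , m′-min) = ℕ.≤-antisym (m-min _ near′) (m′-min _ near)

-- The vectors with the same syndrome as `r` are the `r ⊕ c` with `c` a codeword, and their weights
-- are the Hamming distances from `r` to the codewords. Walks from `x` to `y` correspond to such
-- vectors.
shortest⇒distance : (C : LinearCode n) (S : Fin n → 𝔽₂^ h) →
  (∀ c → combine S c ≡ 𝟎 → c ∈ words C) → (∀ c → c ∈ words C → combine S c ≡ 𝟎) →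
  ∀ r {x y} m → combine S r ≡ x ⊕ y →
  IsMinimum (Walk (Cay h S) x y) m → IsDistanceToCode r C m
shortest⇒distance C S ⇒word word⇒ r m Sr≡ (walk , m-min) =
  -- The shortest walk gives only `weight v ≤ m`; equality holds because `r ⊕ v` is a codeword and
  -- so has distance at least `m` from `r`.
  (r ⊕ v , ⇒word _ ker , ℕ.≤-antisym (ℕ.≤-trans (ℕ.≤-reflexive |r⊕r⊕v|) |v|≤m)
    (lower (r ⊕ v) (⇒word _ ker))) ,
  λ where j (c , c∈C , refl) → lower c c∈C
  where
  v = proj₁ (walk⇒vector S walk)
  |v|≤m = proj₁ (proj₂ (walk⇒vector S walk))
  Sv≡ = proj₂ (proj₂ (walk⇒vector S walk))
  |r⊕r⊕v| : hamming r (r ⊕ v) ≡ weight v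
  |r⊕r⊕v| = cong weight (⊕-cancelˡ r v)
  ker : combine S (r ⊕ v) ≡ 𝟎
  ker = trans (combine-linear S r v) (trans (cong₂ _⊕_ Sr≡ Sv≡) (⊕-self _))
  lower : ∀ c → c ∈ words C → m ℕ.≤ hamming r c
  lower c c∈C = m-min _ (vector⇒walk-to S (r ⊕ c) (trans (combine-linear S r c)
    (trans (cong₂ _⊕_ Sr≡ (word⇒ c c∈C)) (⊕-identityʳ _))))

-- Supports, code distance and wise independence

supportIndex : (v : 𝔽₂^ n) → Fin (weight v) → Fin n
supportIndex (false ∷ v) i       = suc (supportIndex v i)
supportIndex (true  ∷ v) zero    = zero
supportIndex (true  ∷ v) (suc i) = suc (supportIndex v i)

supportIndex-injective : (v : 𝔽₂^ n) → Injective _≡_ _≡_ (supportIndex v)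
supportIndex-injective (false ∷ v) eq = supportIndex-injective v (Fin.suc-injective eq)
supportIndex-injective (true  ∷ v) {zero}  {zero}  eq = refl
supportIndex-injective (true  ∷ v) {suc i} {suc j} eq =
  cong suc (supportIndex-injective v (Fin.suc-injective eq))

lincomb-supportIndex : (S : Fin n → 𝔽₂^ h) (v : 𝔽₂^ n) →
  lincomb (const true) (S ∘ supportIndex v) ≡ combine S v
lincomb-supportIndex S []          = refl
lincomb-supportIndex S (false ∷ v) = trans (lincomb-supportIndex (S ∘ suc) v)
  (sym (trans (cong (_⊕ combine (S ∘ suc) v) (⊙-false (S zero))) (⊕-identityˡ _)))
lincomb-supportIndex S (true  ∷ v) = cong (true ⊙ S zero ⊕_) (lincomb-supportIndex (S ∘ suc) v)

-- A nonzero kernel vector is a dependency, with all coefficients `true`, among the generators in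
-- its support; a weight below `d` would make this family independent.
wise-independent⇒distance : ∀ d (S : Fin n → 𝔽₂^ h) → WiseIndependent d S →
  ∀ v → combine S v ≡ 𝟎 → ¬ v ≡ 𝟎 → d ℕ.≤ weight v
wise-independent⇒distance d S S-indep v Sv≡𝟎 v≢𝟎 with d ℕ.≤? weight v
... | yes d≤|v| = d≤|v|
... | no  d≰|v| with weight v in eq | S-indep (weight v) (ℕ.≰⇒> d≰|v|) (supportIndex v)
                    (supportIndex-injective v) (const true) (trans (lincomb-supportIndex S v) Sv≡𝟎)
-- For the empty support independence says nothing, so this case is excluded by `v` being nonzero.
...   | zero  | _         = contradiction (weight-≡𝟎 v eq) v≢𝟎
...   | suc _ | all-false with () ← all-false zero

lookup-unit-same : (i : Fin n) → lookup (unit i) i ≡ true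
lookup-unit-same zero    = refl
lookup-unit-same (suc i) = lookup-unit-same i

lookup-unit-other : (i j : Fin n) → ¬ i ≡ j → lookup (unit i) j ≡ false
lookup-unit-other zero    zero    i≢j = contradiction refl i≢j
lookup-unit-other zero    (suc j) i≢j = Vec.lookup-replicate j false
lookup-unit-other (suc i) zero    i≢j = refl
lookup-unit-other (suc i) (suc j) i≢j = lookup-unit-other i j (i≢j ∘ cong suc)

lookup-lincomb-suc : (a : Fin (suc k) → 𝔽₂) (v : Fin (suc k) → 𝔽₂^ n) → ∀ j →
  lookup (lincomb a v) j ≡ (a zero ∧ lookup (v zero) j) xor lookup (lincomb (a ∘ suc) (v ∘ suc)) j
lookup-lincomb-suc a v j = trans
  (Vec.lookup-zipWith _xor_ j (a zero ⊙ v zero) _)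
  (cong (_xor lookup (lincomb (a ∘ suc) (v ∘ suc)) j) (Vec.lookup-map j (a zero ∧_) (v zero)))

lookup-off-range : (a : Fin k → 𝔽₂) (ι : Fin k → Fin n) → ∀ j → (∀ i → ¬ ι i ≡ j) →
  lookup (lincomb a (unit ∘ ι)) j ≡ false
lookup-off-range {k = zero}  a ι j j∉ι = Vec.lookup-replicate j false
lookup-off-range {k = suc k} a ι j j∉ι = begin
  lookup (lincomb a (unit ∘ ι)) j
    ≡⟨ lookup-lincomb-suc a (unit ∘ ι) j ⟩
  (a zero ∧ lookup (unit (ι zero)) j) xor lookup (lincomb (a ∘ suc) (unit ∘ ι ∘ suc)) j
    ≡⟨ cong₂ (λ b c → (a zero ∧ b) xor c) (lookup-unit-other (ι zero) j (j∉ι zero))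
         (lookup-off-range (a ∘ suc) (ι ∘ suc) j (j∉ι ∘ suc)) ⟩
  (a zero ∧ false) xor false
    ≡⟨ cong (_xor false) (Bool.∧-zeroʳ (a zero)) ⟩
  false ∎
  where open ≡-Reasoning

-- Injectivity keeps the unit vectors distinct, so no two coefficients are added up in one
-- coordinate.
lookup-in-range : (a : Fin k → 𝔽₂) (ι : Fin k → Fin n) → Injective _≡_ _≡_ ι → ∀ i →
  lookup (lincomb a (unit ∘ ι)) (ι i) ≡ a i
lookup-in-range {k = suc k} a ι ι-inj zero = begin
  lookup (lincomb a (unit ∘ ι)) (ι zero)
    ≡⟨ lookup-lincomb-suc a (unit ∘ ι) (ι zero) ⟩
  (a zero ∧ lookup (unit (ι zero)) (ι zero)) xor
    lookup (lincomb (a ∘ suc) (unit ∘ ι ∘ suc)) (ι zero)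
    ≡⟨ cong₂ (λ b c → (a zero ∧ b) xor c) (lookup-unit-same (ι zero))
         (lookup-off-range (a ∘ suc) (ι ∘ suc) (ι zero) (λ i eq → Fin.0≢1+n (sym (ι-inj eq)))) ⟩
  (a zero ∧ true) xor false
    ≡⟨ Bool.xor-identityʳ _ ⟩
  a zero ∧ true
    ≡⟨ Bool.∧-identityʳ (a zero) ⟩
  a zero ∎
  where open ≡-Reasoning
lookup-in-range {k = suc k} a ι ι-inj (suc i) = begin
  lookup (lincomb a (unit ∘ ι)) (ι (suc i))
    ≡⟨ lookup-lincomb-suc a (unit ∘ ι) (ι (suc i)) ⟩
  (a zero ∧ lookup (unit (ι zero)) (ι (suc i))) xor
    lookup (lincomb (a ∘ suc) (unit ∘ ι ∘ suc)) (ι (suc i))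
    ≡⟨ cong₂ (λ b c → (a zero ∧ b) xor c)
         (lookup-unit-other (ι zero) (ι (suc i)) (λ eq → Fin.0≢1+n (ι-inj eq)))
         (lookup-in-range (a ∘ suc) (ι ∘ suc) (Fin.suc-injective ∘ ι-inj) i) ⟩
  (a zero ∧ false) xor a (suc i)
    ≡⟨ cong (_xor a (suc i)) (Bool.∧-zeroʳ (a zero)) ⟩
  a (suc i) ∎
  where open ≡-Reasoning

weight-⊙ : ∀ a (v : 𝔽₂^ n) → weight (a ⊙ v) ℕ.≤ weight v
weight-⊙ {n} false v = ℕ.≤-trans
  (ℕ.≤-reflexive (trans (cong weight (⊙-false v)) (weight-𝟎 n))) z≤n
weight-⊙ true  v = ℕ.≤-reflexive (cong weight (⊙-true v))

weight-lincomb-unit : (a : Fin k → 𝔽₂) (ι : Fin k → Fin n) →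
  weight (lincomb a (unit ∘ ι)) ℕ.≤ k
weight-lincomb-unit {k = zero} {n = n}  a ι = ℕ.≤-reflexive (weight-𝟎 n)
weight-lincomb-unit {k = suc k} a ι = ℕ.≤-trans
  (weight-⊕ (a zero ⊙ unit (ι zero)) _)
  (ℕ.+-mono-≤ (ℕ.≤-trans (weight-⊙ (a zero) (unit (ι zero)))
                 (ℕ.≤-reflexive (weight-unit (ι zero))))
              (weight-lincomb-unit (a ∘ suc) (ι ∘ suc)))

-- A dependency among fewer than `d` generators, placed on their indices, is a kernel vector of
-- weight below `d` and hence `𝟎`. Its coordinates at those indices are the coefficients, as the
-- indices are distinct.
distance⇒wise-independent : ∀ d (S : Fin n → 𝔽₂^ h) →
  (∀ v → combine S v ≡ 𝟎 → ¬ v ≡ 𝟎 → d ℕ.≤ weight v) → WiseIndependent d S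
distance⇒wise-independent d S S-dist j j<d ι ι-inj a Sa≡𝟎 i with v ≟ᵛ 𝟎
  where v = lincomb a (unit ∘ ι)
... | yes v≡𝟎 = begin
  a i                                    ≡⟨ lookup-in-range a ι ι-inj i ⟨
  lookup (lincomb a (unit ∘ ι)) (ι i)    ≡⟨ cong (λ v → lookup v (ι i)) v≡𝟎 ⟩
  lookup 𝟎 (ι i)                         ≡⟨ Vec.lookup-replicate (ι i) false ⟩
  false                                  ∎
  where open ≡-Reasoning
... | no  v≢𝟎 = contradiction
  (S-dist v (trans (linear-lincomb (combine-linear S) a (unit ∘ ι))
    (trans (lincomb-cong (λ _ → refl) (combine-∘unit S ∘ ι)) Sa≡𝟎)) v≢𝟎)
  (ℕ.<⇒≱ (ℕ.≤-<-trans (weight-lincomb-unit a ι) j<d))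
  where v = lincomb a (unit ∘ ι)

-- Fourier analysis and negative type over ℚ

∑ℚ : (𝔽₂^ n → ℚ) → ℚ
∑ℚ {zero}  f = f []
∑ℚ {suc n} f = ∑ℚ (λ v → f (false ∷ v)) ℚ.+ ∑ℚ (λ v → f (true ∷ v))

∑ℚ-cong : {f g : 𝔽₂^ n → ℚ} → (∀ v → f v ≡ g v) → ∑ℚ f ≡ ∑ℚ g
∑ℚ-cong {zero}  f≗g = f≗g []
∑ℚ-cong {suc n} f≗g = cong₂ ℚ._+_ (∑ℚ-cong (f≗g ∘ (false ∷_))) (∑ℚ-cong (f≗g ∘ (true ∷_)))

∑ℚ-mono : {f g : 𝔽₂^ n → ℚ} → (∀ v → f v ℚ.≤ g v) → ∑ℚ f ℚ.≤ ∑ℚ g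
∑ℚ-mono {zero}  f≤g = f≤g []
∑ℚ-mono {suc n} f≤g = ℚ.+-mono-≤ (∑ℚ-mono (f≤g ∘ (false ∷_))) (∑ℚ-mono (f≤g ∘ (true ∷_)))

∑ℚ-0 : ∀ n → ∑ℚ {n} (λ _ → 0ℚ) ≡ 0ℚ
∑ℚ-0 zero    = refl
∑ℚ-0 (suc n) = cong₂ ℚ._+_ (∑ℚ-0 n) (∑ℚ-0 n)

ℚ-medial : ∀ p q r s → (p ℚ.+ q) ℚ.+ (r ℚ.+ s) ≡ (p ℚ.+ r) ℚ.+ (q ℚ.+ s)
ℚ-medial = solve 4 (λ p q r s → (p :+ q) :+ (r :+ s) := (p :+ r) :+ (q :+ s)) refl
  where open +-*-Solver

∑ℚ-+ : (f g : 𝔽₂^ n → ℚ) → ∑ℚ (λ v → f v ℚ.+ g v) ≡ ∑ℚ f ℚ.+ ∑ℚ g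
∑ℚ-+ {zero}  f g = refl
∑ℚ-+ {suc n} f g = trans
  (cong₂ ℚ._+_ (∑ℚ-+ (f ∘ (false ∷_)) (g ∘ (false ∷_))) (∑ℚ-+ (f ∘ (true ∷_)) (g ∘ (true ∷_))))
  (ℚ-medial (∑ℚ (f ∘ (false ∷_))) _ _ _)

∑ℚ-*ˡ : ∀ c (f : 𝔽₂^ n → ℚ) → ∑ℚ (λ v → c ℚ.* f v) ≡ c ℚ.* ∑ℚ f
∑ℚ-*ˡ {zero}  c f = refl
∑ℚ-*ˡ {suc n} c f = trans
  (cong₂ ℚ._+_ (∑ℚ-*ˡ c (f ∘ (false ∷_))) (∑ℚ-*ˡ c (f ∘ (true ∷_))))
  (sym (ℚ.*-distribˡ-+ c _ _))

∑ℚ-*ʳ : ∀ c (f : 𝔽₂^ n → ℚ) → ∑ℚ (λ v → f v ℚ.* c) ≡ ∑ℚ f ℚ.* c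
∑ℚ-*ʳ c f = trans (∑ℚ-cong (λ v → ℚ.*-comm (f v) c)) (trans (∑ℚ-*ˡ c f) (ℚ.*-comm c (∑ℚ f)))

∑ℚ-shift : ∀ c (f : 𝔽₂^ n → ℚ) → ∑ℚ (λ v → f (c ⊕ v)) ≡ ∑ℚ f
∑ℚ-shift []          f = refl
∑ℚ-shift (false ∷ c) f =
  cong₂ ℚ._+_ (∑ℚ-shift c (f ∘ (false ∷_))) (∑ℚ-shift c (f ∘ (true ∷_)))
∑ℚ-shift (true  ∷ c) f = trans
  (cong₂ ℚ._+_ (∑ℚ-shift c (f ∘ (true ∷_))) (∑ℚ-shift c (f ∘ (false ∷_))))
  (ℚ.+-comm (∑ℚ (f ∘ (true ∷_))) _)

∑ℚ-swap : (f : 𝔽₂^ m → 𝔽₂^ n → ℚ) → ∑ℚ (λ u → ∑ℚ (f u)) ≡ ∑ℚ (λ v → ∑ℚ (λ u → f u v))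
∑ℚ-swap {zero}          f = refl
∑ℚ-swap {suc m} {n = n} f = trans
  (cong₂ ℚ._+_ (∑ℚ-swap (f ∘ (false ∷_))) (∑ℚ-swap (f ∘ (true ∷_))))
  (sym (∑ℚ-+ {n} _ _))

∑ℚ-sumℚ : (f : 𝔽₂^ n → Fin m → ℚ) → ∑ℚ (λ v → sumℚ (f v)) ≡ sumℚ (λ i → ∑ℚ (λ v → f v i))
∑ℚ-sumℚ {n} {zero}  f = ∑ℚ-0 n
∑ℚ-sumℚ {n} {suc m} f = trans (∑ℚ-+ (λ v → f v zero) _)
  (cong (∑ℚ (λ v → f v zero) ℚ.+_) (∑ℚ-sumℚ (λ v → f v ∘ suc)))

sumℚ-*ˡ : ∀ c (f : Fin m → ℚ) → c ℚ.* sumℚ f ≡ sumℚ (λ i → c ℚ.* f i)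
sumℚ-*ˡ {zero}  c f = ℚ.*-zeroʳ c
sumℚ-*ˡ {suc m} c f = trans (ℚ.*-distribˡ-+ c (f zero) _)
  (cong (c ℚ.* f zero ℚ.+_) (sumℚ-*ˡ c (f ∘ suc)))

sumℚ-nonPos : (f : Fin m → ℚ) → (∀ i → f i ℚ.≤ 0ℚ) → sumℚ f ℚ.≤ 0ℚ
sumℚ-nonPos {zero}  f f≤0 = ℚ.≤-refl
sumℚ-nonPos {suc m} f f≤0 = ℚ.+-mono-≤ (f≤0 zero) (sumℚ-nonPos (f ∘ suc) (f≤0 ∘ suc))

-- The number 2ⁿ, written as a sum over the cube so that the doubling step in inductions over `∑ℚ`
-- holds by computation.
pow2 : ℕ → ℚ
pow2 n = ∑ℚ {n} (λ _ → 1ℚ)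

∑ℚ-const : ∀ n c → ∑ℚ {n} (λ _ → c) ≡ pow2 n ℚ.* c
∑ℚ-const n c = trans (∑ℚ-cong {n} (λ _ → sym (ℚ.*-identityˡ c))) (∑ℚ-*ʳ {n} c (λ _ → 1ℚ))

1≤pow2 : ∀ n → 1ℚ ℚ.≤ pow2 n
1≤pow2 zero    = ℚ.≤-refl
1≤pow2 (suc n) = ℚ.+-mono-≤ (1≤pow2 n) (ℚ.≤-trans (ℚ.<⇒≤ 0<1) (1≤pow2 n))

χ : 𝔽₂ → ℚ
χ false = 1ℚ
χ true  = ℚ.- 1ℚ

χ-xor : ∀ a b → χ (a xor b) ≡ χ a ℚ.* χ b
χ-xor false b     = sym (ℚ.*-identityˡ (χ b))
χ-xor true  false = refl
χ-xor true  true  = refl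

χ-∙-⊕ : (a u v : 𝔽₂^ n) → χ (a ∙ (u ⊕ v)) ≡ χ (a ∙ u) ℚ.* χ (a ∙ v)
χ-∙-⊕ a u v = trans (cong χ (∙-distribˡ-⊕ a u v)) (χ-xor (a ∙ u) (a ∙ v))

χ-not : ∀ b c → χ (not b) ℚ.* c ≡ ℚ.- (χ b ℚ.* c)
χ-not b c = trans (cong (ℚ._* c) (χ-not′ b)) (sym (ℚ.neg-distribˡ-* (χ b) c))
  where
  χ-not′ : ∀ b → χ (not b) ≡ ℚ.- χ b
  χ-not′ false = refl
  χ-not′ true  = refl

fourier : (𝔽₂^ n → ℚ) → 𝔽₂^ n → ℚ
fourier G a = ∑ℚ (λ v → χ (a ∙ v) ℚ.* G v)

∑ℚ-neg : (f : 𝔽₂^ n → ℚ) → ∑ℚ (λ v → ℚ.- f v) ≡ ℚ.- ∑ℚ f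
∑ℚ-neg {zero}  f = refl
∑ℚ-neg {suc n} f = trans
  (cong₂ ℚ._+_ (∑ℚ-neg (f ∘ (false ∷_))) (∑ℚ-neg (f ∘ (true ∷_))))
  (sym (ℚ.neg-distrib-+ (∑ℚ (f ∘ (false ∷_))) (∑ℚ (f ∘ (true ∷_)))))

-- Flipping the first coordinate of the frequency changes the sign of the terms whose vector begins
-- with `true`, so these cancel and the other half is counted twice.
fourier-inversion-𝟎 : (G : 𝔽₂^ n → ℚ) → ∑ℚ (fourier G) ≡ pow2 n ℚ.* G 𝟎
fourier-inversion-𝟎 {zero}  G = refl
fourier-inversion-𝟎 {suc n} G = begin
  ∑ℚ (λ a → F a ℚ.+ ∑ℚ (λ v → χ (a ∙ v) ℚ.* G (true ∷ v))) ℚ.+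
    ∑ℚ (λ a → F a ℚ.+ ∑ℚ (λ v → χ (not (a ∙ v)) ℚ.* G (true ∷ v)))
    ≡⟨ cong (∑ℚ (λ a → F a ℚ.+ T′ a) ℚ.+_) (∑ℚ-cong (λ a → cong (F a ℚ.+_)
         (trans (∑ℚ-cong (λ v → χ-not (a ∙ v) (G (true ∷ v)))) (∑ℚ-neg {n} _)))) ⟩
  ∑ℚ (λ a → F a ℚ.+ T′ a) ℚ.+ ∑ℚ (λ a → F a ℚ.+ (ℚ.- T′ a))
    ≡⟨ cong₂ ℚ._+_ (∑ℚ-+ F T′) (trans (∑ℚ-+ F (λ a → ℚ.- T′ a)) (cong (∑ℚ F ℚ.+_) (∑ℚ-neg T′))) ⟩
  (∑ℚ F ℚ.+ ∑ℚ T′) ℚ.+ (∑ℚ F ℚ.+ (ℚ.- ∑ℚ T′))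
    ≡⟨ solve 2 (λ f t → (f :+ t) :+ (f :+ (:- t)) := f :+ f) refl (∑ℚ F) (∑ℚ T′) ⟩
  ∑ℚ F ℚ.+ ∑ℚ F
    ≡⟨ cong (λ z → z ℚ.+ z) (fourier-inversion-𝟎 (G ∘ (false ∷_))) ⟩
  pow2 n ℚ.* G 𝟎 ℚ.+ pow2 n ℚ.* G 𝟎
    ≡⟨ ℚ.*-distribʳ-+ (G 𝟎) (pow2 n) (pow2 n) ⟨
  (pow2 n ℚ.+ pow2 n) ℚ.* G 𝟎 ∎
  where
  open ≡-Reasoning
  open +-*-Solver
  F T′ : 𝔽₂^ n → ℚ
  F  = fourier (G ∘ (false ∷_))
  T′ = fourier (G ∘ (true ∷_))

fourier-shift : (G : 𝔽₂^ n → ℚ) → ∀ r a → fourier (λ v → G (r ⊕ v)) a ≡ χ (a ∙ r) ℚ.* fourier G a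
fourier-shift {n} G r a = begin
  ∑ℚ (λ v → χ (a ∙ v) ℚ.* G (r ⊕ v))
    ≡⟨ ∑ℚ-shift {n} r _ ⟨
  ∑ℚ (λ v → χ (a ∙ (r ⊕ v)) ℚ.* G (r ⊕ (r ⊕ v)))
    ≡⟨ ∑ℚ-cong (λ v → cong₂ ℚ._*_ (χ-∙-⊕ a r v) (cong G (⊕-cancelˡ r v))) ⟩
  ∑ℚ (λ v → (χ (a ∙ r) ℚ.* χ (a ∙ v)) ℚ.* G v)
    ≡⟨ ∑ℚ-cong (λ v → ℚ.*-assoc (χ (a ∙ r)) (χ (a ∙ v)) (G v)) ⟩
  ∑ℚ (λ v → χ (a ∙ r) ℚ.* (χ (a ∙ v) ℚ.* G v))
    ≡⟨ ∑ℚ-*ˡ {n} (χ (a ∙ r)) _ ⟩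
  χ (a ∙ r) ℚ.* fourier G a ∎
  where open ≡-Reasoning

-- The value at `r` is the value at `𝟎` of a translate of `G`, and translation multiplies the
-- transform by a character.
fourier-inversion : (G : 𝔽₂^ n → ℚ) → ∀ r → ∑ℚ (λ a → χ (a ∙ r) ℚ.* fourier G a) ≡ pow2 n ℚ.* G r
fourier-inversion {n} G r = begin
  ∑ℚ (λ a → χ (a ∙ r) ℚ.* fourier G a)     ≡⟨ ∑ℚ-cong (fourier-shift G r) ⟨
  ∑ℚ (fourier (λ v → G (r ⊕ v)))           ≡⟨ fourier-inversion-𝟎 (λ v → G (r ⊕ v)) ⟩
  pow2 n ℚ.* G (r ⊕ 𝟎)                     ≡⟨ cong (λ v → pow2 n ℚ.* G v) (⊕-identityʳ r) ⟩
  pow2 n ℚ.* G r                           ∎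
  where open ≡-Reasoning

p≡-p⇒p≡0 : ∀ p → p ≡ ℚ.- p → p ≡ 0ℚ
p≡-p⇒p≡0 p p≡-p = begin
  p                       ≡⟨ solve 1 (λ p → p := con ½ :* (p :+ p)) refl p ⟩
  ½ ℚ.* (p ℚ.+ p)         ≡⟨ cong (λ q → ½ ℚ.* (p ℚ.+ q)) p≡-p ⟩
  ½ ℚ.* (p ℚ.+ (ℚ.- p))   ≡⟨ cong (½ ℚ.*_) (ℚ.+-inverseʳ p) ⟩
  ½ ℚ.* 0ℚ                ≡⟨⟩
  0ℚ                      ∎
  where
  open ≡-Reasoning
  open +-*-Solver

-- Translating by the period `c` multiplies the coefficient by `χ (a ∙ c)`, here -1, so it equals
-- its own negative.
fourier-invariant : (G : 𝔽₂^ n → ℚ) → ∀ c → (∀ v → G (c ⊕ v) ≡ G v) →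
  ∀ a → a ∙ c ≡ true → fourier G a ≡ 0ℚ
fourier-invariant G c G-inv a a∙c≡1 = p≡-p⇒p≡0 (fourier G a) (begin
  fourier G a                        ≡⟨ ∑ℚ-cong (λ v → cong (χ (a ∙ v) ℚ.*_) (G-inv v)) ⟨
  fourier (λ v → G (c ⊕ v)) a        ≡⟨ fourier-shift G c a ⟩
  χ (a ∙ c) ℚ.* fourier G a          ≡⟨ cong (λ b → χ b ℚ.* fourier G a) a∙c≡1 ⟩
  (ℚ.- 1ℚ) ℚ.* fourier G a           ≡⟨ ℚ.neg-distribˡ-* 1ℚ (fourier G a) ⟨
  ℚ.- (1ℚ ℚ.* fourier G a)           ≡⟨ cong ℚ.-_ (ℚ.*-identityˡ (fourier G a)) ⟩
  ℚ.- fourier G a                    ∎)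
  where open ≡-Reasoning

-- This is a Fourier coefficient of the constant function, which has every period; the unit vector
-- at a nonzero coordinate of `a` is one that `a` detects.
∑ℚ-χ : (a : 𝔽₂^ n) → ¬ a ≡ 𝟎 → ∑ℚ (λ v → χ (a ∙ v)) ≡ 0ℚ
∑ℚ-χ a a≢𝟎 = let i , aᵢ = nonzero-coordinate a a≢𝟎 in trans
  (∑ℚ-cong (λ v → sym (ℚ.*-identityʳ (χ (a ∙ v)))))
  (fourier-invariant (λ _ → 1ℚ) (unit i) (λ _ → refl) a (trans (∙-unit a i) aᵢ))

-- Negative type of the distance on the rational line

p*p-nonNeg : ∀ p → 0ℚ ℚ.≤ p ℚ.* p
p*p-nonNeg p = subst (0ℚ ℚ.≤_) (∣p∣*∣p∣ (ℚ.∣p∣≡p∨∣p∣≡-p p))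
  (ℚ.nonNegative⁻¹ (ℚ.∣ p ∣ ℚ.* ℚ.∣ p ∣) {{ℚ.nonNeg*nonNeg⇒nonNeg ℚ.∣ p ∣ {{ℚ.∣-∣-nonNeg p}} ℚ.∣ p ∣ {{ℚ.∣-∣-nonNeg p}}}})
  where
  open +-*-Solver
  ∣p∣*∣p∣ : ℚ.∣ p ∣ ≡ p ⊎ ℚ.∣ p ∣ ≡ ℚ.- p → ℚ.∣ p ∣ ℚ.* ℚ.∣ p ∣ ≡ p ℚ.* p
  ∣p∣*∣p∣ (inj₁ eq) = cong₂ ℚ._*_ eq eq
  ∣p∣*∣p∣ (inj₂ eq) = trans (cong₂ ℚ._*_ eq eq)
    (solve 1 (λ p → (:- p) :* (:- p) := p :* p) refl p)

-- The quadratic form of the line metric pulled back along `φ`. Negative type means that it is at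
-- most zero on weights `s` of sum zero.
energy : (s φ : 𝔽₂^ n → ℚ) → ℚ
energy s φ = ∑ℚ (λ u → ∑ℚ (λ v → (s u ℚ.* s v) ℚ.* ℚ.∣ φ v ℚ.- φ u ∣))

-- The energy of a set with indicator function x, as x u + x v − 2 x u x v = |x u − x v|.
cut-energy : (s x : 𝔽₂^ n → ℚ) → ∑ℚ s ≡ 0ℚ →
  ∑ℚ (λ u → ∑ℚ (λ v → (s u ℚ.* s v) ℚ.* ((x u ℚ.+ x v) ℚ.- (1ℚ ℚ.+ 1ℚ) ℚ.* (x u ℚ.* x v)))) ≡
  ℚ.- ((1ℚ ℚ.+ 1ℚ) ℚ.* (∑ℚ (λ v → s v ℚ.* x v) ℚ.* ∑ℚ (λ v → s v ℚ.* x v)))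
cut-energy s x ∑s≡0 = begin
  ∑ℚ (λ u → ∑ℚ (λ v → (s u ℚ.* s v) ℚ.* ((x u ℚ.+ x v) ℚ.- 2q ℚ.* (x u ℚ.* x v))))
    ≡⟨ ∑ℚ-cong inner ⟩
  ∑ℚ (λ u → s u ℚ.* A ℚ.+ (s u ℚ.* x u) ℚ.* (ℚ.- (2q ℚ.* A)))
    ≡⟨ ∑ℚ-+ (λ u → s u ℚ.* A) _ ⟩
  ∑ℚ (λ u → s u ℚ.* A) ℚ.+ ∑ℚ (λ u → (s u ℚ.* x u) ℚ.* (ℚ.- (2q ℚ.* A)))
    ≡⟨ cong₂ ℚ._+_ (trans (∑ℚ-*ʳ A s) (cong (ℚ._* A) ∑s≡0)) (∑ℚ-*ʳ _ (λ u → s u ℚ.* x u)) ⟩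
  0ℚ ℚ.* A ℚ.+ A ℚ.* (ℚ.- (2q ℚ.* A))
    ≡⟨ solve 1 (λ a → con 0ℚ :* a :+ a :* (:- (con 2q :* a)) := :- (con 2q :* (a :* a))) refl A ⟩
  ℚ.- (2q ℚ.* (A ℚ.* A)) ∎
  where
  open ≡-Reasoning
  open +-*-Solver
  A 2q : ℚ
  A = ∑ℚ (λ v → s v ℚ.* x v)
  2q = 1ℚ ℚ.+ 1ℚ
  inner : ∀ u → ∑ℚ (λ v → (s u ℚ.* s v) ℚ.* ((x u ℚ.+ x v) ℚ.- 2q ℚ.* (x u ℚ.* x v))) ≡
    s u ℚ.* A ℚ.+ (s u ℚ.* x u) ℚ.* (ℚ.- (2q ℚ.* A))
  inner u = begin
    ∑ℚ (λ v → (s u ℚ.* s v) ℚ.* ((x u ℚ.+ x v) ℚ.- 2q ℚ.* (x u ℚ.* x v)))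
      ≡⟨ ∑ℚ-cong (λ v → solve 4 (λ a b c d → (a :* b) :* ((c :+ d) :- con 2q :* (c :* d))
           := (a :* c) :* b :+ (a :- con 2q :* (a :* c)) :* (b :* d)) refl (s u) (s v) (x u) (x v)) ⟩
    ∑ℚ (λ v → (s u ℚ.* x u) ℚ.* s v ℚ.+ (s u ℚ.- 2q ℚ.* (s u ℚ.* x u)) ℚ.* (s v ℚ.* x v))
      ≡⟨ ∑ℚ-+ (λ v → (s u ℚ.* x u) ℚ.* s v) _ ⟩
    ∑ℚ (λ v → (s u ℚ.* x u) ℚ.* s v) ℚ.+ ∑ℚ (λ v → (s u ℚ.- 2q ℚ.* (s u ℚ.* x u)) ℚ.* (s v ℚ.* x v))
      ≡⟨ cong₂ ℚ._+_ (trans (∑ℚ-*ˡ (s u ℚ.* x u) s) (cong ((s u ℚ.* x u) ℚ.*_) ∑s≡0))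
           (∑ℚ-*ˡ (s u ℚ.- 2q ℚ.* (s u ℚ.* x u)) (λ v → s v ℚ.* x v)) ⟩
    (s u ℚ.* x u) ℚ.* 0ℚ ℚ.+ (s u ℚ.- 2q ℚ.* (s u ℚ.* x u)) ℚ.* A
      ≡⟨ solve 3 (λ a c t → (a :* c) :* con 0ℚ :+ (a :- con 2q :* (a :* c)) :* t
           := a :* t :+ (a :* c) :* (:- (con 2q :* t))) refl (s u) (x u) A ⟩
    s u ℚ.* A ℚ.+ (s u ℚ.* x u) ℚ.* (ℚ.- (2q ℚ.* A)) ∎

-- Peel off the smallest value t of φ: raising it to the next value t′ changes the energy by that of a cut.
sorted-energy-nonPos : (s : 𝔽₂^ n → ℚ) → ∑ℚ s ≡ 0ℚ → ∀ t ts → Linked ℚ._≤_ (t ∷ ts) →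
  (φ : 𝔽₂^ n → ℚ) → (∀ v → φ v ∈ₗ t ∷ ts) → energy s φ ℚ.≤ 0ℚ
sorted-energy-nonPos {n} s ∑s≡0 t [] _ φ φ∈ = ℚ.≤-reflexive (begin
  energy s φ                                ≡⟨ ∑ℚ-cong (λ u → ∑ℚ-cong (λ v → vanish u v)) ⟩
  ∑ℚ {n} (λ u → ∑ℚ {n} (λ v → 0ℚ))          ≡⟨ ∑ℚ-cong {n} (λ _ → ∑ℚ-0 n) ⟩
  ∑ℚ {n} (λ u → 0ℚ)                         ≡⟨ ∑ℚ-0 n ⟩
  0ℚ                                        ∎)
  where
  open ≡-Reasoning
  only : ∀ {p} → p ∈ₗ t ∷ [] → p ≡ t
  only (here eq) = eq
  vanish : ∀ u v → (s u ℚ.* s v) ℚ.* ℚ.∣ φ v ℚ.- φ u ∣ ≡ 0ℚ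
  vanish u v = trans (cong₂ (λ p q → (s u ℚ.* s v) ℚ.* ℚ.∣ p ℚ.- q ∣) (only (φ∈ v)) (only (φ∈ u)))
    (trans (cong (λ p → (s u ℚ.* s v) ℚ.* ℚ.∣ p ∣) (ℚ.+-inverseʳ t)) (ℚ.*-zeroʳ (s u ℚ.* s v)))
sorted-energy-nonPos {n} s ∑s≡0 t (t′ ∷ ts) (t≤t′ ∷ sorted) φ φ∈ = begin
  energy s φ
    ≡⟨ ∑ℚ-cong (λ u → ∑ℚ-cong (λ v → expand u v)) ⟩
  ∑ℚ (λ u → ∑ℚ (λ v → E u v ℚ.+ gap ℚ.* K u v))
    ≡⟨ ∑ℚ-cong (λ u → trans (∑ℚ-+ (E u) _) (cong (∑ℚ (E u) ℚ.+_) (∑ℚ-*ˡ gap (K u)))) ⟩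
  ∑ℚ (λ u → ∑ℚ (E u) ℚ.+ gap ℚ.* ∑ℚ (K u))
    ≡⟨ trans (∑ℚ-+ (λ u → ∑ℚ (E u)) _) (cong (energy s φ′ ℚ.+_) (∑ℚ-*ˡ gap (λ u → ∑ℚ (K u)))) ⟩
  energy s φ′ ℚ.+ gap ℚ.* ∑ℚ (λ u → ∑ℚ (K u))
    ≡⟨ cong (λ p → energy s φ′ ℚ.+ gap ℚ.* p) (cut-energy s x ∑s≡0) ⟩
  energy s φ′ ℚ.+ gap ℚ.* (ℚ.- ((1ℚ ℚ.+ 1ℚ) ℚ.* (A ℚ.* A)))
    ≤⟨ ℚ.+-mono-≤ (sorted-energy-nonPos s ∑s≡0 t′ ts sorted φ′ φ′∈)
         (ℚ.*-monoˡ-≤-nonNeg gap {{ℚ.nonNegative gap≥0}}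
           (ℚ.neg-antimono-≤ (ℚ.*-monoˡ-≤-nonNeg (1ℚ ℚ.+ 1ℚ) (p*p-nonNeg A)))) ⟩
  0ℚ ℚ.+ gap ℚ.* 0ℚ
    ≡⟨ trans (ℚ.+-identityˡ _) (ℚ.*-zeroʳ gap) ⟩
  0ℚ ∎
  where
  open ℚ.≤-Reasoning
  gap : ℚ
  gap = t′ ℚ.- t
  gap≥0 : 0ℚ ℚ.≤ gap
  gap≥0 = subst (ℚ._≤ gap) (ℚ.+-inverseʳ t) (ℚ.+-monoˡ-≤ (ℚ.- t) t≤t′)

  -- `raise` and `low` are read off the position in the list, not off a test for equality with `t`.
  -- A value equal to `t` that is located later does no harm, since sortedness then makes `gap`
  -- zero.
  raise : ∀ {p} → p ∈ₗ t ∷ t′ ∷ ts → ℚ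
  raise     (here _)  = t′
  raise {p} (there _) = p

  low : ∀ {p} → p ∈ₗ t ∷ t′ ∷ ts → ℚ
  low (here _)  = 1ℚ
  low (there _) = 0ℚ

  raise∈ : ∀ {p} (p∈ : p ∈ₗ t ∷ t′ ∷ ts) → raise p∈ ∈ₗ t′ ∷ ts
  raise∈ (here _)   = here refl
  raise∈ (there p∈) = p∈

  t′≤ : ∀ {p} → p ∈ₗ t′ ∷ ts → t′ ℚ.≤ p
  t′≤ (here refl) = ℚ.≤-refl
  t′≤ (there p∈)  = All.lookup (Linked⇒All ℚ.≤-trans ℚ.≤-refl sorted) (there p∈)

  climb : ∀ p → p ∈ₗ t′ ∷ ts → ℚ.∣ p ℚ.- t ∣ ≡ ℚ.∣ p ℚ.- t′ ∣ ℚ.+ gap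
  climb p p∈ = trans (ℚ.0≤p⇒∣p∣≡p (difference-nonNeg (ℚ.≤-trans t≤t′ (t′≤ p∈))))
    (trans (solve 3 (λ p t t′ → p :- t := (p :- t′) :+ (t′ :- t)) refl p t t′)
      (cong (ℚ._+ gap) (sym (ℚ.0≤p⇒∣p∣≡p (difference-nonNeg (t′≤ p∈))))))
    where
    open +-*-Solver
    difference-nonNeg : ∀ {p q} → q ℚ.≤ p → 0ℚ ℚ.≤ p ℚ.- q
    difference-nonNeg {p} {q} q≤p =
      subst (ℚ._≤ p ℚ.- q) (ℚ.+-inverseʳ q) (ℚ.+-monoˡ-≤ (ℚ.- q) q≤p)

  -- Raising the minimum brings it closer by `gap` to every later value, and two values on the same
  -- side keep their distance. The factor after `gap` is |`low p∈` - `low q∈`|, as both are 0 or 1.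
  distance : ∀ {p q} (p∈ : p ∈ₗ t ∷ t′ ∷ ts) (q∈ : q ∈ₗ t ∷ t′ ∷ ts) →
    ℚ.∣ q ℚ.- p ∣ ≡ ℚ.∣ raise q∈ ℚ.- raise p∈ ∣ ℚ.+
      gap ℚ.* ((low p∈ ℚ.+ low q∈) ℚ.- (1ℚ ℚ.+ 1ℚ) ℚ.* (low p∈ ℚ.* low q∈))
  distance (here refl) (here refl) = trans (cong ℚ.∣_∣ (ℚ.+-inverseʳ t))
    (sym (trans (cong₂ ℚ._+_ (cong ℚ.∣_∣ (ℚ.+-inverseʳ t′)) (ℚ.*-zeroʳ gap)) refl))
  distance {q = q} (here refl) (there q∈) = trans (climb q q∈)
    (cong (ℚ.∣ q ℚ.- t′ ∣ ℚ.+_) (sym (ℚ.*-identityʳ gap)))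
  distance {p} (there p∈) (here refl) = trans (∣p-q∣≡∣q-p∣ t p) (trans (climb p p∈)
    (cong₂ ℚ._+_ (∣p-q∣≡∣q-p∣ p t′) (sym (ℚ.*-identityʳ gap))))
  distance {p} {q} (there p∈) (there q∈) =
    sym (trans (cong (ℚ.∣ q ℚ.- p ∣ ℚ.+_) (ℚ.*-zeroʳ gap)) (ℚ.+-identityʳ _))

  φ′ x : 𝔽₂^ n → ℚ
  φ′ v = raise (φ∈ v)
  x v  = low (φ∈ v)

  φ′∈ : ∀ v → φ′ v ∈ₗ t′ ∷ ts
  φ′∈ v = raise∈ (φ∈ v)

  A : ℚ
  A = ∑ℚ (λ v → s v ℚ.* x v)

  E K : 𝔽₂^ n → 𝔽₂^ n → ℚ
  E u v = (s u ℚ.* s v) ℚ.* ℚ.∣ φ′ v ℚ.- φ′ u ∣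
  K u v = (s u ℚ.* s v) ℚ.* ((x u ℚ.+ x v) ℚ.- (1ℚ ℚ.+ 1ℚ) ℚ.* (x u ℚ.* x v))

  expand : ∀ u v → (s u ℚ.* s v) ℚ.* ℚ.∣ φ v ℚ.- φ u ∣ ≡ E u v ℚ.+ gap ℚ.* K u v
  expand u v = trans (cong ((s u ℚ.* s v) ℚ.*_) (distance (φ∈ u) (φ∈ v)))
    (solve 4 (λ a b c d → a :* (b :+ c :* d) := a :* b :+ c :* (a :* d)) refl
      (s u ℚ.* s v) (ℚ.∣ φ′ v ℚ.- φ′ u ∣) gap ((x u ℚ.+ x v) ℚ.- (1ℚ ℚ.+ 1ℚ) ℚ.* (x u ℚ.* x v)))
    where open +-*-Solver

values : (𝔽₂^ n → ℚ) → List ℚ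
values {zero}  φ = φ [] ∷ []
values {suc n} φ = values (φ ∘ (false ∷_)) ++ values (φ ∘ (true ∷_))

∈-values : (φ : 𝔽₂^ n → ℚ) → ∀ v → φ v ∈ₗ values φ
∈-values φ []          = here refl
∈-values φ (false ∷ v) = ∈-++⁺ˡ (∈-values (φ ∘ (false ∷_)) v)
∈-values φ (true  ∷ v) = ∈-++⁺ʳ (values (φ ∘ (false ∷_))) (∈-values (φ ∘ (true ∷_)) v)

-- Sorting the list of all values brings any `φ` into the form that the peeling needs; repeated
-- values merely give gaps of zero.
energy-nonPos : (s φ : 𝔽₂^ n → ℚ) → ∑ℚ s ≡ 0ℚ → energy s φ ℚ.≤ 0ℚ
energy-nonPos s φ ∑s≡0 with sort (values φ) | sort-↗ (values φ) |
  (λ v → ∈-resp-↭ (↭-sym (sort-↭ (values φ))) (∈-values φ v))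
... | []     | _      | φ∈ with () ← φ∈ 𝟎
... | t ∷ ts | sorted | φ∈ = sorted-energy-nonPos s ∑s≡0 t ts sorted φ φ∈

-- Fourier transform of the translation-averaged metric

autocorrelation : (Fin m → 𝔽₂^ n → ℚ) → 𝔽₂^ n → ℚ
autocorrelation φ r = ∑ℚ (λ v → sumℚ (λ i → ℚ.∣ φ i (v ⊕ r) ℚ.- φ i v ∣))

-- Substituting v = u ⊕ r splits `χ (a ∙ r)` into `χ (a ∙ u)` times `χ (a ∙ v)`, so every coordinate
-- contributes an energy whose weights are a character. Nontrivial characters sum to zero, which is
-- what negative type asks of the weights.
fourier-autocorrelation : (φ : Fin m → 𝔽₂^ n → ℚ) → ∀ a →
  fourier (autocorrelation φ) a ≡ sumℚ (λ i → energy (λ v → χ (a ∙ v)) (φ i))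
fourier-autocorrelation {m} {n} φ a = begin
  ∑ℚ (λ r → χ (a ∙ r) ℚ.* ∑ℚ (λ u → sumℚ (λ i → D i u r)))
    ≡⟨ ∑ℚ-cong (λ r → trans (cong (χ (a ∙ r) ℚ.*_) (∑ℚ-sumℚ (λ u i → D i u r)))
         (trans (sumℚ-*ˡ (χ (a ∙ r)) (λ i → ∑ℚ (λ u → D i u r)))
           (sumℚ-cong (λ i → sym (∑ℚ-*ˡ (χ (a ∙ r)) (λ u → D i u r)))))) ⟩
  ∑ℚ (λ r → sumℚ (λ i → ∑ℚ (λ u → χ (a ∙ r) ℚ.* D i u r)))
    ≡⟨ ∑ℚ-sumℚ (λ r i → ∑ℚ (λ u → χ (a ∙ r) ℚ.* D i u r)) ⟩
  sumℚ (λ i → ∑ℚ (λ r → ∑ℚ (λ u → χ (a ∙ r) ℚ.* D i u r)))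
    ≡⟨ sumℚ-cong (λ i → trans (∑ℚ-swap (λ r u → χ (a ∙ r) ℚ.* D i u r)) (∑ℚ-cong (recentre i))) ⟩
  sumℚ (λ i → energy (λ v → χ (a ∙ v)) (φ i)) ∎
  where
  open ≡-Reasoning
  D : Fin m → 𝔽₂^ n → 𝔽₂^ n → ℚ
  D i u r = ℚ.∣ φ i (u ⊕ r) ℚ.- φ i u ∣
  recentre : ∀ i u → ∑ℚ (λ r → χ (a ∙ r) ℚ.* D i u r) ≡
    ∑ℚ (λ v → (χ (a ∙ u) ℚ.* χ (a ∙ v)) ℚ.* ℚ.∣ φ i v ℚ.- φ i u ∣)
  recentre i u = trans (sym (∑ℚ-shift u (λ r → χ (a ∙ r) ℚ.* D i u r)))
    (∑ℚ-cong (λ v → cong₂ (λ p w → p ℚ.* ℚ.∣ φ i w ℚ.- φ i u ∣) (χ-∙-⊕ a u v) (⊕-cancelˡ u v)))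

fourier-autocorrelation-nonPos : (φ : Fin m → 𝔽₂^ n → ℚ) → ∀ a → ¬ a ≡ 𝟎 →
  fourier (autocorrelation φ) a ℚ.≤ 0ℚ
fourier-autocorrelation-nonPos φ a a≢𝟎 =
  ℚ.≤-trans (ℚ.≤-reflexive (fourier-autocorrelation φ a))
    (sumℚ-nonPos _ (λ i → energy-nonPos (λ v → χ (a ∙ v)) (φ i) (∑ℚ-χ a a≢𝟎)))

-- Real numbers

p≤∣p∣ : ∀ p → p ℚ.≤ ℚ.∣ p ∣
p≤∣p∣ p with ℚ.≤-total 0ℚ p
... | inj₁ 0≤p = ℚ.≤-reflexive (sym (ℚ.0≤p⇒∣p∣≡p 0≤p))
... | inj₂ p≤0 = ℚ.≤-trans p≤0 (ℚ.0≤∣p∣ p)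

p≤q+∣p-q∣ : ∀ p q → p ℚ.≤ q ℚ.+ ℚ.∣ p ℚ.- q ∣
p≤q+∣p-q∣ p q = subst (ℚ._≤ q ℚ.+ ℚ.∣ p ℚ.- q ∣)
  (solve 2 (λ p q → q :+ (p :- q) := p) refl p q)
  (ℚ.+-monoʳ-≤ q (p≤∣p∣ (p ℚ.- q)))
  where open +-*-Solver

∣p-q∣≤ : ∀ {p q e} → p ℚ.≤ q ℚ.+ e → q ℚ.≤ p ℚ.+ e → ℚ.∣ p ℚ.- q ∣ ℚ.≤ e
∣p-q∣≤ {p} {q} {e} p≤q+e q≤p+e with ℚ.∣p∣≡p∨∣p∣≡-p (p ℚ.- q)
... | inj₁ eq = subst₂ ℚ._≤_ (sym eq) (solve 2 (λ q e → (q :+ e) :- q := e) refl q e)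
  (ℚ.+-monoˡ-≤ (ℚ.- q) p≤q+e)
  where open +-*-Solver
... | inj₂ eq = subst₂ ℚ._≤_ (trans (solve 2 (λ p q → q :- p := :- (p :- q)) refl p q) (sym eq))
  (solve 2 (λ p e → (p :+ e) :- p := e) refl p e)
  (ℚ.+-monoˡ-≤ (ℚ.- p) q≤p+e)
  where open +-*-Solver

0<½*e : ∀ {e} → 0ℚ ℚ.< e → 0ℚ ℚ.< ½ ℚ.* e
0<½*e {e} e>0 = ℚ.positive⁻¹ (½ ℚ.* e) {{ℚ.pos*pos⇒pos ½ e {{ℚ.positive e>0}}}}

½*e<e : ∀ {e} → 0ℚ ℚ.< e → ½ ℚ.* e ℚ.< e
½*e<e {e} e>0 = subst (½ ℚ.* e ℚ.<_) (ℚ.*-identityˡ e)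
  (ℚ.*-monoˡ-<-pos e {{ℚ.positive e>0}} (from-yes (½ ℚ.<? 1ℚ)))

½*e+½*e : ∀ p e → (p ℚ.+ ½ ℚ.* e) ℚ.+ ½ ℚ.* e ≡ p ℚ.+ e
½*e+½*e = solve 2 (λ p e → (p :+ con ½ :* e) :+ con ½ :* e := p :+ e) refl
  where open +-*-Solver

both : ∀ {P Q : ℕ → Set} → ∃[ N ] (∀ t → N ℕ.≤ t → P t) → ∃[ N ] (∀ t → N ℕ.≤ t → Q t) →
  ∃[ N ] (∀ t → N ℕ.≤ t → P t × Q t)
both (M , p) (N , q) = M ℕ.⊔ N , λ t M⊔N≤t →
  p t (ℕ.≤-trans (ℕ.m≤m⊔n M N) M⊔N≤t) , q t (ℕ.≤-trans (ℕ.m≤n⊔m M N) M⊔N≤t)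

later : ∀ {P Q : ℕ → Set} → (∀ t → P t → Q t) → ∃[ N ] (∀ t → N ℕ.≤ t → P t) →
  ∃[ N ] (∀ t → N ℕ.≤ t → Q t)
later P⇒Q (N , p) = N , λ t N≤t → P⇒Q t (p t N≤t)

termwise-≤ : ∀ x y → (∀ t → seq x t ℚ.≤ seq y t) → x ≤ℝ y
termwise-≤ x y x≤y e e>0 = 0 , λ t _ → ℚ.≤-trans (x≤y t)
  (subst (ℚ._≤ seq y t ℚ.+ e) (ℚ.+-identityʳ (seq y t)) (ℚ.+-monoʳ-≤ (seq y t) (ℚ.<⇒≤ e>0)))

eventually-≈ : ∀ x y → ∃[ N ] (∀ t → N ℕ.≤ t → seq x t ≡ seq y t) → x ≈ℝ y
eventually-≈ x y x≡y e e>0 = later (λ t eq → subst (ℚ._< e)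
  (sym (trans (cong (λ z → ℚ.∣ z ℚ.- seq y t ∣) eq) (cong ℚ.∣_∣ (ℚ.+-inverseʳ (seq y t))))) e>0) x≡y

termwise-≈ : ∀ x y → (∀ t → seq x t ≡ seq y t) → x ≈ℝ y
termwise-≈ x y x≡y = eventually-≈ x y (0 , λ t _ → x≡y t)

≈-refl : ∀ x → x ≈ℝ x
≈-refl x = termwise-≈ x x (λ _ → refl)

≈⇒≤ : ∀ x y → x ≈ℝ y → x ≤ℝ y
≈⇒≤ x y x≈y e e>0 = later
  (λ t d<e → ℚ.≤-trans (p≤q+∣p-q∣ (seq x t) (seq y t)) (ℚ.+-monoʳ-≤ (seq y t) (ℚ.<⇒≤ d<e)))
  (x≈y e e>0)

≈-sym : ∀ x y → x ≈ℝ y → y ≈ℝ x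
≈-sym x y x≈y e e>0 =
  later (λ t → subst (ℚ._< e) (∣p-q∣≡∣q-p∣ (seq x t) (seq y t))) (x≈y e e>0)

≤-antisym : ∀ x y → x ≤ℝ y → y ≤ℝ x → x ≈ℝ y
≤-antisym x y x≤y y≤x e e>0 = later
  -- The relation `_≈ℝ_` demands a strict bound, so both inequalities are taken at half of `e`.
  (λ t (p , q) → ℚ.≤-<-trans (∣p-q∣≤ p q) (½*e<e e>0))
  (both (x≤y (½ ℚ.* e) (0<½*e e>0)) (y≤x (½ ℚ.* e) (0<½*e e>0)))

≤-trans : ∀ x y z → x ≤ℝ y → y ≤ℝ z → x ≤ℝ z
≤-trans x y z x≤y y≤z e e>0 = later
  (λ t (p , q) → ℚ.≤-trans p (ℚ.≤-trans (ℚ.+-monoˡ-≤ (½ ℚ.* e) q)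
    (ℚ.≤-reflexive (½*e+½*e (seq z t) e))))
  (both (x≤y (½ ℚ.* e) (0<½*e e>0)) (y≤z (½ ℚ.* e) (0<½*e e>0)))

≈-trans : ∀ x y z → x ≈ℝ y → y ≈ℝ z → x ≈ℝ z
≈-trans x y z x≈y y≈z = ≤-antisym x z
  (≤-trans x y z (≈⇒≤ x y x≈y) (≈⇒≤ y z y≈z))
  (≤-trans z y x (≈⇒≤ z y (≈-sym y z y≈z)) (≈⇒≤ y x (≈-sym x y x≈y)))

≤ℝ-preorder : Preorder 0ℓ 0ℓ 0ℓ
≤ℝ-preorder = record
  { Carrier    = ℝ
  ; _≈_        = _≈ℝ_
  ; _≲_        = _≤ℝ_
  ; isPreorder = record
    { isEquivalence = record
      { refl  = λ {x} → ≈-refl x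
      ; sym   = λ {x} {y} → ≈-sym x y
      ; trans = λ {x} {y} {z} → ≈-trans x y z
      }
    ; reflexive     = λ {x} {y} → ≈⇒≤ x y
    ; trans         = λ {x} {y} {z} → ≤-trans x y z
    }
  }

module ≤ℝ-Reasoning where
  open import Relation.Binary.Reasoning.Preorder ≤ℝ-preorder public

+ℝ-mono-≤ : ∀ x x′ y y′ → x ≤ℝ x′ → y ≤ℝ y′ → x +ℝ y ≤ℝ x′ +ℝ y′
+ℝ-mono-≤ x x′ y y′ x≤x′ y≤y′ e e>0 = later
  (λ t (p , q) → ℚ.≤-trans (ℚ.+-mono-≤ p q) (ℚ.≤-reflexive
    (solve 3 (λ a b e → (a :+ con ½ :* e) :+ (b :+ con ½ :* e) := (a :+ b) :+ e) refl
      (seq x′ t) (seq y′ t) e)))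
  (both (x≤x′ (½ ℚ.* e) (0<½*e e>0)) (y≤y′ (½ ℚ.* e) (0<½*e e>0)))
  where open +-*-Solver

∑-mono-≤ : (f g : 𝔽₂^ n → ℝ) → (∀ v → f v ≤ℝ g v) → ∑ f ≤ℝ ∑ g
∑-mono-≤ {zero}  f g f≤g = f≤g []
∑-mono-≤ {suc n} f g f≤g = +ℝ-mono-≤ (∑ (f ∘ (false ∷_))) (∑ (g ∘ (false ∷_)))
  (∑ (f ∘ (true ∷_))) (∑ (g ∘ (true ∷_)))
  (∑-mono-≤ (f ∘ (false ∷_)) (g ∘ (false ∷_)) (f≤g ∘ (false ∷_)))
  (∑-mono-≤ (f ∘ (true ∷_)) (g ∘ (true ∷_)) (f≤g ∘ (true ∷_)))

∑-cong : (f g : 𝔽₂^ n → ℝ) → (∀ v → f v ≈ℝ g v) → ∑ f ≈ℝ ∑ g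
∑-cong f g f≈g = ≤-antisym (∑ f) (∑ g)
  (∑-mono-≤ f g (λ v → ≈⇒≤ (f v) (g v) (f≈g v)))
  (∑-mono-≤ g f (λ v → ≈⇒≤ (g v) (f v) (≈-sym (f v) (g v) (f≈g v))))

seq-∑ : (f : 𝔽₂^ n → ℝ) → ∀ t → seq (∑ f) t ≡ ∑ℚ (λ v → seq (f v) t)
seq-∑ {zero}  f t = refl
seq-∑ {suc n} f t = cong₂ ℚ._+_ (seq-∑ (f ∘ (false ∷_)) t) (seq-∑ (f ∘ (true ∷_)) t)

seq-sumℝ : (f : Fin m → ℝ) → ∀ t → seq (sumℝ f) t ≡ sumℚ (λ i → seq (f i) t)
seq-sumℝ {zero}  f t = refl
seq-sumℝ {suc m} f t = cong (seq (f zero) t ℚ.+_) (seq-sumℝ (f ∘ suc) t)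

-- A nonnegative real may have negative terms, but eventually they are at least -½e, and such a term
-- differs from its absolute value by at most e.
∣x∣≈x : ∀ x → 0ℝ ≤ℝ x → ∣ x ∣ℝ ≈ℝ x
∣x∣≈x x 0≤x = ≤-antisym ∣ x ∣ℝ x
  (λ e e>0 → later (λ t p → bound e>0 p) (0≤x (½ ℚ.* e) (0<½*e e>0)))
  (termwise-≤ x ∣ x ∣ℝ (λ t → p≤∣p∣ (seq x t)))
  where
  open +-*-Solver
  bound : ∀ {e p} → 0ℚ ℚ.< e → 0ℚ ℚ.≤ p ℚ.+ ½ ℚ.* e → ℚ.∣ p ∣ ℚ.≤ p ℚ.+ e
  bound {e} {p} e>0 0≤p+½e with ℚ.∣p∣≡p∨∣p∣≡-p p
  ... | inj₁ eq = subst (ℚ._≤ p ℚ.+ e) (trans (ℚ.+-identityʳ p) (sym eq))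
    (ℚ.+-monoʳ-≤ p (ℚ.<⇒≤ e>0))
  ... | inj₂ eq = subst₂ ℚ._≤_ (trans (ℚ.+-identityʳ (ℚ.- p)) (sym eq))
    (solve 2 (λ p e → (:- p) :+ ((p :+ con ½ :* e) :+ (p :+ con ½ :* e)) := p :+ e) refl p e)
    (ℚ.+-monoʳ-≤ (ℚ.- p) (ℚ.+-mono-≤ 0≤p+½e 0≤p+½e))

<ℝ⇒≤ℝ : ∀ x y → x <ℝ y → x ≤ℝ y
<ℝ⇒≤ℝ x y (q , q>0 , x+q≤y) e e>0 = later (λ t p → begin
  seq x t              ≡⟨ ℚ.+-identityʳ (seq x t) ⟨
  seq x t ℚ.+ 0ℚ       ≤⟨ ℚ.+-monoʳ-≤ (seq x t) (ℚ.<⇒≤ q>0) ⟩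
  seq x t ℚ.+ q        ≤⟨ p ⟩
  seq y t              ≡⟨ ℚ.+-identityʳ (seq y t) ⟨
  seq y t ℚ.+ 0ℚ       ≤⟨ ℚ.+-monoʳ-≤ (seq y t) (ℚ.<⇒≤ e>0) ⟩
  seq y t ℚ.+ e        ∎) x+q≤y
  where open ℚ.≤-Reasoning

-- Expanding (x + e′) (y + e′) ≥ 0 shows that x y is at least −e′ M = −e.
*ℝ-nonNeg : ∀ x y → 0ℝ ≤ℝ x → 0ℝ ≤ℝ y → 0ℝ ≤ℝ x *ℝ y
*ℝ-nonNeg x y 0≤x 0≤y e e>0 =
  later bound (both (both (0≤x e′ e′>0) (0≤y e′ e′>0)) (both (A , ∣x∣≤a′) (B , ∣y∣≤b′)))
  where
  open ℚ.≤-Reasoning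
  open +-*-Solver
  A B : ℕ
  A = proj₁ (eventually-bounded x)
  B = proj₁ (eventually-bounded y)
  a b : ℚ
  a = proj₁ (proj₂ (eventually-bounded x))
  b = proj₁ (proj₂ (eventually-bounded y))
  a>0 : 0ℚ ℚ.< a
  a>0 = proj₁ (proj₂ (proj₂ (eventually-bounded x)))
  b>0 : 0ℚ ℚ.< b
  b>0 = proj₁ (proj₂ (proj₂ (eventually-bounded y)))
  ∣x∣≤a′ : ∀ t → A ℕ.≤ t → ℚ.∣ seq x t ∣ ℚ.≤ a
  ∣x∣≤a′ = proj₂ (proj₂ (proj₂ (eventually-bounded x)))
  ∣y∣≤b′ : ∀ t → B ℕ.≤ t → ℚ.∣ seq y t ∣ ℚ.≤ b
  ∣y∣≤b′ = proj₂ (proj₂ (proj₂ (eventually-bounded y)))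
  M : ℚ
  -- `M` has to bound x + y + e′. The summand 1 covers e′, and the summand e ensures e ≤ M and
  -- thereby e′ ≤ 1.
  M = (a ℚ.+ b) ℚ.+ (1ℚ ℚ.+ e)
  M>0 : 0ℚ ℚ.< M
  M>0 = ℚ.+-mono-< (ℚ.+-mono-< a>0 b>0) (ℚ.+-mono-< 0<1 e>0)
  instance
    M-pos : ℚ.Positive M
    M-pos = ℚ.positive M>0
    M-nonZero : ℚ.NonZero M
    M-nonZero = ℚ.pos⇒nonZero M
    e-pos : ℚ.Positive e
    e-pos = ℚ.positive e>0
    M⁻¹-pos : ℚ.Positive (ℚ.1/ M)
    M⁻¹-pos = ℚ.1/pos⇒pos M
    e′-pos : ℚ.Positive (e ℚ.* ℚ.1/ M)
    e′-pos = ℚ.pos*pos⇒pos e (ℚ.1/ M)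
  e′ : ℚ
  e′ = e ℚ.* ℚ.1/ M
  e′>0 : 0ℚ ℚ.< e′
  e′>0 = ℚ.positive⁻¹ e′
  e′*M : e′ ℚ.* M ≡ e
  e′*M = trans (ℚ.*-assoc e (ℚ.1/ M) M) (trans (cong (e ℚ.*_) (ℚ.*-inverseˡ M)) (ℚ.*-identityʳ e))
  0≤+ : ∀ {p q} → 0ℚ ℚ.≤ p → 0ℚ ℚ.≤ q → 0ℚ ℚ.≤ p ℚ.+ q
  0≤+ = ℚ.+-mono-≤
  e≤M : e ℚ.≤ M
  e≤M = subst₂ ℚ._≤_ (ℚ.+-identityˡ e) (solve 3 (λ a b e → (a :+ (b :+ con 1ℚ)) :+ e
      := (a :+ b) :+ (con 1ℚ :+ e)) refl a b e)
    (ℚ.+-monoˡ-≤ e (0≤+ (ℚ.<⇒≤ a>0) (0≤+ (ℚ.<⇒≤ b>0) (ℚ.<⇒≤ 0<1))))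
  e′≤1 : e′ ℚ.≤ 1ℚ
  e′≤1 = ℚ.*-cancelʳ-≤-pos M (subst₂ ℚ._≤_ (sym e′*M) (sym (ℚ.*-identityˡ M)) e≤M)
  bound : ∀ t → ((0ℚ ℚ.≤ seq x t ℚ.+ e′) × (0ℚ ℚ.≤ seq y t ℚ.+ e′)) ×
    ((ℚ.∣ seq x t ∣ ℚ.≤ a) × (ℚ.∣ seq y t ∣ ℚ.≤ b)) → 0ℚ ℚ.≤ seq x t ℚ.* seq y t ℚ.+ e
  bound t ((0≤x+e′ , 0≤y+e′) , (∣x∣≤a , ∣y∣≤b)) = begin
    0ℚ
      ≤⟨ ℚ.nonNegative⁻¹ ((p ℚ.+ e′) ℚ.* (q ℚ.+ e′))
           {{ℚ.nonNeg*nonNeg⇒nonNeg (p ℚ.+ e′) {{ℚ.nonNegative 0≤x+e′}}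
               (q ℚ.+ e′) {{ℚ.nonNegative 0≤y+e′}}}} ⟩
    (p ℚ.+ e′) ℚ.* (q ℚ.+ e′)
      ≡⟨ solve 3 (λ p q d → (p :+ d) :* (q :+ d) := p :* q :+ d :* ((p :+ q) :+ d)) refl p q e′ ⟩
    p ℚ.* q ℚ.+ e′ ℚ.* ((p ℚ.+ q) ℚ.+ e′)
      ≤⟨ ℚ.+-monoʳ-≤ (p ℚ.* q) (ℚ.*-monoˡ-≤-nonNeg e′ {{ℚ.pos⇒nonNeg e′}}
           (ℚ.+-mono-≤ (ℚ.+-mono-≤ (ℚ.≤-trans (p≤∣p∣ p) ∣x∣≤a) (ℚ.≤-trans (p≤∣p∣ q) ∣y∣≤b))
             (ℚ.≤-trans e′≤1 (subst (ℚ._≤ 1ℚ ℚ.+ e) (ℚ.+-identityʳ 1ℚ)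
               (ℚ.+-monoʳ-≤ 1ℚ (ℚ.<⇒≤ e>0)))))) ⟩
    p ℚ.* q ℚ.+ e′ ℚ.* M
      ≡⟨ cong (p ℚ.* q ℚ.+_) e′*M ⟩
    p ℚ.* q ℚ.+ e ∎
    where
    p q : ℚ
    p = seq x t
    q = seq y t

*ℝ-monoˡ-≤ : ∀ z x y → 0ℝ ≤ℝ z → x ≤ℝ y → z *ℝ x ≤ℝ z *ℝ y
*ℝ-monoˡ-≤ z x y 0≤z x≤y = begin
  z *ℝ x
    ≈⟨ termwise-≈ (z *ℝ x) (0ℝ +ℝ z *ℝ x) (λ t → sym (ℚ.+-identityˡ _)) ⟩
  0ℝ +ℝ z *ℝ x
    ≲⟨ +ℝ-mono-≤ 0ℝ (z *ℝ (y -ℝ x)) (z *ℝ x) (z *ℝ x)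
         (*ℝ-nonNeg z (y -ℝ x) 0≤z 0≤y-x) (≈⇒≤ (z *ℝ x) (z *ℝ x) (≈-refl (z *ℝ x))) ⟩
  z *ℝ (y -ℝ x) +ℝ z *ℝ x
    ≈⟨ termwise-≈ (z *ℝ (y -ℝ x) +ℝ z *ℝ x) (z *ℝ y) (λ t →
         solve 3 (λ z x y → z :* (y :- x) :+ z :* x := z :* y) refl (seq z t) (seq x t) (seq y t)) ⟩
  z *ℝ y ∎
  where
  open ≤ℝ-Reasoning
  open +-*-Solver
  0≤y-x : 0ℝ ≤ℝ y -ℝ x
  0≤y-x e e>0 = later (λ t p → subst₂ ℚ._≤_ (ℚ.+-inverseʳ (seq x t))
    (solve 3 (λ x y e → (y :+ e) :- x := (y :- x) :+ e) refl (seq x t) (seq y t) e)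
    (ℚ.+-monoˡ-≤ (ℚ.- seq x t) p)) (x≤y e e>0)

*ℝ-pos : ∀ x y → 0ℝ <ℝ x → 0ℝ <ℝ y → 0ℝ <ℝ x *ℝ y
*ℝ-pos x y (p , p>0 , p≤x) (q , q>0 , q≤y) =
  p ℚ.* q , ℚ.positive⁻¹ (p ℚ.* q) {{ℚ.pos*pos⇒pos p {{ℚ.positive p>0}} q {{ℚ.positive q>0}}}} ,
  later (λ t (p≤xt , q≤yt) → begin
    0ℚ ℚ.+ p ℚ.* q         ≡⟨ ℚ.+-identityˡ (p ℚ.* q) ⟩
    p ℚ.* q                ≤⟨ ℚ.*-monoˡ-≤-nonNeg p {{ℚ.nonNegative (ℚ.<⇒≤ p>0)}} (drop-0 q q≤yt) ⟩
    p ℚ.* seq y t          ≤⟨ ℚ.*-monoʳ-≤-nonNeg (seq y t)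
                                {{ℚ.nonNegative (ℚ.≤-trans (ℚ.<⇒≤ q>0) (drop-0 q q≤yt))}} (drop-0 p p≤xt) ⟩
    seq x t ℚ.* seq y t    ∎)
  (both p≤x q≤y)
  where
  open ℚ.≤-Reasoning
  drop-0 : ∀ p {q} → 0ℚ ℚ.+ p ℚ.≤ q → p ℚ.≤ q
  drop-0 p {q} = subst (ℚ._≤ q) (ℚ.+-identityˡ p)

fromℚ-pos : ∀ q → 0ℚ ℚ.< q → 0ℝ <ℝ fromℚ q
fromℚ-pos q q>0 = q , q>0 , 0 , λ _ _ → ℚ.≤-reflexive (ℚ.+-identityˡ q)

-- Reciprocals of positive reals

module _ (x : ℝ) (x>0 : 0ℝ <ℝ x) where
  open Reciprocal x x>0

  reciprocal-nonNeg : 0ℝ ≤ℝ reciprocal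
  reciprocal-nonNeg = termwise-≤ 0ℝ reciprocal (λ t →
    ℚ.<⇒≤ (ℚ.positive⁻¹ (terms t) {{terms-pos t}}))

  -- The reciprocal is taken of truncated terms, and the truncation is known to be without effect
  -- only from the index supplied by the positivity proof.
  eventually-inverse : ∃[ N ] (∀ t → N ℕ.≤ t → seq x t ℚ.* terms t ≡ 1ℚ)
  eventually-inverse = N₀ , λ t N₀≤t → trans (ℚ.*-comm (seq x t) (terms t))
    (trans (cong (terms t ℚ.*_) (sym (truncated≡ t N₀≤t))) (terms-inverse t))

  reciprocal-inverse : x *ℝ reciprocal ≈ℝ 1ℝ
  reciprocal-inverse = eventually-≈ (x *ℝ reciprocal) 1ℝ eventually-inverse

  ÷-* : ∀ y → (y ÷ℝ x [ x>0 ]) *ℝ x ≈ℝ y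
  ÷-* y = eventually-≈ ((y ÷ℝ x [ x>0 ]) *ℝ x) y (later (λ t eq → begin
    (seq y t ℚ.* terms t) ℚ.* seq x t  ≡⟨ solve 3 (λ y r x → (y :* r) :* x := y :* (x :* r)) refl
                                            (seq y t) (terms t) (seq x t) ⟩
    seq y t ℚ.* (seq x t ℚ.* terms t)  ≡⟨ cong (seq y t ℚ.*_) eq ⟩
    seq y t ℚ.* 1ℚ                     ≡⟨ ℚ.*-identityʳ (seq y t) ⟩
    seq y t                            ∎) eventually-inverse)
    where
    open ≡-Reasoning
    open +-*-Solver

  *-÷ : ∀ y → (y *ℝ x) ÷ℝ x [ x>0 ] ≈ℝ y
  *-÷ y = eventually-≈ ((y *ℝ x) ÷ℝ x [ x>0 ]) y (later (λ t eq → begin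
    (seq y t ℚ.* seq x t) ℚ.* terms t  ≡⟨ ℚ.*-assoc (seq y t) (seq x t) (terms t) ⟩
    seq y t ℚ.* (seq x t ℚ.* terms t)  ≡⟨ cong (seq y t ℚ.*_) eq ⟩
    seq y t ℚ.* 1ℚ                     ≡⟨ ℚ.*-identityʳ (seq y t) ⟩
    seq y t                            ∎) eventually-inverse)
    where open ≡-Reasoning

  -- An eventual upper bound `B` for the terms of `x` gives the lower bound 1/B for those of the
  -- reciprocal.
  reciprocal-pos : 0ℝ <ℝ reciprocal
  reciprocal-pos = from-bound (eventually-bounded x)
    where
    open ℚ.≤-Reasoning
    from-bound : EventuallyBounded (seq x) → 0ℝ <ℝ reciprocal
    from-bound (N , B , B>0 , x≤B) =
      ℚ.1/ B , ℚ.positive⁻¹ (ℚ.1/ B) , later bound (both (N , x≤B) eventually-inverse)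
      where
      instance
        B-pos : ℚ.Positive B
        B-pos = ℚ.positive B>0
        B-nonZero : ℚ.NonZero B
        B-nonZero = ℚ.pos⇒nonZero B
        B⁻¹-pos : ℚ.Positive (ℚ.1/ B)
        B⁻¹-pos = ℚ.1/pos⇒pos B
      bound : ∀ t → (ℚ.∣ seq x t ∣ ℚ.≤ B) × (seq x t ℚ.* terms t ≡ 1ℚ) →
        0ℚ ℚ.+ ℚ.1/ B ℚ.≤ terms t
      bound t (∣x∣≤B , inverse) = ℚ.*-cancelˡ-≤-pos B (begin
        B ℚ.* (0ℚ ℚ.+ ℚ.1/ B)   ≡⟨ cong (B ℚ.*_) (ℚ.+-identityˡ (ℚ.1/ B)) ⟩
        B ℚ.* ℚ.1/ B            ≡⟨ ℚ.*-inverseʳ B ⟩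
        1ℚ                      ≡⟨ inverse ⟨
        seq x t ℚ.* terms t     ≤⟨ ℚ.*-monoʳ-≤-nonNeg (terms t)
                                     {{ℚ.pos⇒nonNeg (terms t) {{terms-pos t}}}}
                                     (ℚ.≤-trans (p≤∣p∣ (seq x t)) ∣x∣≤B) ⟩
        B ℚ.* terms t           ∎)

-- For a variable `n` the fraction is stuck in its reduction to lowest terms, so the identity is
-- checked on unnormalised rationals, where it is integer arithmetic.
suc/1 : ∀ n → + suc n ℚ./ 1 ≡ 1ℚ ℚ.+ (+ n ℚ./ 1)
suc/1 n = ℚ.toℚᵘ-injective (begin
  ℚ.toℚᵘ (+ suc n ℚ./ 1)                  ≈⟨ ℚ.toℚᵘ-fromℚᵘ (mkℚᵘ (+ suc n) 0) ⟩
  mkℚᵘ (+ suc n) 0                        ≈⟨ *≡* (cong (ℤ._* + 1) (cong (ℤ._+_ (+ 1)) (sym (ℤ.*-identityʳ (+ n))))) ⟩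
  ℚ.toℚᵘ 1ℚ ℚᵘ.+ mkℚᵘ (+ n) 0             ≈⟨ ℚᵘ.+-congʳ (ℚ.toℚᵘ 1ℚ) (ℚ.toℚᵘ-fromℚᵘ (mkℚᵘ (+ n) 0)) ⟨
  ℚ.toℚᵘ 1ℚ ℚᵘ.+ ℚ.toℚᵘ (+ n ℚ./ 1)       ≈⟨ ℚ.toℚᵘ-homo-+ 1ℚ (+ n ℚ./ 1) ⟨
  ℚ.toℚᵘ (1ℚ ℚ.+ (+ n ℚ./ 1))             ∎)
  where open import Relation.Binary.Reasoning.Setoid ℚᵘ.≃-setoid

fromℕ-nonNeg : ∀ n → 0ℝ ≤ℝ fromℕ n
fromℕ-nonNeg n = termwise-≤ 0ℝ (fromℕ n) (λ _ → nonNeg n)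
  where
  nonNeg : ∀ n → 0ℚ ℚ.≤ + n ℚ./ 1
  nonNeg zero    = ℚ.≤-refl
  nonNeg (suc n) = subst (0ℚ ℚ.≤_) (sym (suc/1 n)) (ℚ.+-mono-≤ (ℚ.<⇒≤ 0<1) (nonNeg n))

*ℝ-comm : ∀ x y → x *ℝ y ≈ℝ y *ℝ x
*ℝ-comm x y = termwise-≈ (x *ℝ y) (y *ℝ x) (λ t → ℚ.*-comm (seq x t) (seq y t))

sumℚ-++ : ∀ m {n} (f : Fin (m ℕ.+ n) → ℚ) →
  sumℚ f ≡ sumℚ (λ i → f (i ↑ˡ n)) ℚ.+ sumℚ (λ i → f (m ↑ʳ i))
sumℚ-++ zero    f = sym (ℚ.+-identityˡ _)
sumℚ-++ (suc m) f = trans (cong (f zero ℚ.+_) (sumℚ-++ m (f ∘ suc))) (sym (ℚ.+-assoc (f zero) _ _))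

-- Coordinates of `ℓ₁` are indexed by `Fin m`, whereas probabilities are sums over the cube. The
-- listing is specified by preservation of sums, the form in which the two are compared.
enumeration : ∀ n → ∃[ m ] Σ (Fin m → 𝔽₂^ n) λ enum →
  ∀ (f : 𝔽₂^ n → ℚ) → sumℚ (f ∘ enum) ≡ ∑ℚ f
enumeration zero    = 1 , (λ _ → []) , λ f → ℚ.+-identityʳ (f [])
enumeration (suc n) with m , enum , sum≡ ← enumeration n =
  m ℕ.+ m , enum′ ∘ splitAt m , λ f → trans (sumℚ-++ m (f ∘ enum′ ∘ splitAt m)) (cong₂ ℚ._+_
    (trans (sumℚ-cong {n = m} (λ i → cong (f ∘ enum′) (Fin.splitAt-↑ˡ m i m))) (sum≡ (f ∘ (false ∷_))))
    (trans (sumℚ-cong {n = m} (λ i → cong (f ∘ enum′) (Fin.splitAt-↑ʳ m m i))) (sum≡ (f ∘ (true ∷_)))))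
  where
  enum′ : Fin m ⊎ Fin m → 𝔽₂^ (suc n)
  enum′ = [ (λ i → false ∷ enum i) , (λ i → true ∷ enum i) ]′

-- From testers to embeddings

infix 8 _when_
_when_ : ℝ → Bool → ℝ
x when b = if b then x else 0ℝ

∙-lincomb : (α : 𝔽₂^ n) (a : Fin k → 𝔽₂) (v : Fin k → 𝔽₂^ n) →
  (∀ i → α ∙ v i ≡ false) → α ∙ lincomb a v ≡ false
∙-lincomb {k = zero}  α a v α⊥v = ∙-zeroʳ α
∙-lincomb {k = suc k} α a v α⊥v = trans (∙-distribˡ-⊕ α (a zero ⊙ v zero) _)
  (cong₂ _xor_ (scaled (a zero)) (∙-lincomb α (a ∘ suc) (v ∘ suc) (α⊥v ∘ suc)))
  where
  scaled : ∀ b → α ∙ (b ⊙ v zero) ≡ false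
  scaled false = trans (cong (α ∙_) (⊙-false (v zero))) (∙-zeroʳ α)
  scaled true  = trans (cong (α ∙_) (⊙-true (v zero))) (α⊥v zero)

-- By bilinearity it suffices to test the finitely many basis vectors, which makes duality decidable
-- although `words` is an arbitrary predicate. A failed test yields a codeword on which `α` is odd.
dual-or-witness : (C : LinearCode n) → HasRate C k → ∀ α →
  dual C α ⊎ ∃[ c ] (c ∈ words C × α ∙ c ≡ true)
dual-or-witness C (b , b∈C , _ , spans) α with Fin.all? (λ i → α ∙ b i Bool.≟ false)
... | yes α⊥b = inj₁ λ c c∈C → let a , eq = spans c c∈C in
  trans (cong (α ∙_) (sym eq)) (∙-lincomb α a b α⊥b)
... | no ¬α⊥b with i , αbᵢ≢false ← Fin.¬∀⟶∃¬ _ _ (λ i → α ∙ b i Bool.≟ false) ¬α⊥b =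
  inj₂ (b i , b∈C i , Bool.¬-not (αbᵢ≢false ))

lincomb∈ : (C : LinearCode n) (a : Fin k → 𝔽₂) (v : Fin k → 𝔽₂^ n) →
  (∀ i → v i ∈ words C) → lincomb a v ∈ words C
lincomb∈ {k = zero}  C a v v∈C = 𝟎-closed C
lincomb∈ {k = suc k} C a v v∈C = ⊕-closed C (⊙-closed C (a zero) (v∈C zero))
  (lincomb∈ C (a ∘ suc) (v ∘ suc) (v∈C ∘ suc))

≡⇒≈ : ∀ {x y} → x ≡ y → x ≈ℝ y
≡⇒≈ {x} refl = ≈-refl x

when-distance : ∀ b b′ x → 0ℝ ≤ℝ x →
  ∣ x when b -ℝ x when b′ ∣ℝ ≈ℝ x when (b xor b′)
when-distance false false x _   = ≈-refl 0ℝ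
when-distance false true  x 0≤x = ≈-trans ∣ 0ℝ -ℝ x ∣ℝ ∣ x ∣ℝ x
  (termwise-≈ ∣ 0ℝ -ℝ x ∣ℝ ∣ x ∣ℝ (λ t →
    trans (cong ℚ.∣_∣ (ℚ.+-identityˡ (ℚ.- seq x t))) (ℚ.∣-p∣≡∣p∣ (seq x t))))
  (∣x∣≈x x 0≤x)
when-distance true  false x 0≤x = ≈-trans ∣ x -ℝ 0ℝ ∣ℝ ∣ x ∣ℝ x
  (termwise-≈ ∣ x -ℝ 0ℝ ∣ℝ ∣ x ∣ℝ (λ t → cong ℚ.∣_∣ (ℚ.+-identityʳ (seq x t))))
  (∣x∣≈x x 0≤x)
when-distance true  true  x _   =
  termwise-≈ ∣ x -ℝ x ∣ℝ 0ℝ (λ t → cong ℚ.∣_∣ (ℚ.+-inverseʳ (seq x t)))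

when-null : ∀ b b′ x → x ≈ℝ 0ℝ → x when b ≈ℝ x when b′
when-null false false x _   = ≈-refl 0ℝ
when-null false true  x x≈0 = ≈-sym x 0ℝ x≈0
when-null true  false x x≈0 = x≈0
when-null true  true  x _   = ≈-refl x

when-nonNeg : ∀ b x → 0ℝ ≤ℝ x → 0ℝ ≤ℝ x when b
when-nonNeg false x _   = ≈⇒≤ 0ℝ 0ℝ (≈-refl 0ℝ)
when-nonNeg true  x 0≤x = 0≤x

when-xor : ∀ b b′ x → 0ℝ ≤ℝ x → x when (b xor b′) ≤ℝ x when b +ℝ x when b′
when-xor false b′    x _   = termwise-≤ (x when b′) (0ℝ +ℝ x when b′) (λ t →
  ℚ.≤-reflexive (sym (ℚ.+-identityˡ _)))
when-xor true  false x _   = termwise-≤ x (x +ℝ 0ℝ) (λ t →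
  ℚ.≤-reflexive (sym (ℚ.+-identityʳ (seq x t))))
when-xor true  true  x 0≤x = begin
  0ℝ          ≈⟨ termwise-≈ 0ℝ (0ℝ +ℝ 0ℝ) (λ _ → refl) ⟩
  0ℝ +ℝ 0ℝ    ≲⟨ +ℝ-mono-≤ 0ℝ x 0ℝ x 0≤x 0≤x ⟩
  x +ℝ x      ∎
  where open ≤ℝ-Reasoning

∑-+ : (f g : 𝔽₂^ n → ℝ) → ∑ (λ v → f v +ℝ g v) ≈ℝ ∑ f +ℝ ∑ g
∑-+ f g = termwise-≈ (∑ (λ v → f v +ℝ g v)) (∑ f +ℝ ∑ g) (λ t →
  trans (seq-∑ (λ v → f v +ℝ g v) t) (trans (∑ℚ-+ (λ v → seq (f v) t) (λ v → seq (g v) t))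
    (sym (cong₂ ℚ._+_ (seq-∑ f t) (seq-∑ g t)))))

∑-nonNeg : (f : 𝔽₂^ n → ℝ) → (∀ v → 0ℝ ≤ℝ f v) → 0ℝ ≤ℝ ∑ f
∑-nonNeg {n} f 0≤f = begin
  0ℝ                    ≈⟨ termwise-≈ 0ℝ (∑ {n} (λ _ → 0ℝ)) (λ t →
                             sym (trans (seq-∑ {n} (λ _ → 0ℝ) t) (∑ℚ-0 n))) ⟩
  ∑ {n} (λ _ → 0ℝ)      ≲⟨ ∑-mono-≤ (λ _ → 0ℝ) f 0≤f ⟩
  ∑ f                   ∎
  where open ≤ℝ-Reasoning

∙-∷ʳ : (u : 𝔽₂^ (suc n)) → ∀ b v → u ∙ (b ∷ v) ≡ (head u ∧ b) xor (tail u ∙ v)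
∙-∷ʳ (_ ∷ _) b v = refl

lookup-head : (u : 𝔽₂^ (suc n)) → lookup u zero ≡ head u
lookup-head (_ ∷ _) = refl

lookup-tail : (u : 𝔽₂^ (suc n)) → ∀ i → lookup u (suc i) ≡ lookup (tail u) i
lookup-tail (_ ∷ _) i = refl

-- If `E α ∙ r` is odd, then `E α` is one somewhere on the support of `r`. The map `E` is there for
-- the induction on `r`: dropping a coordinate turns it into `tail ∘ E` while the sum still runs
-- over the same space.
union-bound : (p : 𝔽₂^ n → ℝ) → (∀ α → 0ℝ ≤ℝ p α) → ∀ ε (E : 𝔽₂^ n → 𝔽₂^ k) →
  (∀ i → ∑ (λ α → p α when lookup (E α) i) ≤ℝ ε) →
  ∀ r → ∑ (λ α → p α when (E α ∙ r)) ≤ℝ fromℕ (weight r) *ℝ ε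
union-bound {n} p p≥0 ε E smooth [] = begin
  ∑ (λ α → p α when (E α ∙ []))
    ≈⟨ ∑-cong (λ α → p α when (E α ∙ [])) (λ _ → 0ℝ) (λ α → ≡⇒≈ (cong (p α when_) (∙-[] (E α)))) ⟩
  ∑ {n} (λ _ → 0ℝ)
    ≈⟨ termwise-≈ (∑ {n} (λ _ → 0ℝ)) (fromℕ 0 *ℝ ε) (λ t →
         trans (seq-∑ {n} (λ _ → 0ℝ) t) (trans (∑ℚ-0 n) (sym (ℚ.*-zeroˡ (seq ε t))))) ⟩
  fromℕ 0 *ℝ ε ∎
  where
  open ≤ℝ-Reasoning
  ∙-[] : (u : 𝔽₂^ 0) → u ∙ [] ≡ false
  ∙-[] [] = refl
union-bound p p≥0 ε E smooth (b ∷ r) = extend b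
  where
  open ≤ℝ-Reasoning
  rest : ∑ (λ α → p α when (tail (E α) ∙ r)) ≤ℝ fromℕ (weight r) *ℝ ε
  rest = union-bound p p≥0 ε (tail ∘ E) (λ i → begin
    ∑ (λ α → p α when lookup (tail (E α)) i)
      ≈⟨ ∑-cong (λ α → p α when lookup (tail (E α)) i) (λ α → p α when lookup (E α) (suc i))
           (λ α → ≡⇒≈ (cong (p α when_) (sym (lookup-tail (E α) i)))) ⟩
    ∑ (λ α → p α when lookup (E α) (suc i))
      ≲⟨ smooth (suc i) ⟩
    ε ∎) r
  extend : ∀ b → ∑ (λ α → p α when (E α ∙ (b ∷ r))) ≤ℝ fromℕ (weight (b ∷ r)) *ℝ ε
  extend false = begin
    ∑ (λ α → p α when (E α ∙ (false ∷ r)))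
      ≈⟨ ∑-cong (λ α → p α when (E α ∙ (false ∷ r))) (λ α → p α when (tail (E α) ∙ r))
           (λ α → ≡⇒≈ (cong (p α when_) (trans (∙-∷ʳ (E α) false r)
             (cong (_xor (tail (E α) ∙ r)) (Bool.∧-zeroʳ (head (E α))))))) ⟩
    ∑ (λ α → p α when (tail (E α) ∙ r))
      ≲⟨ rest ⟩
    fromℕ (weight r) *ℝ ε ∎
  extend true = begin
    ∑ (λ α → p α when (E α ∙ (true ∷ r)))
      ≲⟨ ∑-mono-≤ (λ α → p α when (E α ∙ (true ∷ r)))
           (λ α → p α when lookup (E α) zero +ℝ p α when (tail (E α) ∙ r)) split ⟩
    ∑ (λ α → p α when lookup (E α) zero +ℝ p α when (tail (E α) ∙ r))
      ≈⟨ ∑-+ (λ α → p α when lookup (E α) zero) (λ α → p α when (tail (E α) ∙ r)) ⟩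
    ∑ (λ α → p α when lookup (E α) zero) +ℝ ∑ (λ α → p α when (tail (E α) ∙ r))
      ≲⟨ +ℝ-mono-≤ (∑ (λ α → p α when lookup (E α) zero)) ε
           (∑ (λ α → p α when (tail (E α) ∙ r))) (fromℕ (weight r) *ℝ ε) (smooth zero) rest ⟩
    ε +ℝ fromℕ (weight r) *ℝ ε
      ≈⟨ termwise-≈ (ε +ℝ fromℕ (weight r) *ℝ ε) (fromℕ (suc (weight r)) *ℝ ε) (λ t → sym
           (trans (cong (ℚ._* seq ε t) (suc/1 (weight r)))
             (trans (ℚ.*-distribʳ-+ (seq ε t) 1ℚ (+ weight r ℚ./ 1))
               (cong (ℚ._+ (+ weight r ℚ./ 1) ℚ.* seq ε t) (ℚ.*-identityˡ (seq ε t)))))) ⟩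
    fromℕ (suc (weight r)) *ℝ ε ∎
    where
    split : ∀ α → p α when (E α ∙ (true ∷ r)) ≤ℝ
      p α when lookup (E α) zero +ℝ p α when (tail (E α) ∙ r)
    split α = subst (λ b → p α when b ≤ℝ p α when lookup (E α) zero +ℝ p α when (tail (E α) ∙ r))
      (sym (trans (∙-∷ʳ (E α) true r) (cong (_xor (tail (E α) ∙ r))
        (trans (Bool.∧-identityʳ (head (E α))) (sym (lookup-head (E α)))))))
      (when-xor (lookup (E α) zero) (tail (E α) ∙ r) (p α) (p≥0 α))

code⇒cayley : ∀ {n} d k (ε δ : ℝ) (δ>0 : 0ℝ <ℝ δ) → 1 ℕ.≤ n →
  (Σ (LinearCode n) λ C → HasRate C k × HasDistance C d ×
    Σ (LocalTester C) λ D → IsSmooth D ε × HasSoundness D δ) →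
  ∃[ h ] (h ℕ.+ k ≡ n × Σ (Fin n → 𝔽₂^ h) λ S →
    Spanning S × WiseIndependent d S ×
    ShortestPathEmbedsIntoℓ₁ (Cay h S) (ε ÷ℝ δ [ δ>0 ]))
code⇒cayley {n} d k ε δ δ>0 1≤n (C , rate@(b , b∈C , b-indep , b-spans) , C-dist , D , smooth , sound) =
  from-cokernel (cokernel-sequence (combine b) (combine-linear b)
    (λ u eq → all-false⇒≡𝟎 u (b-indep (lookup u) eq)))
  where
  from-cokernel : ∃[ h ] (h ℕ.+ k ≡ n × Σ (𝔽₂^ n → 𝔽₂^ h) (ExactSequence (combine b))) →
    ∃[ h ] (h ℕ.+ k ≡ n × Σ (Fin n → 𝔽₂^ h) λ S → Spanning S × WiseIndependent d S ×
      ShortestPathEmbedsIntoℓ₁ (Cay h S) (ε ÷ℝ δ [ δ>0 ]))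
  from-cokernel (h , h+k≡n , H , exact) = h , h+k≡n , S , spanning ,
    distance⇒wise-independent d S (λ v Sv≡𝟎 → C-dist v (kernel⇒word v Sv≡𝟎)) ,
    ρ , (λ x y → lightest⇒shortest S (rep x y) (rep-end x y) (rep-min x y)) ,
    N , f , ε ÷ℝ δ [ δ>0 ] , ≈⇒≤ (ε ÷ℝ δ [ δ>0 ]) (ε ÷ℝ δ [ δ>0 ]) (≈-refl (ε ÷ℝ δ [ δ>0 ])) ,
    *ℝ-nonNeg ε (Reciprocal.reciprocal δ δ>0) 0≤ε (reciprocal-nonNeg δ δ>0) ,
    -- The scaling factor of the embedding is the soundness `δ`, so that distortion times scaling is
    -- `ε`.
    δ , δ>0 , λ x y → lower x y , upper x y
    where
    open ≤ℝ-Reasoning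
    open ExactSequence exact

    -- The generators are the columns of the parity check `H`.
    S : Fin n → 𝔽₂^ h
    S = H ∘ unit

    S≡H : ∀ v → combine S v ≡ H v
    S≡H = linear-combine f-linear

    spanning : Spanning S
    spanning x = let v , Hv≡x = surjective x in lookup v , trans (S≡H v) Hv≡x

    kernel⇒word : ∀ v → combine S v ≡ 𝟎 → v ∈ words C
    kernel⇒word v Sv≡𝟎 = let u , bu≡v = kernel v (trans (sym (S≡H v)) Sv≡𝟎) in
      subst (_∈ words C) bu≡v (lincomb∈ C (lookup u) b b∈C)

    word⇒kernel : ∀ v → v ∈ words C → combine S v ≡ 𝟎
    word⇒kernel v v∈C = let a , ba≡v = b-spans v v∈C in trans (S≡H v)
      (trans (cong H (trans (sym ba≡v) (sym (combine-tabulate a b)))) (composite (tabulate a)))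

    lift : 𝔽₂^ h → 𝔽₂^ n
    lift x = proj₁ (surjective x)

    lift-end : ∀ x y → combine S (lift x ⊕ lift y) ≡ x ⊕ y
    lift-end x y = trans (S≡H _) (trans (f-linear (lift x) (lift y))
      (cong₂ _⊕_ (proj₂ (surjective x)) (proj₂ (surjective y))))

    shortest : ∀ x y → ∃[ v ] (combine S v ≡ x ⊕ y × ∀ u → combine S u ≡ x ⊕ y → weight v ℕ.≤ weight u)
    shortest x y = lightest (λ v → combine S v ≟ᵛ x ⊕ y) (lift x ⊕ lift y , lift-end x y)

    rep : 𝔽₂^ h → 𝔽₂^ h → 𝔽₂^ n
    rep x y = proj₁ (shortest x y)

    rep-end : ∀ x y → combine S (rep x y) ≡ x ⊕ y
    rep-end x y = proj₁ (proj₂ (shortest x y))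

    rep-min : ∀ x y u → combine S u ≡ x ⊕ y → weight (rep x y) ℕ.≤ weight u
    rep-min x y = proj₂ (proj₂ (shortest x y))

    ρ : 𝔽₂^ h → 𝔽₂^ h → ℕ
    ρ x y = weight (rep x y)

    -- `lift x ⊕ lift y` and `rep x y` have the same syndrome, so they differ by a codeword, on
    -- which `α` is even.
    dual-rep : ∀ α x y → dual C α → (α ∙ lift x) xor (α ∙ lift y) ≡ α ∙ rep x y
    dual-rep α x y α⊥C = xor≡false⇒≡ _ _ (trans
      (sym (trans (∙-distribˡ-⊕ α (lift x ⊕ lift y) (rep x y))
        (cong (_xor (α ∙ rep x y)) (∙-distribˡ-⊕ α (lift x) (lift y)))))
      (α⊥C _ (kernel⇒word ((lift x ⊕ lift y) ⊕ rep x y)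
        (trans (combine-linear S (lift x ⊕ lift y) (rep x y))
          (trans (cong₂ _⊕_ (lift-end x y) (rep-end x y)) (⊕-self (x ⊕ y)))))))

    p : 𝔽₂^ n → ℝ
    p = mass D

    N : ℕ
    N = proj₁ (enumeration n)

    enum : Fin N → 𝔽₂^ n
    enum = proj₁ (proj₂ (enumeration n))

    sum-enum : ∀ (F : 𝔽₂^ n → ℚ) → sumℚ (F ∘ enum) ≡ ∑ℚ F
    sum-enum = proj₂ (proj₂ (enumeration n))

    f : 𝔽₂^ h → Fin N → ℝ
    f x i = p (enum i) when (enum i ∙ lift x)

    gap : 𝔽₂^ h → 𝔽₂^ h → 𝔽₂^ n → ℝ
    gap x y α = ∣ p α when (α ∙ lift x) -ℝ p α when (α ∙ lift y) ∣ℝ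

    -- Off the dual code the two parities may differ, but there the mass is null.
    gap≈ : ∀ x y α → gap x y α ≈ℝ p α when (α ∙ rep x y)
    gap≈ x y α = ≈-trans (gap x y α) (p α when ((α ∙ lift x) xor (α ∙ lift y))) (p α when (α ∙ rep x y))
      (when-distance (α ∙ lift x) (α ∙ lift y) (p α) (mass-≥0 D α))
      (compare (dual-or-witness C rate α))
      where
      compare : dual C α ⊎ ∃[ c ] (c ∈ words C × α ∙ c ≡ true) →
        p α when ((α ∙ lift x) xor (α ∙ lift y)) ≈ℝ p α when (α ∙ rep x y)
      compare (inj₁ α⊥C) = ≡⇒≈ (cong (p α when_) (dual-rep α x y α⊥C))
      compare (inj₂ (c , c∈C , αc≡1)) = when-null ((α ∙ lift x) xor (α ∙ lift y)) (α ∙ rep x y) (p α)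
        (support D α (λ α⊥C → contradiction (trans (sym αc≡1) (α⊥C c c∈C)) λ ()))

    seq-ℓ₁ : ∀ x y t → seq (ℓ₁ (f x) (f y)) t ≡ sumℚ (λ i → seq (gap x y (enum i)) t)
    seq-ℓ₁ x y t = seq-sumℝ (λ i → ∣ f x i -ℝ f y i ∣ℝ) t

    seq-∑gap : ∀ x y t → seq (ℓ₁ (f x) (f y)) t ≡ seq (∑ (gap x y)) t
    seq-∑gap x y t = trans (seq-ℓ₁ x y t) (trans (sum-enum (λ α → seq (gap x y α) t)) (sym (seq-∑ (gap x y) t)))

    ℓ₁≈∑gap : ∀ x y → ℓ₁ (f x) (f y) ≈ℝ ∑ (gap x y)
    ℓ₁≈∑gap x y = termwise-≈ (ℓ₁ (f x) (f y)) (∑ (gap x y)) (seq-∑gap x y)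

    ∑gap≈Pr : ∀ x y → ∑ (gap x y) ≈ℝ Pr D (λ α → α ∙ rep x y)
    ∑gap≈Pr x y = ∑-cong (gap x y) (λ α → p α when (α ∙ rep x y)) (gap≈ x y)

    ℓ₁≈Pr : ∀ x y → ℓ₁ (f x) (f y) ≈ℝ Pr D (λ α → α ∙ rep x y)
    ℓ₁≈Pr x y = ≈-trans (ℓ₁ (f x) (f y)) (∑ (gap x y)) (Pr D (λ α → α ∙ rep x y))
      (ℓ₁≈∑gap x y) (∑gap≈Pr x y)

    -- Smoothness at a single coordinate bounds a nonnegative probability by `ε`. This is where n ≥
    -- 1 enters.
    0≤ε : 0ℝ ≤ℝ ε
    0≤ε = begin
      0ℝ                                ≲⟨ ∑-nonNeg (λ α → p α when lookup α first)
                                             (λ α → when-nonNeg (lookup α first) (p α) (mass-≥0 D α)) ⟩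
      Pr D (λ α → lookup α first)       ≲⟨ smooth first ⟩
      ε                                 ∎
      where
      first : Fin n
      first = fromℕ< 1≤n

    lower : ∀ x y → δ *ℝ fromℕ (ρ x y) ≤ℝ ℓ₁ (f x) (f y)
    lower x y = begin
      δ *ℝ fromℕ (ρ x y)            ≲⟨ sound (rep x y) (ρ x y)
                                        (shortest⇒distance C S kernel⇒word word⇒kernel (rep x y) (ρ x y)
                                          (rep-end x y)
                                          (lightest⇒shortest S (rep x y) (rep-end x y) (rep-min x y))) ⟩
      Pr D (λ α → α ∙ rep x y)      ≈⟨ ℓ₁≈Pr x y ⟨
      ℓ₁ (f x) (f y)                ∎

    upper : ∀ x y → ℓ₁ (f x) (f y) ≤ℝ (ε ÷ℝ δ [ δ>0 ]) *ℝ δ *ℝ fromℕ (ρ x y)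
    upper x y = begin
      ℓ₁ (f x) (f y)                                  ≈⟨ ℓ₁≈Pr x y ⟩
      Pr D (λ α → α ∙ rep x y)                        ≲⟨ union-bound p (mass-≥0 D) ε id smooth (rep x y) ⟩
      fromℕ (ρ x y) *ℝ ε                              ≲⟨ *ℝ-monoˡ-≤ (fromℕ (ρ x y)) ε ((ε ÷ℝ δ [ δ>0 ]) *ℝ δ)
                                                           (fromℕ-nonNeg (ρ x y))
                                                           (≈⇒≤ ε ((ε ÷ℝ δ [ δ>0 ]) *ℝ δ)
                                                             (≈-sym ((ε ÷ℝ δ [ δ>0 ]) *ℝ δ) ε (÷-* δ δ>0 ε))) ⟩
      fromℕ (ρ x y) *ℝ ((ε ÷ℝ δ [ δ>0 ]) *ℝ δ)        ≈⟨ *ℝ-comm (fromℕ (ρ x y)) ((ε ÷ℝ δ [ δ>0 ]) *ℝ δ) ⟩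
      (ε ÷ℝ δ [ δ>0 ]) *ℝ δ *ℝ fromℕ (ρ x y)          ∎

-- From embeddings to testers

∑ℚ-nonNeg : (f : 𝔽₂^ n → ℚ) → (∀ v → 0ℚ ℚ.≤ f v) → 0ℚ ℚ.≤ ∑ℚ f
∑ℚ-nonNeg {n} f 0≤f = ℚ.≤-trans (ℚ.≤-reflexive (sym (∑ℚ-0 n))) (∑ℚ-mono 0≤f)

f𝟎≤∑ℚ : (f : 𝔽₂^ n → ℚ) → (∀ v → 0ℚ ℚ.≤ f v) → f 𝟎 ℚ.≤ ∑ℚ f
f𝟎≤∑ℚ {zero}  f 0≤f = ℚ.≤-refl
f𝟎≤∑ℚ {suc n} f 0≤f = subst (ℚ._≤ ∑ℚ f) (ℚ.+-identityʳ (f 𝟎)) (ℚ.+-mono-≤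
  (f𝟎≤∑ℚ (f ∘ (false ∷_)) (0≤f ∘ (false ∷_))) (∑ℚ-nonNeg (f ∘ (true ∷_)) (0≤f ∘ (true ∷_))))

autocorrelation-𝟎 : (φ : Fin m → 𝔽₂^ n → ℚ) → autocorrelation φ 𝟎 ≡ 0ℚ
autocorrelation-𝟎 {m} {n} φ = trans
  (∑ℚ-cong (λ v → trans (sumℚ-cong (λ i → vanish i v)) (sumℚ-0 m))) (∑ℚ-0 n)
  where
  vanish : ∀ i v → ℚ.∣ φ i (v ⊕ 𝟎) ℚ.- φ i v ∣ ≡ 0ℚ
  vanish i v = trans (cong (λ u → ℚ.∣ φ i u ℚ.- φ i v ∣) (⊕-identityʳ v))
    (cong ℚ.∣_∣ (ℚ.+-inverseʳ (φ i v)))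

autocorrelation-invariant : (φ : Fin m → 𝔽₂^ n → ℚ) → ∀ c → (∀ i v → φ i (c ⊕ v) ≡ φ i v) →
  ∀ v → autocorrelation φ (c ⊕ v) ≡ autocorrelation φ v
autocorrelation-invariant φ c φ-inv v = ∑ℚ-cong (λ u → sumℚ-cong (λ i →
  cong (λ p → ℚ.∣ p ℚ.- φ i u ∣) (trans (cong (φ i) (swap u)) (φ-inv i (u ⊕ v)))))
  where
  swap : ∀ u → u ⊕ (c ⊕ v) ≡ c ⊕ (u ⊕ v)
  swap u = trans (sym (⊕-assoc u c v)) (trans (cong (_⊕ v) (⊕-comm u c)) (⊕-assoc c u v))

-- The Fourier weights of the translation-averaged metric of φ.  The weight at 𝟎 is irrelevant for the
-- metric; choosing it to be 1 makes the total weight positive.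
module Spectrum (φ : 𝔽₂^ n → Fin m → ℝ) where

  term : ℕ → Fin m → 𝔽₂^ n → ℚ
  term t i v = seq (φ v i) t

  averaged : 𝔽₂^ n → ℝ
  averaged r = ∑ (λ v → ℓ₁ (φ (v ⊕ r)) (φ v))

  seq-averaged : ∀ r t → seq (averaged r) t ≡ autocorrelation (term t) r
  seq-averaged r t = trans (seq-∑ (λ v → ℓ₁ (φ (v ⊕ r)) (φ v)) t)
    (∑ℚ-cong (λ v → seq-sumℝ (λ i → ∣ φ (v ⊕ r) i -ℝ φ v i ∣ℝ) t))

  coefficient : 𝔽₂^ n → ℝ
  coefficient a = ∑ (λ v → fromℚ (χ (a ∙ v)) *ℝ averaged v)

  F : ℕ → 𝔽₂^ n → ℚ
  F t = fourier (autocorrelation (term t))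

  seq-coefficient : ∀ a t → seq (coefficient a) t ≡ F t a
  seq-coefficient a t = trans (seq-∑ (λ v → fromℚ (χ (a ∙ v)) *ℝ averaged v) t)
    (∑ℚ-cong (λ v → cong (χ (a ∙ v) ℚ.*_) (seq-averaged v t)))

  -- The decision is an argument so that facts about `spectrum` can be proved by cases on it.
  weightOf : ∀ a → Dec (a ≡ 𝟎) → ℝ
  weightOf a (yes _) = 1ℝ
  weightOf a (no  _) = -ℝ coefficient a

  spectrum : 𝔽₂^ n → ℝ
  spectrum a = weightOf a (a ≟ᵛ 𝟎)

  spectrum-𝟎 : ∀ t → seq (spectrum 𝟎) t ≡ 1ℚ
  spectrum-𝟎 t = at (𝟎 ≟ᵛ 𝟎)
    where
    at : ∀ 𝟎≟𝟎 → seq (weightOf 𝟎 𝟎≟𝟎) t ≡ 1ℚ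
    at (yes _)   = refl
    at (no 𝟎≢𝟎) = contradiction refl 𝟎≢𝟎

  spectrum-≢𝟎 : ∀ a → ¬ a ≡ 𝟎 → ∀ t → seq (spectrum a) t ≡ ℚ.- F t a
  spectrum-≢𝟎 a a≢𝟎 t = at (a ≟ᵛ 𝟎)
    where
    at : ∀ a≟𝟎 → seq (weightOf a a≟𝟎) t ≡ ℚ.- F t a
    at (yes a≡𝟎) = contradiction a≡𝟎 a≢𝟎
    at (no _)    = cong ℚ.-_ (seq-coefficient a t)

  spectrum-nonNeg : ∀ a t → 0ℚ ℚ.≤ seq (spectrum a) t
  spectrum-nonNeg a t = at (a ≟ᵛ 𝟎)
    where
    at : ∀ a≟𝟎 → 0ℚ ℚ.≤ seq (weightOf a a≟𝟎) t
    at (yes _)   = ℚ.<⇒≤ 0<1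
    at (no a≢𝟎) = subst (0ℚ ℚ.≤_) (cong ℚ.-_ (sym (seq-coefficient a t)))
      (ℚ.neg-antimono-≤ (fourier-autocorrelation-nonPos (term t) a a≢𝟎))

  total : ℝ
  total = ∑ spectrum

  -- The weight at `𝟎` alone keeps every term of the total at least 1, even for a one-point graph,
  -- where all other weights vanish.
  total>0 : 0ℝ <ℝ total
  total>0 = 1ℚ , 0<1 , 0 , λ t _ → begin
    0ℚ ℚ.+ 1ℚ                        ≡⟨ ℚ.+-identityˡ 1ℚ ⟩
    1ℚ                               ≡⟨ spectrum-𝟎 t ⟨
    seq (spectrum 𝟎) t               ≤⟨ f𝟎≤∑ℚ (λ a → seq (spectrum a) t) (λ a → spectrum-nonNeg a t) ⟩
    ∑ℚ (λ a → seq (spectrum a) t)    ≡⟨ seq-∑ spectrum t ⟨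
    seq total t                      ∎
    where open ℚ.≤-Reasoning

  1/total : ℝ
  1/total = Reciprocal.reciprocal total total>0

  distribution : 𝔽₂^ n → ℝ
  distribution a = spectrum a *ℝ 1/total

  distribution-nonNeg : ∀ a → 0ℝ ≤ℝ distribution a
  distribution-nonNeg a = *ℝ-nonNeg (spectrum a) 1/total
    (termwise-≤ 0ℝ (spectrum a) (spectrum-nonNeg a)) (reciprocal-nonNeg total total>0)

  distribution-sum : ∑ distribution ≈ℝ 1ℝ
  distribution-sum = ≈-trans (∑ distribution) (total *ℝ 1/total) 1ℝ
    (termwise-≈ (∑ distribution) (total *ℝ 1/total) (λ t → begin
      seq (∑ distribution) t
        ≡⟨ seq-∑ distribution t ⟩
      ∑ℚ (λ a → seq (spectrum a) t ℚ.* seq 1/total t)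
        ≡⟨ ∑ℚ-*ʳ (seq 1/total t) (λ a → seq (spectrum a) t) ⟩
      ∑ℚ (λ a → seq (spectrum a) t) ℚ.* seq 1/total t
        ≡⟨ cong (ℚ._* seq 1/total t) (seq-∑ spectrum t) ⟨
      seq total t ℚ.* seq 1/total t ∎))
    (reciprocal-inverse total total>0)
    where open ≡-Reasoning

  -- A period `c` of `φ` is a period of the averaged metric, so coefficients at frequencies odd on
  -- `c` vanish. The artificial weight at `𝟎` is not affected, since `𝟎` is even on every vector.
  distribution-vanishes : ∀ c → (∀ v i → φ (c ⊕ v) i ≡ φ v i) → ∀ a → a ∙ c ≡ true →
    distribution a ≈ℝ 0ℝ
  distribution-vanishes c φ-inv a a∙c≡1 = termwise-≈ (distribution a) 0ℝ (λ t → begin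
    seq (spectrum a) t ℚ.* seq 1/total t
      ≡⟨ cong (ℚ._* seq 1/total t) (spectrum-≢𝟎 a a≢𝟎 t) ⟩
    (ℚ.- F t a) ℚ.* seq 1/total t
      ≡⟨ cong (λ p → (ℚ.- p) ℚ.* seq 1/total t)
           (fourier-invariant (autocorrelation (term t)) c
             (autocorrelation-invariant (term t) c (λ i v → cong (λ x → seq x t) (φ-inv v i)))
             a a∙c≡1) ⟩
    0ℚ ℚ.* seq 1/total t
      ≡⟨ ℚ.*-zeroˡ (seq 1/total t) ⟩
    0ℚ ∎)
    where
    open ≡-Reasoning
    a≢𝟎 : ¬ a ≡ 𝟎
    a≢𝟎 refl = contradiction (trans (sym a∙c≡1) (∙-zeroˡ c)) λ ()

  -- The factor 2ⁿ comes from Fourier inversion and ½ from the indicator ½(1 - χ); the reciprocal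
  -- normalises the total mass.
  scale : ℝ
  scale = fromℚ (½ ℚ.* pow2 n) *ℝ 1/total

  -- The indicator of odd parity is ½(1 - χ), so the sum combines the inversion formulas at `r` and
  -- at `𝟎`, where the averaged metric is zero. The artificial weight at `𝟎` drops out because
  -- `𝟎 ∙ r` is even.
  odd-mass : ∀ r → ∑ (λ a → distribution a when (a ∙ r)) ≈ℝ scale *ℝ averaged r
  odd-mass r = termwise-≈ (∑ (λ a → distribution a when (a ∙ r))) (scale *ℝ averaged r) (λ t →
    let R = seq 1/total t in begin
    seq (∑ (λ a → distribution a when (a ∙ r))) t
      ≡⟨ seq-∑ (λ a → distribution a when (a ∙ r)) t ⟩
    ∑ℚ (λ a → seq (distribution a when (a ∙ r)) t)
      ≡⟨ ∑ℚ-cong (pointwise t) ⟩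
    ∑ℚ (λ a → (½ ℚ.* R) ℚ.* (χ (a ∙ r) ℚ.* F t a ℚ.+ ℚ.- F t a))
      ≡⟨ ∑ℚ-*ˡ (½ ℚ.* R) (λ a → χ (a ∙ r) ℚ.* F t a ℚ.+ ℚ.- F t a) ⟩
    (½ ℚ.* R) ℚ.* ∑ℚ (λ a → χ (a ∙ r) ℚ.* F t a ℚ.+ ℚ.- F t a)
      ≡⟨ cong ((½ ℚ.* R) ℚ.*_) (trans (∑ℚ-+ (λ a → χ (a ∙ r) ℚ.* F t a) (λ a → ℚ.- F t a))
           (cong₂ ℚ._+_ (fourier-inversion (autocorrelation (term t)) r)
             (trans (∑ℚ-neg (F t)) (cong ℚ.-_ (fourier-inversion-𝟎 (autocorrelation (term t))))))) ⟩
    (½ ℚ.* R) ℚ.* (pow2 n ℚ.* autocorrelation (term t) r ℚ.+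
      ℚ.- (pow2 n ℚ.* autocorrelation (term t) 𝟎))
      ≡⟨ cong₂ (λ p q → (½ ℚ.* R) ℚ.* (pow2 n ℚ.* p ℚ.+ ℚ.- (pow2 n ℚ.* q)))
           (sym (seq-averaged r t)) (autocorrelation-𝟎 (term t)) ⟩
    (½ ℚ.* R) ℚ.* (pow2 n ℚ.* seq (averaged r) t ℚ.+ ℚ.- (pow2 n ℚ.* 0ℚ))
      ≡⟨ solve 3 (λ R N G → (con ½ :* R) :* (N :* G :+ :- (N :* con 0ℚ)) := ((con ½ :* N) :* R) :* G)
           refl R (pow2 n) (seq (averaged r) t) ⟩
    ((½ ℚ.* pow2 n) ℚ.* R) ℚ.* seq (averaged r) t ∎)
    where
    open ≡-Reasoning
    open +-*-Solver
    pointwise : ∀ t a → seq (distribution a when (a ∙ r)) t ≡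
      (½ ℚ.* seq 1/total t) ℚ.* (χ (a ∙ r) ℚ.* F t a ℚ.+ ℚ.- F t a)
    pointwise t a = at (a ∙ r) refl
      where
      R : ℚ
      R = seq 1/total t
      at : ∀ b → a ∙ r ≡ b → seq (distribution a when b) t ≡
        (½ ℚ.* R) ℚ.* (χ b ℚ.* F t a ℚ.+ ℚ.- F t a)
      at false eq = solve 2 (λ R f → con 0ℚ := (con ½ :* R) :* (con 1ℚ :* f :+ :- f)) refl R (F t a)
      at true  eq = trans (cong (ℚ._* R) (spectrum-≢𝟎 a a≢𝟎 t))
        (solve 2 (λ R f → (:- f) :* R := (con ½ :* R) :* ((:- con 1ℚ) :* f :+ :- f)) refl R (F t a))
        where
        a≢𝟎 : ¬ a ≡ 𝟎
        a≢𝟎 refl = contradiction (trans (sym eq) (∙-zeroˡ r)) λ ()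

cayley⇒code : ∀ {n} d h (c : ℝ) →
  (Σ (Fin n → 𝔽₂^ h) λ S → Spanning S × WiseIndependent d S ×
    ShortestPathEmbedsIntoℓ₁ (Cay h S) c) →
  ∃[ k ] (k ℕ.+ h ≡ n × Σ (LinearCode n) λ C → HasRate C k × HasDistance C d ×
    Σ (LocalTester C) λ D → ∃[ ε ] ∃[ δ ] Σ (0ℝ <ℝ δ) λ δ>0 →
      0ℝ ≤ℝ ε × IsSmooth D ε × HasSoundness D δ × ε ÷ℝ δ [ δ>0 ] ≤ℝ c)
cayley⇒code {n} d h c (S , spanning , S-indep , ρ , ρ-min , m , f , c′ , c′≤c , 0≤c′ , α , α>0 , f-embeds) =
  from-kernel (kernel-sequence (combine S) (combine-linear S) (λ x →
    let a , Sa≡x = spanning x in tabulate a , trans (combine-tabulate a S) Sa≡x))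
  where
  from-kernel : ∃[ k ] (k ℕ.+ h ≡ n × Σ (𝔽₂^ k → 𝔽₂^ n) λ g → ExactSequence g (combine S)) →
    ∃[ k ] (k ℕ.+ h ≡ n × Σ (LinearCode n) λ C → HasRate C k × HasDistance C d ×
      Σ (LocalTester C) λ D → ∃[ ε ] ∃[ δ ] Σ (0ℝ <ℝ δ) λ δ>0 →
        0ℝ ≤ℝ ε × IsSmooth D ε × HasSoundness D δ × ε ÷ℝ δ [ δ>0 ] ≤ℝ c)
  from-kernel (k , k+h≡n , g , exact) = k , k+h≡n , C , rate ,
    wise-independent⇒distance d S S-indep , D , ε , δ , δ>0 , 0≤ε , smooth , sound , ratio
    where
    open ≤ℝ-Reasoning
    open ExactSequence exact
    open Spectrum (f ∘ combine S)

    C : LinearCode n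
    C = record
      { words    = λ v → combine S v ≡ 𝟎
      ; 𝟎-closed = linear-𝟎 f-linear
      ; ⊕-closed = λ {u} {v} Su≡𝟎 Sv≡𝟎 →
          trans (f-linear u v) (trans (cong₂ _⊕_ Su≡𝟎 Sv≡𝟎) (⊕-self 𝟎))
      ; ⊙-closed = λ where
          false {v} _    → trans (cong (combine S) (⊙-false v)) (linear-𝟎 f-linear)
          true  {v} Sv≡𝟎 → trans (cong (combine S) (⊙-true v)) Sv≡𝟎
      }

    rate : HasRate C k
    rate = g ∘ unit , composite ∘ unit , independent , spans
      where
      independent : LinearlyIndependent (g ∘ unit)
      independent a ga≡𝟎 i = trans (sym (Vec.lookup∘tabulate a i))
        (trans (cong (λ v → lookup v i) (injective (tabulate a)
          (trans (sym (linear-combine g-linear (tabulate a)))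
            (trans (combine-tabulate a (g ∘ unit)) ga≡𝟎))))
          (Vec.lookup-replicate i false))
      spans : ∀ v → combine S v ≡ 𝟎 → ∃[ a ] lincomb a (g ∘ unit) ≡ v
      spans v Sv≡𝟎 = let u , gu≡v = kernel v Sv≡𝟎 in
        lookup u , trans (linear-combine g-linear u) gu≡v

    D : LocalTester C
    D = record
      { mass     = distribution
      ; mass-≥0  = distribution-nonNeg
      ; mass-sum = distribution-sum
      ; support  = λ a a∉C⊥ → off-dual a a∉C⊥ (dual-or-witness C rate a)
      }
      where
      off-dual : ∀ a → ¬ dual C a → dual C a ⊎ ∃[ c ] (c ∈ words C × a ∙ c ≡ true) →
        distribution a ≈ℝ 0ℝ
      off-dual a a∉C⊥ (inj₁ a∈C⊥)                = contradiction a∈C⊥ a∉C⊥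
      off-dual a a∉C⊥ (inj₂ (c , Sc≡𝟎 , a∙c≡1)) = distribution-vanishes c (λ v i →
        cong (λ x → f x i) (trans (f-linear c v)
          (trans (cong (_⊕ combine S v) Sc≡𝟎) (⊕-identityˡ (combine S v))))) a a∙c≡1

    -- `averaged` sums over 2ⁿ vectors without dividing, so a bound valid at each vector is
    -- multiplied by 2ⁿ.
    scale′ : ℝ
    scale′ = scale *ℝ fromℚ (pow2 n)

    -- `δ` is the lower constant of the embedding after normalisation. Taking `ε` as `c′` times `δ`
    -- makes the ratio equal to the distortion `c′` of the embedding, which is then compared with
    -- `c`.
    δ ε : ℝ
    δ = α *ℝ scale′
    ε = c′ *ℝ δ

    pow2>0 : 0ℚ ℚ.< pow2 n
    pow2>0 = ℚ.<-≤-trans 0<1 (1≤pow2 n)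

    scale>0 : 0ℝ <ℝ scale
    scale>0 = *ℝ-pos (fromℚ (½ ℚ.* pow2 n)) 1/total (fromℚ-pos (½ ℚ.* pow2 n) (0<½*e pow2>0))
      (reciprocal-pos total total>0)

    0≤scale : 0ℝ ≤ℝ scale
    0≤scale = <ℝ⇒≤ℝ 0ℝ scale scale>0

    δ>0 : 0ℝ <ℝ δ
    δ>0 = *ℝ-pos α scale′ α>0 (*ℝ-pos scale (fromℚ (pow2 n)) scale>0 (fromℚ-pos (pow2 n) pow2>0))

    0≤ε : 0ℝ ≤ℝ ε
    0≤ε = *ℝ-nonNeg c′ δ 0≤c′ (<ℝ⇒≤ℝ 0ℝ δ δ>0)

    ratio : ε ÷ℝ δ [ δ>0 ] ≤ℝ c
    ratio = begin
      ε ÷ℝ δ [ δ>0 ]  ≈⟨ *-÷ δ δ>0 c′ ⟩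
      c′              ≲⟨ c′≤c ⟩
      c               ∎

    scaled-const : ∀ x → scale *ℝ ∑ {n} (λ _ → x) ≈ℝ x *ℝ scale′
    scaled-const x = termwise-≈ (scale *ℝ ∑ {n} (λ _ → x)) (x *ℝ scale′) (λ t →
      trans (cong (seq scale t ℚ.*_) (trans (seq-∑ {n} (λ _ → x) t) (∑ℚ-const n (seq x t))))
        (solve 3 (λ s N x → s :* (N :* x) := x :* (s :* N)) refl (seq scale t) (pow2 n) (seq x t)))
      where open +-*-Solver

    at-distance : ∀ r v → combine S r ≡ combine S (v ⊕ r) ⊕ combine S v
    at-distance r v = sym (trans (cong (_⊕ combine S v) (f-linear v r))
      (trans (⊕-comm (combine S v ⊕ combine S r) (combine S v)) (⊕-cancelˡ (combine S v) (combine S r))))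

    -- For every `v` the vertices `combine S (v ⊕ r)` and `combine S v` are at graph distance `m`,
    -- so the lower bound of the embedding applies to each summand of the average.
    sound : HasSoundness D δ
    sound r m r-min = begin
      δ *ℝ fromℕ m
        ≈⟨ termwise-≈ (δ *ℝ fromℕ m) (α *ℝ fromℕ m *ℝ scale′) (λ t →
             solve 3 (λ a s m → a :* s :* m := a :* m :* s) refl
               (seq α t) (seq scale′ t) (seq (fromℕ m) t)) ⟩
      α *ℝ fromℕ m *ℝ scale′
        ≈⟨ scaled-const (α *ℝ fromℕ m) ⟨
      scale *ℝ ∑ {n} (λ _ → α *ℝ fromℕ m)
        ≲⟨ *ℝ-monoˡ-≤ scale (∑ {n} (λ _ → α *ℝ fromℕ m)) (averaged r) 0≤scale
             (∑-mono-≤ (λ _ → α *ℝ fromℕ m) (λ v → ℓ₁ (f (combine S (v ⊕ r))) (f (combine S v))) below) ⟩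
      scale *ℝ averaged r
        ≈⟨ odd-mass r ⟨
      Pr D (λ a → a ∙ r) ∎
      where
      open +-*-Solver
      ρ≡m : ∀ v → ρ (combine S (v ⊕ r)) (combine S v) ≡ m
      ρ≡m v = distance-unique C r
        (shortest⇒distance C S (λ _ → id) (λ _ → id) r (ρ (combine S (v ⊕ r)) (combine S v))
          (at-distance r v) (ρ-min (combine S (v ⊕ r)) (combine S v))) r-min
      below : ∀ v → α *ℝ fromℕ m ≤ℝ ℓ₁ (f (combine S (v ⊕ r))) (f (combine S v))
      below v = begin
        α *ℝ fromℕ m
          ≈⟨ ≡⇒≈ (cong (λ j → α *ℝ fromℕ j) (ρ≡m v)) ⟨
        α *ℝ fromℕ (ρ (combine S (v ⊕ r)) (combine S v))
          ≲⟨ proj₁ (f-embeds (combine S (v ⊕ r)) (combine S v)) ⟩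
        ℓ₁ (f (combine S (v ⊕ r))) (f (combine S v)) ∎

    -- Reading coordinate `i` is the parity test with `unit i`, and adding `unit i` moves along a
    -- single edge of the graph.
    smooth : IsSmooth D ε
    smooth i = begin
      Pr D (λ a → lookup a i)
        ≈⟨ ∑-cong (λ a → distribution a when lookup a i) (λ a → distribution a when (a ∙ unit i))
             (λ a → ≡⇒≈ (cong (distribution a when_) (sym (∙-unit a i)))) ⟩
      Pr D (λ a → a ∙ unit i)
        ≈⟨ odd-mass (unit i) ⟩
      scale *ℝ averaged (unit i)
        ≲⟨ *ℝ-monoˡ-≤ scale (averaged (unit i)) (∑ {n} (λ _ → c′ *ℝ α)) 0≤scale
             (∑-mono-≤ (λ v → ℓ₁ (f (combine S (v ⊕ unit i))) (f (combine S v))) (λ _ → c′ *ℝ α) above) ⟩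
      scale *ℝ ∑ {n} (λ _ → c′ *ℝ α)
        ≈⟨ scaled-const (c′ *ℝ α) ⟩
      c′ *ℝ α *ℝ scale′
        ≈⟨ termwise-≈ (c′ *ℝ α *ℝ scale′) ε (λ t → ℚ.*-assoc (seq c′ t) (seq α t) (seq scale′ t)) ⟩
      ε ∎
      where
      0≤c′α : 0ℝ ≤ℝ c′ *ℝ α
      0≤c′α = *ℝ-nonNeg c′ α 0≤c′ (<ℝ⇒≤ℝ 0ℝ α α>0)
      fromℕ≤1 : ∀ {j} → j ℕ.≤ 1 → fromℕ j ≤ℝ 1ℝ
      fromℕ≤1 {zero}  _         = <ℝ⇒≤ℝ 0ℝ 1ℝ (fromℚ-pos 1ℚ 0<1)
      fromℕ≤1 {suc _} (s≤s z≤n) = ≈⇒≤ 1ℝ 1ℝ (≈-refl 1ℝ)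
      -- The distance is 0 when `S i` is `𝟎`, so only an upper bound is available; nonnegativity of
      -- `c′ *ℝ α` lets 1 take its place.
      ρ≤1 : ∀ v → ρ (combine S (v ⊕ unit i)) (combine S v) ℕ.≤ 1
      ρ≤1 v = ℕ.≤-trans
        (proj₂ (ρ-min (combine S (v ⊕ unit i)) (combine S v)) (weight (unit i))
          (vector⇒walk-to S (unit i) (at-distance (unit i) v)))
        (ℕ.≤-reflexive (weight-unit i))
      above : ∀ v → ℓ₁ (f (combine S (v ⊕ unit i))) (f (combine S v)) ≤ℝ c′ *ℝ α
      above v = begin
        ℓ₁ (f (combine S (v ⊕ unit i))) (f (combine S v))
          ≲⟨ proj₂ (f-embeds (combine S (v ⊕ unit i)) (combine S v)) ⟩
        c′ *ℝ α *ℝ fromℕ (ρ (combine S (v ⊕ unit i)) (combine S v))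
          ≲⟨ *ℝ-monoˡ-≤ (c′ *ℝ α) (fromℕ (ρ (combine S (v ⊕ unit i)) (combine S v))) 1ℝ
               0≤c′α (fromℕ≤1 (ρ≤1 v)) ⟩
        c′ *ℝ α *ℝ 1ℝ
          ≈⟨ termwise-≈ (c′ *ℝ α *ℝ 1ℝ) (c′ *ℝ α) (λ t → ℚ.*-identityʳ (seq (c′ *ℝ α) t)) ⟩
        c′ *ℝ α ∎

theorem1 : (n d : ℕ) → 1 ≤ n → 1 ≤ d →
    ((k : ℕ) (ε δ : ℝ) (δ>0 : 0ℝ <ℝ δ) →
    (Σ (LinearCode n) λ C → HasRate C k × HasDistance C d ×
    Σ (LocalTester C) λ D → IsSmooth D ε × HasSoundness D δ) →
    ∃[ h ] (h + k ≡ n × Σ (Fin n → 𝔽₂^ h) λ S →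
    Spanning S × WiseIndependent d S ×
    ShortestPathEmbedsIntoℓ₁ (Cay h S) (ε ÷ℝ δ [ δ>0 ])))
    ×
    ((h : ℕ) (c : ℝ) →
    (Σ (Fin n → 𝔽₂^ h) λ S → Spanning S × WiseIndependent d S ×
    ShortestPathEmbedsIntoℓ₁ (Cay h S) c) →
    ∃[ k ] (k + h ≡ n × Σ (LinearCode n) λ C → HasRate C k × HasDistance C d ×
    Σ (LocalTester C) λ D → ∃[ ε ] ∃[ δ ] Σ (0ℝ <ℝ δ) λ δ>0 →
    0ℝ ≤ℝ ε × IsSmooth D ε × HasSoundness D δ × ε ÷ℝ δ [ δ>0 ] ≤ℝ c))
theorem1 n d 1≤n _ = (λ k ε δ δ>0 → code⇒cayley d k ε δ δ>0 1≤n) , cayley⇒code d
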